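{- Let $q=2^m>4$ (with $m$ a positive integer) and let $E$ be a supersingular elliptic curve over $\mathbf{F}_q$. The number of curves in the family $$Y^2+Y=\lambda X+\mu X^3\qquad(\lambda\in\mathbf{F}_q,\ \mu\in\mathbf{F}_q^*)$$ that are isomorphic over $\mathbf{F}_q$ to $E$ (that is, the number of pairs $(\lambda,\mu)\in\mathbf{F}_q\times\mathbf{F}_q^*$ for which the corresponding curve is isomorphic to $E$ over $\mathbf{F}_q$) is equal to $$\frac{(q-1)\,(\#E(\mathbf{F}_q)-1)}{\#\mathrm{Aut}_{\mathbf{F}_q}(E)}.$$
   Context: The equation $Y^2+Y=\lambda X+\mu X^3$ with $\mu\neq 0$ stands for the associated smooth projective curve of genus $1$, viewed as an elliptic curve over $\mathbf{F}_q$ with the point at infinity as origin. $\mathrm{Aut}_{\mathbf{F}_q}(E)$ is the group of automorphisms of the elliptic curve $E$ (fixing the origin) defined over $\mathbf{F}_q$. An elliptic curve over a field of characteristic $2$ is supersingular if it has no points of order $2$ over the algebraic closure. -}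

module Defs where

open import Algebra.Bundles using (CommutativeRing)
open import Algebra.Morphism.Structures using (IsRingHomomorphism; IsRingIsomorphism)
import Algebra.Definitions.RawMonoid as RawMonoidDefs
open import Data.Fin.Base using (Fin)
open import Data.Maybe.Base using (Maybe; just; nothing)
import Data.Maybe.Relation.Binary.Pointwise as Maybe
open import Data.Nat.Base using (ℕ; suc)
open import Data.Product.Base using (Σ-syntax; ∃-syntax; _×_; _,_; proj₁)
open import Data.Product.Relation.Binary.Pointwise.NonDependent using (×-setoid)
open import Data.Vec.Base using (Vec; []; _∷_; map)
open import Function.Bundles using (Inverse)
open import Level using (Level; _⊔_) renaming (suc to lsuc)
open import Relation.Binary.Bundles using (Setoid)
open import Relation.Binary.Definitions using (Decidable)
open import Relation.Binary.PropositionalEquality.Core using (_≡_)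
open import Relation.Binary.PropositionalEquality.Properties using () renaming (setoid to ≡-setoid)
import Relation.Binary.Construct.On as On
open import Relation.Nullary using (¬_; yes; no)

private
  variable
    c ℓ c′ ℓ′ : Level

_HasCardinality_ : Setoid c ℓ → ℕ → Set (c ⊔ ℓ)
S HasCardinality n = Inverse S (≡-setoid (Fin n))

-- The value of _⁻¹ at zero is irrelevant.  Equality is required to be
-- decidable because the chord–tangent law below branches on it.
record Field c ℓ : Set (lsuc (c ⊔ ℓ)) where
  infix 9 _⁻¹
  field
    commutativeRing : CommutativeRing c ℓ
  open CommutativeRing commutativeRing public
  field
    _≟_      : Decidable _≈_
    0≉1      : 0# ≉ 1#
    _⁻¹      : Carrier → Carrier
    inverseʳ : ∀ {x} → x ≉ 0# → x * x ⁻¹ ≈ 1#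

-- The monic polynomial a₀ + a₁ x + ⋯ + aₙ₋₁ xⁿ⁻¹ + xⁿ evaluated at x.
evalMonic : (K : Field c ℓ) {n : ℕ} → Vec (Field.Carrier K) n → Field.Carrier K → Field.Carrier K
evalMonic K []       x = Field.1# K
evalMonic K (a ∷ as) x = a + x * evalMonic K as x
  where open Field K

record AlgebraicClosure (F : Field c ℓ) c′ ℓ′ : Set (c ⊔ ℓ ⊔ lsuc (c′ ⊔ ℓ′)) where
  field
    closure : Field c′ ℓ′
  private
    module F = Field F
    module K = Field closure
  field
    ι                   : F.Carrier → K.Carrier
    ι-isHomomorphism    : IsRingHomomorphism F.rawRing K.rawRing ι
    algebraic           : ∀ (y : K.Carrier) → ∃[ n ] Σ[ as ∈ Vec F.Carrier n ]
                            evalMonic closure (map ι as) y K.≈ K.0#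
    algebraicallyClosed : ∀ n (as : Vec K.Carrier (suc n)) → ∃[ x ]
                            evalMonic closure as x K.≈ K.0#

-- Polynomial expressions in two variables.  They represent elements of
-- A[X,Y] once they are identified modulo the ring laws, as in `_∼_` below.
data Poly {c} (A : Set c) : Set c where
  con     : A → Poly A
  X Y     : Poly A
  _:+_    : Poly A → Poly A → Poly A
  _:*_    : Poly A → Poly A → Poly A
  :-_     : Poly A → Poly A

infixl 6 _:+_ _:-_
infixl 7 _:*_
infix  8 :-_

_:-_ : {A : Set c} → Poly A → Poly A → Poly A
p :- q = p :+ (:- q)

module _ (F : Field c ℓ) where
  open Field F

  eval : Poly Carrier → Carrier → Carrier → Carrier
  eval (con a)  x y = a
  eval X        x y = x
  eval Y        x y = y
  eval (p :+ q) x y = eval p x y + eval q x y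
  eval (p :* q) x y = eval p x y * eval q x y
  eval (:- p)   x y = - eval p x y

-- The coordinate ring F[X,Y]/(W) of the affine curve W = 0, presented by
-- generators and relations: `_∼_` is the least congruence that makes the
-- expressions a commutative F-algebra in which W is zero.
module Coordinate (F : Field c ℓ) (W : Poly (Field.Carrier F)) where
  open Field F using (Carrier; _≈_; _+_; _*_; -_; 0#; 1#)

  infix 4 _∼_
  data _∼_ : Poly Carrier → Poly Carrier → Set (c ⊔ ℓ) where
    curve      : W ∼ con 0#
    con-cong   : ∀ {a b} → a ≈ b → con a ∼ con b
    con-+      : ∀ a b → con (a + b) ∼ con a :+ con b
    con-*      : ∀ a b → con (a * b) ∼ con a :* con b
    ∼-refl     : ∀ {p} → p ∼ p
    ∼-sym      : ∀ {p q} → p ∼ q → q ∼ p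
    ∼-trans    : ∀ {p q r} → p ∼ q → q ∼ r → p ∼ r
    +-cong     : ∀ {p p′ q q′} → p ∼ p′ → q ∼ q′ → p :+ q ∼ p′ :+ q′
    *-cong     : ∀ {p p′ q q′} → p ∼ p′ → q ∼ q′ → p :* q ∼ p′ :* q′
    neg-cong   : ∀ {p p′} → p ∼ p′ → :- p ∼ :- p′
    +-assoc    : ∀ p q r → (p :+ q) :+ r ∼ p :+ (q :+ r)
    +-comm     : ∀ p q → p :+ q ∼ q :+ p
    +-identity : ∀ p → con 0# :+ p ∼ p
    +-inverse  : ∀ p → :- p :+ p ∼ con 0#
    *-assoc    : ∀ p q r → (p :* q) :* r ∼ p :* (q :* r)
    *-comm     : ∀ p q → p :* q ∼ q :* p
    *-identity : ∀ p → con 1# :* p ∼ p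
    distribˡ   : ∀ p q r → p :* (q :+ r) ∼ p :* q :+ p :* r

  coordinateRing : CommutativeRing c (c ⊔ ℓ)
  coordinateRing = record
    { Carrier = Poly Carrier
    ; _≈_ = _∼_
    ; _+_ = _:+_
    ; _*_ = _:*_
    ; -_  = :-_
    ; 0#  = con 0#
    ; 1#  = con 1#
    ; isCommutativeRing = record
      { isRing = record
        { +-isAbelianGroup = record
          { isGroup = record
            { isMonoid = record
              { isSemigroup = record
                { isMagma = record
                  { isEquivalence = record { refl = ∼-refl ; sym = ∼-sym ; trans = ∼-trans }
                  ; ∙-cong = +-cong
                  }
                ; assoc = +-assoc
                }
              ; identity = +-identity , λ p → ∼-trans (+-comm p (con 0#)) (+-identity p)
              }
            ; inverse = +-inverse , λ p → ∼-trans (+-comm p (:- p)) (+-inverse p)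
            ; ⁻¹-cong = neg-cong
            }
          ; comm = +-comm
          }
        ; *-cong     = *-cong
        ; *-assoc    = *-assoc
        ; *-identity = *-identity , λ p → ∼-trans (*-comm p (con 1#)) (*-identity p)
        ; distrib    = distribˡ , λ p q r →
            ∼-trans (*-comm (q :+ r) p)
              (∼-trans (distribˡ p q r) (+-cong (*-comm p q) (*-comm p r)))
        }
      ; *-comm = *-comm
      }
    }

open Coordinate public using (coordinateRing)

-- F-algebra isomorphisms of coordinate rings.  For curves W = 0, W′ = 0 that
-- are elliptic curves with a single point O at infinity taken as origin, these
-- are the isomorphisms of elliptic curves defined over F: an isomorphism
-- preserving O restricts to the affine curves complementary to O, and an
-- isomorphism of those extends uniquely to the smooth projective models.
-- (An isomorphism of curves from W to W′ corresponds to one of rings from W′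
-- to W.)
record Isomorphism (F : Field c ℓ) (W W′ : Poly (Field.Carrier F)) : Set (c ⊔ ℓ) where
  private
    module F  = Field F
    module R  = CommutativeRing (coordinateRing F W)
    module R′ = CommutativeRing (coordinateRing F W′)
  field
    pullback          : R′.Carrier → R.Carrier
    isRingIsomorphism : IsRingIsomorphism R′.rawRing R.rawRing pullback
    fixes-constants   : ∀ a → pullback (con a) R.≈ con a

isomorphismSetoid : (F : Field c ℓ) (W W′ : Poly (Field.Carrier F)) → Setoid (c ⊔ ℓ) (c ⊔ ℓ)
isomorphismSetoid F W W′ = record
  { Carrier = Isomorphism F W W′
  ; _≈_     = λ φ ψ → ∀ p → pullback φ p R.≈ pullback ψ p
  ; isEquivalence = record
    { refl  = λ p → R.refl
    ; sym   = λ e p → R.sym (e p)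
    ; trans = λ e e′ p → R.trans (e p) (e′ p)
    }
  }
  where
  module R = CommutativeRing (coordinateRing F W)
  open Isomorphism

record Weierstrass (A : Set c) : Set c where
  constructor weierstrass
  field
    a₁ a₂ a₃ a₄ a₆ : A

mapWeierstrass : {A : Set c} {B : Set c′} → (A → B) → Weierstrass A → Weierstrass B
mapWeierstrass f (weierstrass a₁ a₂ a₃ a₄ a₆) =
  weierstrass (f a₁) (f a₂) (f a₃) (f a₄) (f a₆)

equation : {A : Set c} → Weierstrass A → Poly A
equation (weierstrass a₁ a₂ a₃ a₄ a₆) =
  (Y :* Y :+ con a₁ :* X :* Y :+ con a₃ :* Y)
    :- (X :* X :* X :+ con a₂ :* X :* X :+ con a₄ :* X :+ con a₆)

module _ (F : Field c ℓ) where
  open Field F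
  open RawMonoidDefs +-rawMonoid using () renaming (_×′_ to _·_)

  discriminant : Weierstrass Carrier → Carrier
  discriminant (weierstrass a₁ a₂ a₃ a₄ a₆) =
    - (b₂ * b₂ * b₈) - 8 · (b₄ * b₄ * b₄) - 27 · (b₆ * b₆) + 9 · (b₂ * b₄ * b₆)
    where
    b₂ = a₁ * a₁ + 4 · a₂
    b₄ = 2 · a₄ + a₁ * a₃
    b₆ = a₃ * a₃ + 4 · a₆
    b₈ = a₁ * a₁ * a₆ + 4 · (a₂ * a₆) - a₁ * a₃ * a₄ + a₂ * (a₃ * a₃) - a₄ * a₄

  record EllipticCurve : Set (c ⊔ ℓ) where
    field
      coefficients : Weierstrass Carrier
      nonsingular  : discriminant coefficients ≉ 0#

  OnCurve : Weierstrass Carrier → Carrier × Carrier → Set ℓ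
  OnCurve W (x , y) = eval F (equation W) x y ≈ 0#

  -- `nothing` is the point at infinity.
  pointSetoid : Weierstrass Carrier → Setoid (c ⊔ ℓ) (c ⊔ ℓ)
  pointSetoid W = Maybe.setoid (On.setoid (×-setoid setoid setoid) (proj₁ {B = OnCurve W}))

  -- The third point of the curve on the line of slope s through
  -- (x₁ , y₁) and (x₂ , y₂), negated.
  chordSum : Weierstrass Carrier → Carrier → Carrier × Carrier → Carrier × Carrier → Carrier × Carrier
  chordSum (weierstrass a₁ a₂ a₃ a₄ a₆) s (x₁ , y₁) (x₂ , y₂) =
    x₃ , - ((s + a₁) * x₃) - (y₁ - s * x₁) - a₃
    where
    x₃ = s * s + a₁ * s - a₂ - x₁ - x₂

  -- The chord–tangent law in coordinates.  It is the group law when the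
  -- arguments lie on the curve; in that case no denominator vanishes.
  add : Weierstrass Carrier →
        Maybe (Carrier × Carrier) → Maybe (Carrier × Carrier) → Maybe (Carrier × Carrier)
  add W nothing  Q        = Q
  add W (just P) nothing  = just P
  add W@(weierstrass a₁ a₂ a₃ a₄ a₆) (just P@(x₁ , y₁)) (just Q@(x₂ , y₂))
    with x₁ ≟ x₂ | (y₁ + y₂ + a₁ * x₂ + a₃) ≟ 0#
  ... | yes _ | yes _ = nothing
  ... | yes _ | no  _ = just (chordSum W tangent P Q)
    where
    tangent = (3 · (x₁ * x₁) + 2 · (a₂ * x₁) + a₄ - a₁ * y₁) * (2 · y₁ + a₁ * x₁ + a₃) ⁻¹
  ... | no  _ | _     = just (chordSum W ((y₂ - y₁) * (x₂ - x₁) ⁻¹) P Q)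

  HasPointOfOrder2 : Weierstrass Carrier → Set (c ⊔ ℓ)
  HasPointOfOrder2 W = ∃[ P ] OnCurve W P × add W (just P) (just P) ≡ nothing

  familyEquation : Carrier × Carrier → Poly Carrier
  familyEquation (l , μ) = (Y :* Y :+ Y) :- (con l :* X :+ con μ :* X :* X :* X)

open EllipticCurve public

module _ {F : Field c ℓ} where
  open Field F

  -- The definition appropriate to characteristic 2.
  Supersingular : AlgebraicClosure F c′ ℓ′ → EllipticCurve F → Set (c′ ⊔ ℓ′)
  Supersingular F̄ E = ¬ HasPointOfOrder2 closure (mapWeierstrass ι (coefficients E))
    where open AlgebraicClosure F̄

  rationalPoints : EllipticCurve F → Setoid (c ⊔ ℓ) (c ⊔ ℓ)
  rationalPoints E = pointSetoid F (coefficients E)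

  automorphisms : EllipticCurve F → Setoid (c ⊔ ℓ) (c ⊔ ℓ)
  automorphisms E = isomorphismSetoid F (equation (coefficients E)) (equation (coefficients E))

  -- The pairs (λ , μ) with μ ≠ 0 whose curve is isomorphic to E over F,
  -- compared as pairs: the choice of the isomorphism is not counted.
  isomorphicMembers : EllipticCurve F → Setoid (c ⊔ ℓ) ℓ
  isomorphicMembers E = On.setoid (×-setoid setoid setoid) (proj₁ {B = Member})
    where
    Member : Carrier × Carrier → Set (c ⊔ ℓ)
    Member (l , μ) = μ ≉ 0# × Isomorphism F (familyEquation F (l , μ)) (equation (coefficients E))

-- In characteristic 2, "no point of order 2" forces a₁ = 0, and nonsingularity
-- then forces a₃ ≠ 0.  Measuring elements of the coordinate ring by their pole
-- order at infinity (X has order 2, Y order 3) shows that every isomorphism to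
-- Y² + Y = λ X + μ X³ is a substitution X ↦ α X + β, Y ↦ γ Y + δ X + ε whose
-- coefficients satisfy finitely many equations.
--
-- The isomorphisms from E to members of the family are then counted twice.
-- Every member of the family passes through (0 , 0); an isomorphism is
-- determined by α ∈ F* and the affine point of E that it moves to (0 , 0), and
-- every such pair occurs because squaring is bijective on F.  Hence there are
-- (q − 1)(#E(F) − 1) of them.  On the other hand, those to a fixed member form
-- a torsor under Aut(E).

module Submission where

open import Defs
open import Algebra.Bundles using (CommutativeRing; RawRing)
import Algebra.Morphism.Construct.Composition as RingComposition
import Algebra.Morphism.Construct.Identity as RingIdentity
open import Algebra.Morphism.Structures using (IsRingHomomorphism; IsRingIsomorphism)
import Algebra.Properties.CommutativeMonoid.Sum as FiniteSum
import Algebra.Properties.Ring as RingProperties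
import Algebra.Properties.Semiring.Mult as Mult
import Algebra.Solver.Ring as RingSolver
open import Algebra.Solver.Ring.AlmostCommutativeRing
  using (fromCommutativeRing; _-Raw-AlmostCommutative⟶_)
open import Data.Bool.Base using (Bool; true; false; _xor_; _∧_)
open import Data.Fin.Base as Fin using (Fin; zero; suc; punchOut)
import Data.Fin.Permutation as Permutation
import Data.Fin.Properties as Fin
open import Data.Integer.Base as ℤ using (+_)
import Data.Integer.Properties as ℤ
open import Data.List.Base using (List; []; _∷_; drop; length)
open import Data.Maybe.Base using (Maybe; just; nothing)
import Data.Maybe.Relation.Binary.Pointwise as Maybe
open import Data.Nat.Base as ℕ using (ℕ; zero; suc; z≤n; s≤s; NonZero; _^_; _≤_; _<_)
import Data.Nat.Properties as ℕ
open import Data.Product.Base using (Σ-syntax; ∃-syntax; _×_; _,_; proj₁; proj₂)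
open import Data.Product.Relation.Binary.Pointwise.NonDependent using (×-setoid)
open import Data.Rational.Base using (_/_)
import Data.Rational.Properties as ℚ
open import Data.Rational.Unnormalised.Base using (mkℚᵘ; *≡*)
open import Data.Sum.Base as Sum using (_⊎_; inj₁; inj₂)
open import Data.Vec.Base using ([]; _∷_)
open import Function.Base using (id; _∘_)
open import Function.Bundles using (Inverse)
import Function.Construct.Composition as InverseComposition
import Function.Construct.Identity as InverseIdentity
import Function.Construct.Symmetry as InverseSymmetry
open import Level using (Level; _⊔_)
open import Relation.Binary.Bundles using (Setoid)
import Relation.Binary.Construct.On as On
open import Relation.Binary.Definitions using (Tri; tri<; tri≈; tri>)
open import Relation.Binary.PropositionalEquality as ≡ using (_≡_; _≢_)
import Relation.Binary.Reasoning.Setoid as SetoidReasoning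
open import Relation.Nullary using (¬_; Dec; yes; no; contradiction)
open import Relation.Nullary.Decidable using (map′; _×-dec_; ¬?)

private
  variable
    c ℓ c′ ℓ′ c₁ ℓ₁ c₂ ℓ₂ ℓ₃ : Level

CharTwo : CommutativeRing c ℓ → Set ℓ
CharTwo R = 1# + 1# ≈ 0#
  where open CommutativeRing R

module CharacteristicTwo (R : CommutativeRing c₁ ℓ₁)
  (1+1≈0 : CharTwo R) where

  open CommutativeRing R
  open RingProperties ring using (-0#≈0#)
  open SetoidReasoning setoid

  x+x≈0 : ∀ x → x + x ≈ 0#
  x+x≈0 x = begin
    x + x           ≈⟨ +-cong (*-identityˡ x) (*-identityˡ x) ⟨
    1# * x + 1# * x ≈⟨ distribʳ x 1# 1# ⟨
    (1# + 1#) * x   ≈⟨ *-congʳ 1+1≈0 ⟩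
    0# * x          ≈⟨ zeroˡ x ⟩
    0#              ∎

  -x≈x : ∀ x → - x ≈ x
  -x≈x x = begin
    - x           ≈⟨ +-identityʳ (- x) ⟨
    - x + 0#      ≈⟨ +-congˡ (x+x≈0 x) ⟨
    - x + (x + x) ≈⟨ +-assoc (- x) x x ⟨
    - x + x + x   ≈⟨ +-congʳ (-‿inverseˡ x) ⟩
    0# + x        ≈⟨ +-identityˡ x ⟩
    x             ∎

  x+y≈0⇒x≈y : ∀ {x y} → x + y ≈ 0# → x ≈ y
  x+y≈0⇒x≈y {x} {y} x+y≈0 = begin
    x           ≈⟨ +-identityʳ x ⟨
    x + 0#      ≈⟨ +-congˡ (x+x≈0 y) ⟨
    x + (y + y) ≈⟨ +-assoc x y y ⟨
    x + y + y   ≈⟨ +-congʳ x+y≈0 ⟩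
    0# + y      ≈⟨ +-identityˡ y ⟩
    y           ∎

  x≈y⇒x+y≈0 : ∀ {x y} → x ≈ y → x + y ≈ 0#
  x≈y⇒x+y≈0 {x} {y} x≈y = trans (+-congʳ x≈y) (x+x≈0 y)

  -- With coefficients in 𝔽₂ the ring solver knows that 1 + 1 = 0 and - x = x.
  private
    𝔽₂ : RawRing _ _
    𝔽₂ = record
      { Carrier = Bool ; _≈_ = _≡_ ; _+_ = _xor_ ; _*_ = _∧_ ; -_ = id ; 0# = false ; 1# = true }

    fromBool : Bool → Carrier
    fromBool false = 0#
    fromBool true  = 1#

    morphism : 𝔽₂ -Raw-AlmostCommutative⟶ fromCommutativeRing R
    morphism = record
      { ⟦_⟧    = fromBool
      ; +-homo = λ where
          false b     → sym (+-identityˡ (fromBool b))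
          true  false → sym (+-identityʳ 1#)
          true  true  → sym 1+1≈0
      ; *-homo = λ where
          false b → sym (zeroˡ (fromBool b))
          true  b → sym (*-identityˡ (fromBool b))
      ; -‿homo = λ where
          false → sym -0#≈0#
          true  → sym (-x≈x 1#)
      ; 0-homo = refl
      ; 1-homo = refl
      }

    decide : ∀ a b → Maybe (fromBool a ≈ fromBool b)
    decide false false = just refl
    decide true  true  = just refl
    decide _     _     = nothing

  open RingSolver 𝔽₂ (fromCommutativeRing R) morphism decide public
    using (Polynomial; solve)
    renaming (_:+_ to infixl 6 _⊕_; _:*_ to infixl 7 _⊗_; :-_ to ⊖_; _:=_ to infix 4 _⊜_; con to lit)

  :0 :1 : ∀ {n} → Polynomial n
  :0 = lit false
  :1 = lit true

module Series (R : CommutativeRing c₁ ℓ₁) where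

  open CommutativeRing R
  open SetoidReasoning setoid

  Series : Set c₁
  Series = ℕ → Carrier

  infix  4 _≋_
  infixl 6 _⊞_
  infixl 7 _⊛_ _·_

  _≋_ : Series → Series → Set ℓ₁
  f ≋ g = ∀ n → f n ≈ g n

  zeroₛ : Series
  zeroₛ _ = 0#

  const : Carrier → Series
  const a zero    = a
  const a (suc _) = 0#

  shift : Series → Series
  shift f zero    = 0#
  shift f (suc n) = f n

  tail : Series → Series
  tail f n = f (suc n)

  _⊞_ : Series → Series → Series
  (f ⊞ g) n = f n + g n

  _·_ : Carrier → Series → Series
  (a · f) n = a * f n

  neg : Series → Series
  neg f n = - f n

  _⊛_ : Series → Series → Series
  (f ⊛ g) zero    = f 0 * g 0
  (f ⊛ g) (suc n) = f 0 * g (suc n) + (tail f ⊛ g) n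

  ⊛-cong : ∀ {f f′ g g′} → f ≋ f′ → g ≋ g′ → f ⊛ g ≋ f′ ⊛ g′
  ⊛-cong p q zero    = *-cong (p 0) (q 0)
  ⊛-cong p q (suc n) = +-cong (*-cong (p 0) (q (suc n))) (⊛-cong (p ∘ suc) q n)

  swap-+ : ∀ x y z → x + (y + z) ≈ y + (x + z)
  swap-+ x y z = begin
    x + (y + z) ≈⟨ +-assoc x y z ⟨
    x + y + z   ≈⟨ +-congʳ (+-comm x y) ⟩
    y + x + z   ≈⟨ +-assoc y x z ⟩
    y + (x + z) ∎

  interchange-+ : ∀ w x y z → (w + x) + (y + z) ≈ (w + y) + (x + z)
  interchange-+ w x y z = begin
    (w + x) + (y + z) ≈⟨ +-assoc w x (y + z) ⟩
    w + (x + (y + z)) ≈⟨ +-congˡ (swap-+ x y z) ⟩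
    w + (y + (x + z)) ≈⟨ +-assoc w y (x + z) ⟨
    (w + y) + (x + z) ∎

  ⊛-sucʳ : ∀ f g n → (f ⊛ g) (suc n) ≈ g 0 * f (suc n) + (f ⊛ tail g) n
  ⊛-sucʳ f g zero = trans (+-comm _ _) (+-congʳ (*-comm (f 1) (g 0)))
  ⊛-sucʳ f g (suc n) = trans (+-congˡ (⊛-sucʳ (tail f) g n)) (swap-+ _ _ _)

  ⊛-comm : ∀ f g → f ⊛ g ≋ g ⊛ f
  ⊛-comm f g zero    = *-comm (f 0) (g 0)
  ⊛-comm f g (suc n) = trans (+-congˡ (⊛-comm (tail f) g n)) (sym (⊛-sucʳ g f n))

  ⊛-distribʳ : ∀ h f g → (f ⊞ g) ⊛ h ≋ f ⊛ h ⊞ g ⊛ h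
  ⊛-distribʳ h f g zero    = distribʳ _ _ _
  ⊛-distribʳ h f g (suc n) = trans
    (+-cong (distribʳ _ _ _) (⊛-distribʳ h (tail f) (tail g) n)) (interchange-+ _ _ _ _)

  ·-⊛ : ∀ a f g → (a · f) ⊛ g ≋ a · (f ⊛ g)
  ·-⊛ a f g zero    = *-assoc a (f 0) (g 0)
  ·-⊛ a f g (suc n) = trans
    (+-cong (*-assoc a _ _) (·-⊛ a (tail f) g n)) (sym (distribˡ a _ _))

  ⊛-assoc : ∀ f g h → (f ⊛ g) ⊛ h ≋ f ⊛ (g ⊛ h)
  ⊛-assoc f g h zero    = *-assoc _ _ _
  ⊛-assoc f g h (suc n) = begin
    f 0 * g 0 * h (suc n) + ((f 0 · tail g ⊞ tail f ⊛ g) ⊛ h) n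
      ≈⟨ +-congˡ (⊛-distribʳ h (f 0 · tail g) (tail f ⊛ g) n) ⟩
    f 0 * g 0 * h (suc n) + (((f 0 · tail g) ⊛ h) n + ((tail f ⊛ g) ⊛ h) n)
      ≈⟨ +-cong (*-assoc _ _ _) (+-cong (·-⊛ (f 0) (tail g) h n) (⊛-assoc (tail f) g h n)) ⟩
    f 0 * (g 0 * h (suc n)) + (f 0 * (tail g ⊛ h) n + (tail f ⊛ (g ⊛ h)) n)
      ≈⟨ +-assoc _ _ _ ⟨
    f 0 * (g 0 * h (suc n)) + f 0 * (tail g ⊛ h) n + (tail f ⊛ (g ⊛ h)) n
      ≈⟨ +-congʳ (distribˡ _ _ _) ⟨
    f 0 * (g ⊛ h) (suc n) + (tail f ⊛ (g ⊛ h)) n ∎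

  ⊛-zeroˡ : ∀ g → zeroₛ ⊛ g ≋ zeroₛ
  ⊛-zeroˡ g zero    = zeroˡ _
  ⊛-zeroˡ g (suc n) = trans (+-cong (zeroˡ _) (⊛-zeroˡ g n)) (+-identityˡ 0#)

  const-⊛ : ∀ a g → const a ⊛ g ≋ a · g
  const-⊛ a g zero    = refl
  const-⊛ a g (suc n) = trans (+-congˡ (⊛-zeroˡ g n)) (+-identityʳ _)

  shift-⊛ : ∀ f g → shift f ⊛ g ≋ shift (f ⊛ g)
  shift-⊛ f g zero    = zeroˡ _
  shift-⊛ f g (suc n) = trans (+-congʳ (zeroˡ _)) (+-identityˡ _)

  ⊛-identityˡ : ∀ g → const 1# ⊛ g ≋ g
  ⊛-identityˡ g n = trans (const-⊛ 1# g n) (*-identityˡ (g n))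

  seriesRing : CommutativeRing c₁ ℓ₁
  seriesRing = record
    { Carrier = Series
    ; _≈_ = _≋_
    ; _+_ = _⊞_
    ; _*_ = _⊛_
    ; -_  = neg
    ; 0#  = zeroₛ
    ; 1#  = const 1#
    ; isCommutativeRing = record
      { isRing = record
        { +-isAbelianGroup = record
          { isGroup = record
            { isMonoid = record
              { isSemigroup = record
                { isMagma = record
                  { isEquivalence = record
                    { refl = λ n → refl ; sym = λ p n → sym (p n) ; trans = λ p q n → trans (p n) (q n) }
                  ; ∙-cong = λ p q n → +-cong (p n) (q n)
                  }
                ; assoc = λ f g h n → +-assoc _ _ _
                }
              ; identity = (λ f n → +-identityˡ _) , (λ f n → +-identityʳ _)
              }
            ; inverse = (λ f n → -‿inverseˡ _) , (λ f n → -‿inverseʳ _)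
            ; ⁻¹-cong = λ p n → -‿cong (p n)
            }
          ; comm = λ f g n → +-comm _ _
          }
        ; *-cong     = ⊛-cong
        ; *-assoc    = ⊛-assoc
        ; *-identity = ⊛-identityˡ , λ g n → trans (⊛-comm g (const 1#) n) (⊛-identityˡ g n)
        ; distrib    = (λ f g h n → trans (⊛-comm f (g ⊞ h) n)
                         (trans (⊛-distribʳ f g h n) (+-cong (⊛-comm g f n) (⊛-comm h f n))))
                     , ⊛-distribʳ
        }
      ; *-comm = ⊛-comm
      }
    }

module QuadraticExtension (A : CommutativeRing c₁ ℓ₁)
  (1+1≈0 : CharTwo A) (h f : CommutativeRing.Carrier A) where

  open CommutativeRing A
  open CharacteristicTwo A 1+1≈0

  _⊡_ : Carrier × Carrier → Carrier × Carrier → Carrier × Carrier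
  (a , b) ⊡ (c , d) = a * c + b * d * f , a * d + b * c + b * d * h

  extension : CommutativeRing c₁ ℓ₁
  extension = record
    { Carrier = Carrier × Carrier
    ; _≈_ = λ (a , b) (c , d) → a ≈ c × b ≈ d
    ; _+_ = λ (a , b) (c , d) → a + c , b + d
    ; _*_ = _⊡_
    ; -_  = λ (a , b) → - a , - b
    ; 0#  = 0# , 0#
    ; 1#  = 1# , 0#
    ; isCommutativeRing = record
      { isRing = record
        { +-isAbelianGroup = record
          { isGroup = record
            { isMonoid = record
              { isSemigroup = record
                { isMagma = record
                  { isEquivalence = record
                    { refl = refl , refl
                    ; sym = λ (p , q) → sym p , sym q
                    ; trans = λ (p , q) (p′ , q′) → trans p p′ , trans q q′ }
                  ; ∙-cong = λ (p , q) (p′ , q′) → +-cong p p′ , +-cong q q′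
                  }
                ; assoc = λ _ _ _ → +-assoc _ _ _ , +-assoc _ _ _
                }
              ; identity = (λ _ → +-identityˡ _ , +-identityˡ _) , (λ _ → +-identityʳ _ , +-identityʳ _)
              }
            ; inverse = (λ _ → -‿inverseˡ _ , -‿inverseˡ _) , (λ _ → -‿inverseʳ _ , -‿inverseʳ _)
            ; ⁻¹-cong = λ (p , q) → -‿cong p , -‿cong q
            }
          ; comm = λ _ _ → +-comm _ _ , +-comm _ _
          }
        ; *-cong     = λ (p , q) (p′ , q′) →
            +-cong (*-cong p p′) (*-congʳ (*-cong q q′)) ,
            +-cong (+-cong (*-cong p q′) (*-cong q p′)) (*-congʳ (*-cong q q′))
        ; *-assoc    = λ (a , b) (c , d) (a′ , b′) →
            solve 8 (λ a b c d a′ b′ h f →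
              (a ⊗ c ⊕ b ⊗ d ⊗ f) ⊗ a′ ⊕ (a ⊗ d ⊕ b ⊗ c ⊕ b ⊗ d ⊗ h) ⊗ b′ ⊗ f
              ⊜ a ⊗ (c ⊗ a′ ⊕ d ⊗ b′ ⊗ f) ⊕ b ⊗ (c ⊗ b′ ⊕ d ⊗ a′ ⊕ d ⊗ b′ ⊗ h) ⊗ f)
              refl a b c d a′ b′ h f ,
            solve 8 (λ a b c d a′ b′ h f →
              (a ⊗ c ⊕ b ⊗ d ⊗ f) ⊗ b′ ⊕ (a ⊗ d ⊕ b ⊗ c ⊕ b ⊗ d ⊗ h) ⊗ a′
                ⊕ (a ⊗ d ⊕ b ⊗ c ⊕ b ⊗ d ⊗ h) ⊗ b′ ⊗ h
              ⊜ a ⊗ (c ⊗ b′ ⊕ d ⊗ a′ ⊕ d ⊗ b′ ⊗ h) ⊕ b ⊗ (c ⊗ a′ ⊕ d ⊗ b′ ⊗ f)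
                ⊕ b ⊗ (c ⊗ b′ ⊕ d ⊗ a′ ⊕ d ⊗ b′ ⊗ h) ⊗ h)
              refl a b c d a′ b′ h f
        ; *-identity = (λ (a , b) →
            solve 3 (λ a b f → :1 ⊗ a ⊕ :0 ⊗ b ⊗ f ⊜ a) refl a b f ,
            solve 3 (λ a b h → :1 ⊗ b ⊕ :0 ⊗ a ⊕ :0 ⊗ b ⊗ h ⊜ b) refl a b h) , (λ (a , b) →
            solve 3 (λ a b f → a ⊗ :1 ⊕ b ⊗ :0 ⊗ f ⊜ a) refl a b f ,
            solve 3 (λ a b h → a ⊗ :0 ⊕ b ⊗ :1 ⊕ b ⊗ :0 ⊗ h ⊜ b) refl a b h)
        ; distrib    = (λ (a , b) (c , d) (a′ , b′) →
            solve 7 (λ a b c d a′ b′ f →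
              a ⊗ (c ⊕ a′) ⊕ b ⊗ (d ⊕ b′) ⊗ f ⊜ a ⊗ c ⊕ b ⊗ d ⊗ f ⊕ (a ⊗ a′ ⊕ b ⊗ b′ ⊗ f))
              refl a b c d a′ b′ f ,
            solve 7 (λ a b c d a′ b′ h →
              a ⊗ (d ⊕ b′) ⊕ b ⊗ (c ⊕ a′) ⊕ b ⊗ (d ⊕ b′) ⊗ h
              ⊜ a ⊗ d ⊕ b ⊗ c ⊕ b ⊗ d ⊗ h ⊕ (a ⊗ b′ ⊕ b ⊗ a′ ⊕ b ⊗ b′ ⊗ h))
              refl a b c d a′ b′ h) , (λ (a , b) (c , d) (a′ , b′) →
            solve 7 (λ a b c d a′ b′ f →
              (c ⊕ a′) ⊗ a ⊕ (d ⊕ b′) ⊗ b ⊗ f ⊜ c ⊗ a ⊕ d ⊗ b ⊗ f ⊕ (a′ ⊗ a ⊕ b′ ⊗ b ⊗ f))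
              refl a b c d a′ b′ f ,
            solve 7 (λ a b c d a′ b′ h →
              (c ⊕ a′) ⊗ b ⊕ (d ⊕ b′) ⊗ a ⊕ (d ⊕ b′) ⊗ b ⊗ h
              ⊜ c ⊗ b ⊕ d ⊗ a ⊕ d ⊗ b ⊗ h ⊕ (a′ ⊗ b ⊕ b′ ⊗ a ⊕ b′ ⊗ b ⊗ h))
              refl a b c d a′ b′ h)
        }
      ; *-comm = λ (a , b) (c , d) →
          solve 5 (λ a b c d f → a ⊗ c ⊕ b ⊗ d ⊗ f ⊜ c ⊗ a ⊕ d ⊗ b ⊗ f) refl a b c d f ,
          solve 5 (λ a b c d h → a ⊗ d ⊕ b ⊗ c ⊕ b ⊗ d ⊗ h ⊜ c ⊗ b ⊕ d ⊗ a ⊕ d ⊗ b ⊗ h)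
            refl a b c d h
      }
    }

record Cubic (A : Set c) : Set c where
  constructor cubic
  field
    h μ a₂ a₄ a₆ : A

standard : {A : Set c} → Cubic A → Poly A
standard (cubic h μ a₂ a₄ a₆) =
  Y :* Y :+ con h :* Y :+ (con μ :* X :* X :* X :+ con a₂ :* X :* X :+ con a₄ :* X :+ con a₆)

-- (α , β , γ , δ , ε) stands for X ↦ α X + β, Y ↦ γ Y + δ X + ε.
Substitution : Set c → Set c
Substitution A = A × A × A × A × A

module _ {A : Set c} where

  image-X image-Y : Substitution A → Poly A
  image-X (α , β , γ , δ , ε) = con α :* X :+ con β
  image-Y (α , β , γ , δ , ε) = con γ :* Y :+ con δ :* X :+ con ε

  -- The coefficients of standard κ′ after the substitution, less γ² (standard κ);
  -- see evaluate-standard-substitution.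
  obstruction-Y obstruction-X³ obstruction-X² obstruction-X obstruction-1 :
    Cubic A → Cubic A → Substitution A → Poly A
  obstruction-Y (cubic h μ a₂ a₄ a₆) (cubic h′ μ′ a₂′ a₄′ a₆′) (α , β , γ , δ , ε) =
    con γ :* con γ :* con h :+ con h′ :* con γ
  obstruction-X³ (cubic h μ a₂ a₄ a₆) (cubic h′ μ′ a₂′ a₄′ a₆′) (α , β , γ , δ , ε) =
    con γ :* con γ :* con μ :+ con μ′ :* con α :* con α :* con α
  obstruction-X² (cubic h μ a₂ a₄ a₆) (cubic h′ μ′ a₂′ a₄′ a₆′) (α , β , γ , δ , ε) =
    con γ :* con γ :* con a₂ :+ con δ :* con δ
      :+ con μ′ :* con α :* con α :* con β :+ con a₂′ :* con α :* con α
  obstruction-X (cubic h μ a₂ a₄ a₆) (cubic h′ μ′ a₂′ a₄′ a₆′) (α , β , γ , δ , ε) =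
    con γ :* con γ :* con a₄ :+ con h′ :* con δ
      :+ con μ′ :* con α :* con β :* con β :+ con a₄′ :* con α
  obstruction-1 (cubic h μ a₂ a₄ a₆) (cubic h′ μ′ a₂′ a₄′ a₆′) (α , β , γ , δ , ε) =
    con γ :* con γ :* con a₆ :+ con ε :* con ε :+ con h′ :* con ε
      :+ con μ′ :* con β :* con β :* con β :+ con a₂′ :* con β :* con β :+ con a₄′ :* con β :+ con a₆′

-- Separate from the ring laws, so that evaluation in coordinate rings of
-- different curves is definitionally the same substitution.
module _ {A : Set c} {B : Set c′} (ι : A → B) (_+_ _*_ : B → B → B) (-_ : B → B) (x y : B) where

  evaluateWith : Poly A → B
  evaluateWith (con a)  = ι a
  evaluateWith X        = x
  evaluateWith Y        = y
  evaluateWith (p :+ q) = evaluateWith p + evaluateWith q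
  evaluateWith (p :* q) = evaluateWith p * evaluateWith q
  evaluateWith (:- p)   = - evaluateWith p

module Evaluation {F : Field c ℓ} (S : CommutativeRing c₁ ℓ₁)
  (ι : Field.Carrier F → CommutativeRing.Carrier S)
  (ι-hom : IsRingHomomorphism (Field.rawRing F) (CommutativeRing.rawRing S) ι) where

  private
    module F = Field F
    module S = CommutativeRing S
  open S
  open IsRingHomomorphism ι-hom
  open SetoidReasoning setoid

  evaluate : Carrier → Carrier → Poly F.Carrier → Carrier
  evaluate = evaluateWith ι _+_ _*_ (-_)

  evaluate-cong : ∀ {x x′ y y′} → x ≈ x′ → y ≈ y′ → ∀ p → evaluate x y p ≈ evaluate x′ y′ p
  evaluate-cong x≈x′ y≈y′ (con a)  = refl
  evaluate-cong x≈x′ y≈y′ X        = x≈x′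
  evaluate-cong x≈x′ y≈y′ Y        = y≈y′
  evaluate-cong x≈x′ y≈y′ (p :+ q) = +-cong (evaluate-cong x≈x′ y≈y′ p) (evaluate-cong x≈x′ y≈y′ q)
  evaluate-cong x≈x′ y≈y′ (p :* q) = *-cong (evaluate-cong x≈x′ y≈y′ p) (evaluate-cong x≈x′ y≈y′ q)
  evaluate-cong x≈x′ y≈y′ (:- p)   = -‿cong (evaluate-cong x≈x′ y≈y′ p)

  ι-eval : ∀ {a b} p → ι (eval F p a b) ≈ evaluate (ι a) (ι b) p
  ι-eval (con a)  = refl
  ι-eval X        = refl
  ι-eval Y        = refl
  ι-eval (p :+ q) = trans (+-homo _ _) (+-cong (ι-eval p) (ι-eval q))
  ι-eval (p :* q) = trans (*-homo _ _) (*-cong (ι-eval p) (ι-eval q))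
  ι-eval (:- p)   = trans (-‿homo _) (-‿cong (ι-eval p))

  module _ {W : Poly F.Carrier} {x y : Carrier} (onCurve : evaluate x y W ≈ 0#) where
    open Coordinate F W using (_∼_)

    evaluate-resp : ∀ {p q} → p ∼ q → evaluate x y p ≈ evaluate x y q
    evaluate-resp Coordinate.curve            = trans onCurve (sym 0#-homo)
    evaluate-resp (Coordinate.con-cong a≈b)   = ⟦⟧-cong a≈b
    evaluate-resp (Coordinate.con-+ a b)      = +-homo a b
    evaluate-resp (Coordinate.con-* a b)      = *-homo a b
    evaluate-resp Coordinate.∼-refl           = refl
    evaluate-resp (Coordinate.∼-sym e)        = sym (evaluate-resp e)
    evaluate-resp (Coordinate.∼-trans e e′)   = trans (evaluate-resp e) (evaluate-resp e′)
    evaluate-resp (Coordinate.+-cong e e′)    = +-cong (evaluate-resp e) (evaluate-resp e′)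
    evaluate-resp (Coordinate.*-cong e e′)    = *-cong (evaluate-resp e) (evaluate-resp e′)
    evaluate-resp (Coordinate.neg-cong e)     = -‿cong (evaluate-resp e)
    evaluate-resp (Coordinate.+-assoc p q r)  = +-assoc _ _ _
    evaluate-resp (Coordinate.+-comm p q)     = +-comm _ _
    evaluate-resp (Coordinate.+-identity p)   = trans (+-congʳ 0#-homo) (+-identityˡ _)
    evaluate-resp (Coordinate.+-inverse p)    = trans (-‿inverseˡ _) (sym 0#-homo)
    evaluate-resp (Coordinate.*-assoc p q r)  = *-assoc _ _ _
    evaluate-resp (Coordinate.*-comm p q)     = *-comm _ _
    evaluate-resp (Coordinate.*-identity p)   = trans (*-congʳ 1#-homo) (*-identityˡ _)
    evaluate-resp (Coordinate.distribˡ p q r) = distribˡ _ _ _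

    evaluate-isRingHomomorphism :
      IsRingHomomorphism (CommutativeRing.rawRing (coordinateRing F W)) S.rawRing (evaluate x y)
    evaluate-isRingHomomorphism = record
      { isSemiringHomomorphism = record
        { isNearSemiringHomomorphism = record
          { +-isMonoidHomomorphism = record
            { isMagmaHomomorphism = record
              { isRelHomomorphism = record { cong = evaluate-resp }
              ; homo = λ _ _ → refl }
            ; ε-homo = 0#-homo }
          ; *-homo = λ _ _ → refl }
        ; 1#-homo = 1#-homo }
      ; -‿homo = λ _ → refl }

  module _ {W : Poly F.Carrier} {φ : Poly F.Carrier → Carrier}
    (φ-hom : IsRingHomomorphism (CommutativeRing.rawRing (coordinateRing F W)) S.rawRing φ)
    (φ-con : ∀ a → φ (con a) ≈ ι a) where

    private
      module φ = IsRingHomomorphism φ-hom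

    hom≈evaluate : ∀ p → φ p ≈ evaluate (φ X) (φ Y) p
    hom≈evaluate (con a)  = φ-con a
    hom≈evaluate X        = refl
    hom≈evaluate Y        = refl
    hom≈evaluate (p :+ q) = trans (φ.+-homo p q) (+-cong (hom≈evaluate p) (hom≈evaluate q))
    hom≈evaluate (p :* q) = trans (φ.*-homo p q) (*-cong (hom≈evaluate p) (hom≈evaluate q))
    hom≈evaluate (:- p)   = trans (φ.-‿homo p) (-‿cong (hom≈evaluate p))

  module StandardSubstitution (1+1≈0 : 1# + 1# ≈ 0#) where
    open CharacteristicTwo S 1+1≈0

    evaluate-standard-substitution : ∀ κ κ′ α β γ δ ε x y → let σ = α , β , γ , δ , ε in
      evaluate (evaluate x y (image-X σ)) (evaluate x y (image-Y σ)) (standard κ′) ≈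
      ι γ * ι γ * evaluate x y (standard κ) +
      (evaluate x y (obstruction-1 κ κ′ σ) + evaluate x y (obstruction-X κ κ′ σ) * x
       + evaluate x y (obstruction-X² κ κ′ σ) * (x * x)
       + evaluate x y (obstruction-X³ κ κ′ σ) * (x * x * x)
       + evaluate x y (obstruction-Y κ κ′ σ) * y)
    evaluate-standard-substitution
      (cubic h μ a₂ a₄ a₆) (cubic h′ μ′ a₂′ a₄′ a₆′) α β γ δ ε x y =
      solve 17 (λ h μ a₂ a₄ a₆ h′ μ′ a₂′ a₄′ a₆′ α β γ δ ε x y →
        let X′ = α ⊗ x ⊕ β
            Y′ = γ ⊗ y ⊕ δ ⊗ x ⊕ ε
        in Y′ ⊗ Y′ ⊕ h′ ⊗ Y′ ⊕ (μ′ ⊗ X′ ⊗ X′ ⊗ X′ ⊕ a₂′ ⊗ X′ ⊗ X′ ⊕ a₄′ ⊗ X′ ⊕ a₆′)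
        ⊜ γ ⊗ γ ⊗ (y ⊗ y ⊕ h ⊗ y ⊕ (μ ⊗ x ⊗ x ⊗ x ⊕ a₂ ⊗ x ⊗ x ⊕ a₄ ⊗ x ⊕ a₆))
        ⊕ ((γ ⊗ γ ⊗ a₆ ⊕ ε ⊗ ε ⊕ h′ ⊗ ε ⊕ μ′ ⊗ β ⊗ β ⊗ β ⊕ a₂′ ⊗ β ⊗ β ⊕ a₄′ ⊗ β ⊕ a₆′)
          ⊕ (γ ⊗ γ ⊗ a₄ ⊕ h′ ⊗ δ ⊕ μ′ ⊗ α ⊗ β ⊗ β ⊕ a₄′ ⊗ α) ⊗ x
          ⊕ (γ ⊗ γ ⊗ a₂ ⊕ δ ⊗ δ ⊕ μ′ ⊗ α ⊗ α ⊗ β ⊕ a₂′ ⊗ α ⊗ α) ⊗ (x ⊗ x)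
          ⊕ (γ ⊗ γ ⊗ μ ⊕ μ′ ⊗ α ⊗ α ⊗ α) ⊗ (x ⊗ x ⊗ x)
          ⊕ (γ ⊗ γ ⊗ h ⊕ h′ ⊗ γ) ⊗ y))
        refl (ι h) (ι μ) (ι a₂) (ι a₄) (ι a₆) (ι h′) (ι μ′) (ι a₂′) (ι a₄′) (ι a₆′)
        (ι α) (ι β) (ι γ) (ι δ) (ι ε) x y

module _ {R : CommutativeRing c₁ ℓ₁} {S : CommutativeRing c₂ ℓ₂} where
  private
    module R = CommutativeRing R
    module S = CommutativeRing S

  module _ (1+1≈0 : R.1# R.+ R.1# R.≈ R.0#) (1+1≈0′ : S.1# S.+ S.1# S.≈ S.0#) where
    private
      module R₂ = CharacteristicTwo R 1+1≈0
      module S₂ = CharacteristicTwo S 1+1≈0′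

    isRingHomomorphism₂ : {φ : R.Carrier → S.Carrier} →
      (∀ {x y} → x R.≈ y → φ x S.≈ φ y) →
      (∀ x y → φ (x R.+ y) S.≈ φ x S.+ φ y) → φ R.0# S.≈ S.0# →
      (∀ x y → φ (x R.* y) S.≈ φ x S.* φ y) → φ R.1# S.≈ S.1# →
      IsRingHomomorphism R.rawRing S.rawRing φ
    isRingHomomorphism₂ φ-cong φ-+ φ-0 φ-* φ-1 = record
      { isSemiringHomomorphism = record
        { isNearSemiringHomomorphism = record
          { +-isMonoidHomomorphism = record
            { isMagmaHomomorphism = record
              { isRelHomomorphism = record { cong = φ-cong }
              ; homo = φ-+ }
            ; ε-homo = φ-0 }
          ; *-homo = φ-* }
        ; 1#-homo = φ-1 }
      ; -‿homo = λ x → S.trans (φ-cong (R₂.-x≈x x)) (S.sym (S₂.-x≈x _)) }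

module QuadraticExtensionProperties (A : CommutativeRing c₁ ℓ₁)
  (1+1≈0 : CharTwo A) (h f : CommutativeRing.Carrier A) where

  open CommutativeRing A
  open CharacteristicTwo A 1+1≈0
  open QuadraticExtension A 1+1≈0 h f public
  private module E = CommutativeRing extension

  embed : Carrier → Carrier × Carrier
  embed a = a , 0#

  root : Carrier × Carrier
  root = 0# , 1#

  extension-1+1≈0 : E.1# E.+ E.1# E.≈ E.0#
  extension-1+1≈0 = 1+1≈0 , +-identityˡ 0#

  embed-isRingHomomorphism : IsRingHomomorphism rawRing E.rawRing embed
  embed-isRingHomomorphism = isRingHomomorphism₂ {R = A} {S = extension} 1+1≈0 extension-1+1≈0
    (λ p → p , refl) (λ a b → refl , sym (+-identityˡ 0#)) E.refl
    (λ a b → solve 3 (λ a b f → a ⊗ b ⊜ a ⊗ b ⊕ :0 ⊗ :0 ⊗ f) refl a b f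
           , solve 3 (λ a b h → :0 ⊜ a ⊗ :0 ⊕ :0 ⊗ b ⊕ :0 ⊗ :0 ⊗ h) refl a b h)
    E.refl

  root-equation : root E.* root E.+ embed h E.* root E.+ embed f E.≈ E.0#
  root-equation =
    solve 2 (λ h f → :0 ⊗ :0 ⊕ :1 ⊗ :1 ⊗ f ⊕ (h ⊗ :0 ⊕ :0 ⊗ :1 ⊗ f) ⊕ f ⊜ :0) refl h f ,
    solve 1 (λ h → :0 ⊗ :1 ⊕ :1 ⊗ :0 ⊕ :1 ⊗ :1 ⊗ h ⊕ (h ⊗ :1 ⊕ :0 ⊗ :0 ⊕ :0 ⊗ :1 ⊗ h) ⊕ :0 ⊜ :0) refl h

  embed-* : ∀ a b → embed a E.* (b , 0#) E.≈ embed (a * b)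
  embed-* a b = E.sym (IsRingHomomorphism.*-homo embed-isRingHomomorphism a b)

  embed-*-root : ∀ a → embed a E.* root E.≈ (0# , a)
  embed-*-root a =
    solve 2 (λ a f → a ⊗ :0 ⊕ :0 ⊗ :1 ⊗ f ⊜ :0) refl a f ,
    solve 2 (λ a h → a ⊗ :1 ⊕ :0 ⊗ :0 ⊕ :0 ⊗ :1 ⊗ h ⊜ a) refl a h

module FieldOfCharacteristicTwo (F : Field c ℓ)
  (1+1≈0 : CharTwo (Field.commutativeRing F)) where

  open Field F hiding (_⁻¹; inverseʳ)
  open CharacteristicTwo commutativeRing 1+1≈0 public
  open Series commutativeRing public
  module 𝕊 = CommutativeRing seriesRing

  series-1+1≈0 : 𝕊.1# 𝕊.+ 𝕊.1# 𝕊.≈ 𝕊.0#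
  series-1+1≈0 zero    = 1+1≈0
  series-1+1≈0 (suc n) = +-identityˡ 0#

  const-isRingHomomorphism : IsRingHomomorphism rawRing 𝕊.rawRing const
  const-isRingHomomorphism = isRingHomomorphism₂ {R = commutativeRing} {S = seriesRing} 1+1≈0 series-1+1≈0
    (λ where a≈b zero → a≈b ; a≈b (suc n) → refl)
    (λ where a b zero → refl ; a b (suc n) → sym (+-identityˡ 0#))
    (λ where zero → refl ; (suc n) → refl)
    (λ where a b zero → refl ; a b (suc n) → sym (trans (const-⊛ a (const b) (suc n)) (zeroʳ a)))
    𝕊.refl

  variable-t : Series
  variable-t = shift (const 1#)

  variable-t-⊛ : ∀ f → variable-t ⊛ f ≋ shift f
  variable-t-⊛ f zero    = zeroˡ _
  variable-t-⊛ f (suc n) = trans (shift-⊛ (const 1#) f (suc n)) (⊛-identityˡ f n)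

  coefficients-of : List Carrier → Series
  coefficients-of []       = zeroₛ
  coefficients-of (a ∷ as) zero    = a
  coefficients-of (a ∷ as) (suc n) = coefficients-of as n

  horner : List Carrier → Poly Carrier
  horner []       = con 0#
  horner (a ∷ as) = con a :+ X :* horner as

  module Model (κ : Cubic Carrier) where
    open Cubic κ

    f-series : Series
    f-series = const μ ⊛ variable-t ⊛ variable-t ⊛ variable-t ⊞ const a₂ ⊛ variable-t ⊛ variable-t
      ⊞ const a₄ ⊛ variable-t ⊞ const a₆

    open QuadraticExtensionProperties seriesRing series-1+1≈0 (const h) f-series public
    module M = CommutativeRing extension

    ι : Carrier → M.Carrier
    ι a = embed (const a)

    ι-isRingHomomorphism : IsRingHomomorphism rawRing M.rawRing ι
    ι-isRingHomomorphism =
      RingComposition.isRingHomomorphism M.trans const-isRingHomomorphism embed-isRingHomomorphism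

    open Evaluation {F = F} extension ι ι-isRingHomomorphism

    nf : Poly Carrier → M.Carrier
    nf = evaluate (embed variable-t) root

    nf-standard : nf (standard κ) M.≈ M.0#
    nf-standard = M.trans (M.+-congˡ (M.+-congʳ (M.+-cong (M.+-cong
        (M.trans (M.*-congʳ (M.trans (M.*-congʳ (embed-* _ _)) (embed-* _ _))) (embed-* _ _))
        (M.trans (M.*-congʳ (embed-* _ _)) (embed-* _ _))) (embed-* _ _))))
      (M.trans (M.+-congˡ (𝕊.refl , λ n → trans (+-congʳ (trans (+-congʳ (+-identityˡ 0#)) (+-identityˡ 0#))) (+-identityˡ 0#))) root-equation)

    nf-horner : ∀ as → nf (horner as) M.≈ embed (coefficients-of as)
    nf-horner []       = (λ where zero → refl ; (suc n) → refl) , 𝕊.refl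
    nf-horner (a ∷ as) = M.trans (M.+-congˡ (M.trans (M.*-congˡ (nf-horner as)) (embed-* _ _)))
      ((λ where
          zero    → trans (+-congˡ (zeroˡ _)) (+-identityʳ a)
          (suc n) → trans (+-identityˡ _) (variable-t-⊛ (coefficients-of as) (suc n)))
      , λ n → +-identityˡ 0#)

    nf-span : ∀ as bs → nf (horner as :+ horner bs :* Y) M.≈ (coefficients-of as , coefficients-of bs)
    nf-span as bs = M.trans (M.+-cong (nf-horner as) (M.trans (M.*-congʳ (nf-horner bs)) (embed-*-root _)))
      ((λ n → +-identityʳ _) , λ n → +-identityˡ _)

  record Presents (W : Poly Carrier) (κ : Cubic Carrier) : Set (c ⊔ ℓ) where
    field
      standard∼0 : Coordinate._∼_ F W (standard κ) (con 0#)
      W∼0        : Coordinate._∼_ F (standard κ) W (con 0#)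

  module CoordinateRing (W : Poly Carrier) where
    open Coordinate F W using (con-cong; con-+; con-*) public
    module R = CommutativeRing (coordinateRing F W)

    R-1+1≈0 : R.1# R.+ R.1# R.≈ R.0#
    R-1+1≈0 = R.trans (R.sym (con-+ 1# 1#)) (con-cong 1+1≈0)

    module R₂ = CharacteristicTwo (coordinateRing F W) R-1+1≈0

    con-isRingHomomorphism : IsRingHomomorphism rawRing R.rawRing con
    con-isRingHomomorphism = isRingHomomorphism₂ {R = commutativeRing} {S = coordinateRing F W} 1+1≈0 R-1+1≈0
      con-cong con-+ R.refl con-* R.refl

    module Ev = Evaluation {F = F} (coordinateRing F W) con con-isRingHomomorphism

    horner-+ : ∀ as bs → ∃[ cs ] horner as :+ horner bs R.≈ horner cs
    horner-+ []       bs       = bs , R.+-identityˡ _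
    horner-+ (a ∷ as) []       = a ∷ as , R.+-identityʳ _
    horner-+ (a ∷ as) (b ∷ bs) = let cs , e = horner-+ as bs in a + b ∷ cs , R.trans
      (R₂.solve 5 (λ a b x p q → a R₂.⊕ x R₂.⊗ p R₂.⊕ (b R₂.⊕ x R₂.⊗ q)
        R₂.⊜ (a R₂.⊕ b) R₂.⊕ x R₂.⊗ (p R₂.⊕ q)) R.refl (con a) (con b) X (horner as) (horner bs))
      (R.+-cong (R.sym (con-+ a b)) (R.*-congˡ e))

    horner-con* : ∀ a as → ∃[ cs ] con a :* horner as R.≈ horner cs
    horner-con* a []       = [] , R.zeroʳ _
    horner-con* a (b ∷ bs) = let cs , e = horner-con* a bs in a * b ∷ cs , R.trans
      (R₂.solve 4 (λ a b x p → a R₂.⊗ (b R₂.⊕ x R₂.⊗ p) R₂.⊜ a R₂.⊗ b R₂.⊕ x R₂.⊗ (a R₂.⊗ p))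
        R.refl (con a) (con b) X (horner bs))
      (R.+-cong (R.sym (con-* a b)) (R.*-congˡ e))

    horner-* : ∀ as bs → ∃[ cs ] horner as :* horner bs R.≈ horner cs
    horner-* []       bs = [] , R.zeroˡ _
    horner-* (a ∷ as) bs =
      let cs , e   = horner-* as bs
          ds , e′  = horner-con* a bs
          es , e″ = horner-+ ds (0# ∷ cs)
      in es , R.trans
        (R₂.solve 4 (λ a x p q → (a R₂.⊕ x R₂.⊗ p) R₂.⊗ q R₂.⊜ a R₂.⊗ q R₂.⊕ (R₂.:0 R₂.⊕ x R₂.⊗ (p R₂.⊗ q)))
          R.refl (con a) X (horner as) (horner bs))
        (R.trans (R.+-cong e′ (R.+-congˡ (R.*-congˡ e))) e″)

    IsPolynomial : Poly Carrier → Set (c ⊔ ℓ)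
    IsPolynomial p = ∃[ as ] p R.≈ horner as

    isPolynomial-resp : ∀ {p q} → p R.≈ q → IsPolynomial q → IsPolynomial p
    isPolynomial-resp p≈q (as , e) = as , R.trans p≈q e

    isPolynomial-+ : ∀ {p q} → IsPolynomial p → IsPolynomial q → IsPolynomial (p :+ q)
    isPolynomial-+ (as , e) (bs , e′) = isPolynomial-resp (R.+-cong e e′) (horner-+ as bs)

    isPolynomial-* : ∀ {p q} → IsPolynomial p → IsPolynomial q → IsPolynomial (p :* q)
    isPolynomial-* (as , e) (bs , e′) = isPolynomial-resp (R.*-cong e e′) (horner-* as bs)

    isPolynomial-con : ∀ a → IsPolynomial (con a)
    isPolynomial-con a = a ∷ [] , R.sym (R.trans (R.+-congˡ (R.zeroʳ X)) (R.+-identityʳ _))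

    isPolynomial-X : IsPolynomial X
    isPolynomial-X = 0# ∷ 1# ∷ [] ,
      R₂.solve 1 (λ x → x R₂.⊜ R₂.:0 R₂.⊕ x R₂.⊗ (R₂.:1 R₂.⊕ x R₂.⊗ R₂.:0)) R.refl X

    HasSpan : Poly Carrier → Set (c ⊔ ℓ)
    HasSpan p = ∃[ as ] ∃[ bs ] p R.≈ horner as :+ horner bs :* Y

    module Spanning {κ : Cubic Carrier} (P : Presents W κ) where
      open Presents P
      open Cubic κ

      private
        span : ∀ {p a b} → IsPolynomial a → IsPolynomial b → p R.≈ a :+ b :* Y → HasSpan p
        span (as , e) (bs , e′) e″ = as , bs , R.trans e″ (R.+-cong e (R.*-congʳ e′))

        cubic-part : Poly Carrier
        cubic-part = con μ :* X :* X :* X :+ con a₂ :* X :* X :+ con a₄ :* X :+ con a₆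

        isPolynomial-cubic : IsPolynomial cubic-part
        isPolynomial-cubic = isPolynomial-+ (isPolynomial-+ (isPolynomial-+
          (isPolynomial-* (isPolynomial-* (isPolynomial-* (isPolynomial-con μ) isPolynomial-X) isPolynomial-X) isPolynomial-X)
          (isPolynomial-* (isPolynomial-* (isPolynomial-con a₂) isPolynomial-X) isPolynomial-X))
          (isPolynomial-* (isPolynomial-con a₄) isPolynomial-X)) (isPolynomial-con a₆)

      spanning : ∀ p → HasSpan p
      spanning (con a)  = span (isPolynomial-con a) (isPolynomial-con 0#)
        (R₂.solve 2 (λ a y → a R₂.⊜ a R₂.⊕ R₂.:0 R₂.⊗ y) R.refl (con a) Y)
      spanning X        = span isPolynomial-X (isPolynomial-con 0#)
        (R₂.solve 2 (λ a y → a R₂.⊜ a R₂.⊕ R₂.:0 R₂.⊗ y) R.refl X Y)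
      spanning Y        = span (isPolynomial-con 0#) (isPolynomial-con 1#)
        (R₂.solve 1 (λ y → y R₂.⊜ R₂.:0 R₂.⊕ R₂.:1 R₂.⊗ y) R.refl Y)
      spanning (p :+ q) =
        let as , bs , e  = spanning p
            cs , ds , e′ = spanning q
        in span (horner-+ as cs) (horner-+ bs ds) (R.trans (R.+-cong e e′)
          (R₂.solve 5 (λ a b c d y → (a R₂.⊕ b R₂.⊗ y) R₂.⊕ (c R₂.⊕ d R₂.⊗ y)
            R₂.⊜ a R₂.⊕ c R₂.⊕ (b R₂.⊕ d) R₂.⊗ y) R.refl (horner as) (horner bs) (horner cs) (horner ds) Y))
      spanning (p :* q) =
        let as , bs , e  = spanning p
            cs , ds , e′ = spanning q
            a = as , R.refl
            b = bs , R.refl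
            c = cs , R.refl
            d = ds , R.refl
        in span
          (isPolynomial-+ (isPolynomial-* a c) (isPolynomial-* (isPolynomial-* b d) isPolynomial-cubic))
          (isPolynomial-+ (isPolynomial-+ (isPolynomial-* a d) (isPolynomial-* b c))
            (isPolynomial-* (isPolynomial-* b d) (isPolynomial-con h)))
          (R.trans (R.*-cong e e′) (R.trans
            (R₂.solve 7 (λ a b c d y h f → (a R₂.⊕ b R₂.⊗ y) R₂.⊗ (c R₂.⊕ d R₂.⊗ y)
              R₂.⊜ a R₂.⊗ c R₂.⊕ b R₂.⊗ d R₂.⊗ f R₂.⊕ (a R₂.⊗ d R₂.⊕ b R₂.⊗ c R₂.⊕ b R₂.⊗ d R₂.⊗ h) R₂.⊗ y
                R₂.⊕ b R₂.⊗ d R₂.⊗ (y R₂.⊗ y R₂.⊕ h R₂.⊗ y R₂.⊕ f))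
              R.refl (horner as) (horner bs) (horner cs) (horner ds) Y (con h) cubic-part)
            (R.trans (R.+-congˡ (R.trans (R.*-congˡ standard∼0) (R.zeroʳ _))) (R.+-identityʳ _))))
      spanning (:- p)   = let as , bs , e = spanning p in as , bs , R.trans (R₂.-x≈x p) e

module FieldProperties (F : Field c ℓ) where
  open Field F

  inverseˡ : ∀ {x} → x ≉ 0# → x ⁻¹ * x ≈ 1#
  inverseˡ x≉0 = trans (*-comm _ _) (inverseʳ x≉0)

  *-cancelˡ : ∀ {x y z} → x ≉ 0# → x * y ≈ x * z → y ≈ z
  *-cancelˡ {x} {y} {z} x≉0 xy≈xz = begin
    y              ≈⟨ *-identityˡ y ⟨
    1# * y         ≈⟨ *-congʳ (inverseˡ x≉0) ⟨
    x ⁻¹ * x * y   ≈⟨ *-assoc _ _ _ ⟩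
    x ⁻¹ * (x * y) ≈⟨ *-congˡ xy≈xz ⟩
    x ⁻¹ * (x * z) ≈⟨ *-assoc _ _ _ ⟨
    x ⁻¹ * x * z   ≈⟨ *-congʳ (inverseˡ x≉0) ⟩
    1# * z         ≈⟨ *-identityˡ z ⟩
    z              ∎
    where open SetoidReasoning setoid

  xy≈0⇒y≈0 : ∀ {x y} → x ≉ 0# → x * y ≈ 0# → y ≈ 0#
  xy≈0⇒y≈0 x≉0 xy≈0 = *-cancelˡ x≉0 (trans xy≈0 (sym (zeroʳ _)))

  *-nonzero : ∀ {x y} → x ≉ 0# → y ≉ 0# → x * y ≉ 0#
  *-nonzero x≉0 y≉0 xy≈0 = y≉0 (xy≈0⇒y≈0 x≉0 xy≈0)

  x²≈0⇒x≈0 : ∀ {x} → x * x ≈ 0# → x ≈ 0#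
  x²≈0⇒x≈0 {x} x²≈0 with x ≟ 0#
  ... | yes x≈0 = x≈0
  ... | no  x≉0 = xy≈0⇒y≈0 x≉0 x²≈0

  ⁻¹-nonzero : ∀ {x} → x ≉ 0# → x ⁻¹ ≉ 0#
  ⁻¹-nonzero x≉0 x⁻¹≈0 = 0≉1 (trans (sym (zeroʳ _)) (trans (*-congˡ (sym x⁻¹≈0)) (inverseʳ x≉0)))

module SeriesDegree (F : Field c ℓ) (1+1≈0 : CharTwo (Field.commutativeRing F)) where

  open Field F hiding (_⁻¹; inverseʳ)
  open FieldProperties F
  open FieldOfCharacteristicTwo F 1+1≈0

  infix 4 _≼_

  _≼_ : Series → ℕ → Set ℓ
  f ≼ n = ∀ k → n ℕ.≤ k → f k ≈ 0#

  Degree : Series → ℕ → Set ℓ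
  Degree f n = f ≼ suc n × f n ≉ 0#

  ≼-resp : ∀ {f g n} → f ≋ g → g ≼ n → f ≼ n
  ≼-resp f≋g g≼n k n≤k = trans (f≋g k) (g≼n k n≤k)

  ≼-mono : ∀ {f m n} → m ℕ.≤ n → f ≼ m → f ≼ n
  ≼-mono m≤n f≼m k n≤k = f≼m k (ℕ.≤-trans m≤n n≤k)

  const-≼ : ∀ a → const a ≼ 1
  const-≼ a (suc k) _ = refl

  ≼-⊞ : ∀ {f g n} → f ≼ n → g ≼ n → f ⊞ g ≼ n
  ≼-⊞ f≼n g≼n k n≤k = trans (+-cong (f≼n k n≤k) (g≼n k n≤k)) (+-identityˡ 0#)

  ≼-shift : ∀ {f n} → f ≼ n → shift f ≼ suc n
  ≼-shift f≼n (suc k) (s≤s n≤k) = f≼n k n≤k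

  ≼-tail : ∀ {f n} → f ≼ suc n → tail f ≼ n
  ≼-tail f≼ k n≤k = f≼ (suc k) (s≤s n≤k)

  ≼-⊛ : ∀ {f g} n m → f ≼ suc n → g ≼ suc m → f ⊛ g ≼ suc (n ℕ.+ m)
  ≼-⊛ {f} {g} n m f≼ g≼ (suc k) (s≤s n+m≤k) = trans
    (+-cong (trans (*-congˡ (g≼ (suc k) (s≤s (ℕ.≤-trans (ℕ.m≤n+m m n) n+m≤k)))) (zeroʳ _))
            (rest n f≼ n+m≤k))
    (+-identityˡ 0#)
    where
    rest : ∀ n → f ≼ suc n → n ℕ.+ m ℕ.≤ k → (tail f ⊛ g) k ≈ 0#
    rest zero    f≼ _     = trans (⊛-cong {g = g} (λ n → f≼ (suc n) (s≤s z≤n)) (λ _ → refl) k) (⊛-zeroˡ g k)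
    rest (suc n) f≼ n+m<k = ≼-⊛ n m (≼-tail f≼) g≼ k n+m<k

  ⊛-top : ∀ {f g} n m → f ≼ suc n → g ≼ suc m → (f ⊛ g) (n ℕ.+ m) ≈ f n * g m
  ⊛-top {f} {g} zero m f≼ g≼ = trans
    (⊛-cong {g = g} (λ where zero → refl ; (suc k) → f≼ (suc k) (s≤s z≤n)) (λ _ → refl) m) (const-⊛ (f 0) g m)
  ⊛-top {f} {g} (suc n) m f≼ g≼ = trans
    (+-cong (trans (*-congˡ (g≼ _ (s≤s (ℕ.m≤n+m m n)))) (zeroʳ _)) (⊛-top n m (≼-tail f≼) g≼))
    (+-identityˡ _)

  degree-resp : ∀ {f g n} → f ≋ g → Degree g n → Degree f n
  degree-resp f≋g (g≼ , gn≉0) = ≼-resp f≋g g≼ , λ fn≈0 → gn≉0 (trans (sym (f≋g _)) fn≈0)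

  degree-⊞ : ∀ {f g n} → g ≼ n → Degree f n → Degree (g ⊞ f) n
  degree-⊞ {n = n} g≼n (f≼ , fn≉0) = ≼-⊞ (≼-mono (ℕ.n≤1+n n) g≼n) f≼ ,
    λ e → fn≉0 (trans (trans (sym (+-identityˡ _)) (+-congʳ (sym (g≼n n ℕ.≤-refl)))) e)

  degree-⊛ : ∀ {f g n m} → Degree f n → Degree g m → Degree (f ⊛ g) (n ℕ.+ m)
  degree-⊛ {n = n} {m} (f≼ , fn≉0) (g≼ , gm≉0) = ≼-⊛ n m f≼ g≼ ,
    λ e → *-nonzero fn≉0 gm≉0 (trans (sym (⊛-top n m f≼ g≼)) e)

  degree-unique : ∀ {f m n} → Degree f m → Degree f n → m ≡ n
  degree-unique (f≼m , fm≉0) (f≼n , fn≉0) = ℕ.≤-antisym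
    (ℕ.≮⇒≥ λ n<m → fm≉0 (f≼n _ n<m)) (ℕ.≮⇒≥ λ m<n → fn≉0 (f≼m _ m<n))

  degree-exists : ∀ {f} n → f ≼ n → f ≋ zeroₛ ⊎ ∃[ d ] Degree f d
  degree-exists zero    f≼0 = inj₁ λ k → f≼0 k z≤n
  degree-exists {f} (suc n) f≼ with f n ≟ 0#
  ... | no  fn≉0 = inj₂ (n , f≼ , fn≉0)
  ... | yes fn≈0 = degree-exists n λ k n≤k → case k n≤k
    where
    case : ∀ k → n ℕ.≤ k → f k ≈ 0#
    case k n≤k with ℕ.m≤n⇒m<n∨m≡n n≤k
    ... | inj₁ n<k     = f≼ k n<k
    ... | inj₂ ≡.refl = fn≈0

  coefficients-of-≼ : ∀ as → coefficients-of as ≼ length as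
  coefficients-of-≼ []       k       _         = refl
  coefficients-of-≼ (a ∷ as) (suc k) (s≤s l≤k) = coefficients-of-≼ as k l≤k

  -- f(t) ↦ f(t²)
  double : Series → Series
  double f zero          = f 0
  double f (suc zero)    = 0#
  double f (suc (suc n)) = double (tail f) n

  double-cong : ∀ {f g} → f ≋ g → double f ≋ double g
  double-cong p zero          = p 0
  double-cong p (suc zero)    = refl
  double-cong p (suc (suc n)) = double-cong (p ∘ suc) n

  double-⊞ : ∀ f g → double (f ⊞ g) ≋ double f ⊞ double g
  double-⊞ f g zero          = refl
  double-⊞ f g (suc zero)    = sym (+-identityˡ 0#)
  double-⊞ f g (suc (suc n)) = double-⊞ (tail f) (tail g) n

  double-· : ∀ a g → double (a · g) ≋ a · double g
  double-· a g zero          = refl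
  double-· a g (suc zero)    = sym (zeroʳ a)
  double-· a g (suc (suc n)) = double-· a (tail g) n

  double-⊛ : ∀ f g → double (f ⊛ g) ≋ double f ⊛ double g
  double-⊛ f g zero          = refl
  double-⊛ f g (suc zero)    = sym (trans (+-cong (zeroʳ _) (zeroˡ _)) (+-identityˡ 0#))
  double-⊛ f g (suc (suc n)) = trans (double-⊞ (f 0 · tail g) (tail f ⊛ g) n)
    (+-cong (double-· (f 0) (tail g) n)
      (trans (double-⊛ (tail f) g n) (sym (trans (+-congʳ (zeroˡ _)) (+-identityˡ _)))))

  double-zero : double zeroₛ ≋ zeroₛ
  double-zero zero          = refl
  double-zero (suc zero)    = refl
  double-zero (suc (suc n)) = double-zero n

  double-const : ∀ a → double (const a) ≋ const a
  double-const a zero          = refl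
  double-const a (suc zero)    = refl
  double-const a (suc (suc n)) = double-zero n

  double-t : double variable-t ≋ variable-t ⊛ variable-t
  double-t n = trans (lemma n) (sym (variable-t-⊛ variable-t n))
    where
    lemma : double variable-t ≋ shift variable-t
    lemma zero          = refl
    lemma (suc zero)    = refl
    lemma (suc (suc n)) = double-const 1# n

  double-even : ∀ f n → double f (n ℕ.* 2) ≡ f n
  double-even f zero    = ≡.refl
  double-even f (suc n) = double-even (tail f) n

  double-≼ : ∀ {f} n → f ≼ n → double f ≼ n ℕ.* 2
  double-≼ zero    f≼0 k             _                 = trans (double-cong (λ n → f≼0 n z≤n) k) (double-zero k)
  double-≼ (suc n) f≼  (suc (suc k)) (s≤s (s≤s 2n≤k)) = double-≼ n (≼-tail f≼) k 2n≤k

  double-disjoint : ∀ f g k → double f (3 ℕ.+ k) ≈ 0# ⊎ double g k ≈ 0#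
  double-disjoint f g zero          = inj₁ refl
  double-disjoint f g (suc zero)    = inj₂ refl
  double-disjoint f g (suc (suc k)) = double-disjoint (tail f) (tail g) k

  shift³ : Series → Series
  shift³ f = shift (shift (shift f))

  -- X has a double and Y a triple pole at infinity, so (a , b) = a(X) + b(X) Y
  -- is recorded by pole order as a(t²) + t³ b(t²); the odd index 1 stays empty.
  pole : Series × Series → Series
  pole (a , b) = double a ⊞ shift³ (double b)

  pole-cong : ∀ {a a′ b b′} → a ≋ a′ → b ≋ b′ → pole (a , b) ≋ pole (a′ , b′)
  pole-cong p q n = +-cong (double-cong p n) (shift³-cong (double-cong q) n)
    where
    shift³-cong : ∀ {f g} → f ≋ g → shift³ f ≋ shift³ g
    shift³-cong p zero                = refl
    shift³-cong p (suc zero)          = refl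
    shift³-cong p (suc (suc zero))    = refl
    shift³-cong p (suc (suc (suc n))) = p n

  pole-disjoint : ∀ a b k → double a k ≈ 0# ⊎ shift³ (double b) k ≈ 0#
  pole-disjoint a b zero                = inj₂ refl
  pole-disjoint a b (suc zero)          = inj₂ refl
  pole-disjoint a b (suc (suc zero))    = inj₂ refl
  pole-disjoint a b (suc (suc (suc k))) = double-disjoint a b k

  pole-≼⁻ : ∀ {a b n} → pole (a , b) ≼ n → double a ≼ n × shift³ (double b) ≼ n
  pole-≼⁻ {a} {b} p≼n = (λ k n≤k → proj₁ (split k n≤k)) , (λ k n≤k → proj₂ (split k n≤k))
    where
    split : ∀ k → _ ℕ.≤ k → double a k ≈ 0# × shift³ (double b) k ≈ 0#
    split k n≤k with pole-disjoint a b k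
    ... | inj₁ e = e , trans (sym (+-identityˡ _)) (trans (+-congʳ (sym e)) (p≼n k n≤k))
    ... | inj₂ e = trans (sym (+-identityʳ _)) (trans (+-congˡ (sym e)) (p≼n k n≤k)) , e

  pole-≼⁻-coefficient₁ : ∀ {a b n} → pole (a , b) ≼ n → ∀ k → n ℕ.≤ k ℕ.* 2 → a k ≈ 0#
  pole-≼⁻-coefficient₁ {a} p≼n k n≤ =
    trans (reflexive (≡.sym (double-even a k))) (proj₁ (pole-≼⁻ p≼n) (k ℕ.* 2) n≤)

  pole-≼⁻-coefficient₂ : ∀ {a b n} → pole (a , b) ≼ n → ∀ k → n ℕ.≤ 3 ℕ.+ k ℕ.* 2 → b k ≈ 0#
  pole-≼⁻-coefficient₂ {b = b} p≼n k n≤ =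
    trans (reflexive (≡.sym (double-even b k))) (proj₂ (pole-≼⁻ p≼n) (3 ℕ.+ k ℕ.* 2) n≤)

  pole-≼ : ∀ {a b n} → a ≼ n → b ≼ n → pole (a , b) ≼ 3 ℕ.+ n ℕ.* 2
  pole-≼ {n = n} a≼n b≼n = ≼-⊞ (≼-mono (ℕ.m≤n+m _ 3) (double-≼ n a≼n))
    (≼-shift (≼-shift (≼-shift (double-≼ n b≼n))))

  shift-≋ : ∀ f → shift f ≋ variable-t ⊛ f
  shift-≋ f n = sym (variable-t-⊛ f n)

  shift³-≋ : ∀ f → shift³ f ≋ variable-t ⊛ (variable-t ⊛ (variable-t ⊛ f))
  shift³-≋ f = begin
    shift (shift (shift f))                       ≈⟨ shift-≋ _ ⟩
    variable-t ⊛ shift (shift f)                  ≈⟨ 𝕊.*-congˡ (shift-≋ (shift f)) ⟩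
    variable-t ⊛ (variable-t ⊛ shift f)           ≈⟨ 𝕊.*-congˡ (𝕊.*-congˡ {x = variable-t} (shift-≋ f)) ⟩
    variable-t ⊛ (variable-t ⊛ (variable-t ⊛ f)) ∎
    where open SetoidReasoning 𝕊.setoid

  module 𝕊₂ = CharacteristicTwo seriesRing series-1+1≈0

  module PoleOrder (κ : Cubic Carrier) (μ≈1 : Cubic.μ κ ≈ 1#) where
    open Cubic κ
    open Model κ

    private
      t = variable-t

    -- The terms of lower pole order in Y² = X³ + ⋯
    lower : Series
    lower = shift (shift (shift (shift (const a₂)))) ⊞ shift (shift (const a₄)) ⊞ const a₆ ⊞ shift³ (const h)

    lower-≼ : lower ≼ 5
    lower-≼ = ≼-⊞ (≼-⊞ (≼-⊞
      (≼-shift (≼-shift (≼-shift (≼-shift (const-≼ a₂)))))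
      (≼-mono (ℕ.m≤n+m 3 2) (≼-shift (≼-shift (const-≼ a₄)))))
      (≼-mono (ℕ.m≤n+m 1 4) (const-≼ a₆)))
      (≼-mono (ℕ.m≤n+m 4 1) (≼-shift (≼-shift (≼-shift (const-≼ h)))))

    private
      hₛ a₂ₛ a₄ₛ a₆ₛ : Series
      hₛ = const h
      a₂ₛ = const a₂
      a₄ₛ = const a₄
      a₆ₛ = const a₆

    lower-≋ : lower ≋ t ⊛ (t ⊛ (t ⊛ (t ⊛ a₂ₛ))) ⊞ t ⊛ (t ⊛ a₄ₛ) ⊞ a₆ₛ ⊞ t ⊛ (t ⊛ (t ⊛ hₛ))
    lower-≋ = 𝕊.+-cong (𝕊.+-congʳ (𝕊.+-cong
        (𝕊.trans (shift-≋ _) (𝕊.*-congˡ (shift³-≋ a₂ₛ)))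
        (𝕊.trans (shift-≋ _) (𝕊.*-congˡ (shift-≋ a₄ₛ)))))
      (shift³-≋ hₛ)

    double-f : double f-series ≋ t ⊛ t ⊛ (t ⊛ t) ⊛ (t ⊛ t) ⊞ a₂ₛ ⊛ (t ⊛ t) ⊛ (t ⊛ t) ⊞ a₄ₛ ⊛ (t ⊛ t) ⊞ a₆ₛ
    double-f = double+ (double+ (double+ μt³ (double* (double* (double-const a₂) double-t) double-t))
                       (double* (double-const a₄) double-t)) (double-const a₆)
      where
      double+ : ∀ {f g f′ g′} → double f ≋ f′ → double g ≋ g′ → double (f ⊞ g) ≋ f′ ⊞ g′
      double+ p q = 𝕊.trans (double-⊞ _ _) (𝕊.+-cong p q)
      double* : ∀ {f g f′ g′} → double f ≋ f′ → double g ≋ g′ → double (f ⊛ g) ≋ f′ ⊛ g′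
      double* {f} {g} p q = 𝕊.trans (double-⊛ f g) (𝕊.*-cong p q)
      μt³ : double (const μ ⊛ t ⊛ t ⊛ t) ≋ t ⊛ t ⊛ (t ⊛ t) ⊛ (t ⊛ t)
      μt³ = double* (double* (𝕊.trans (double* (𝕊.trans (double-cong const-μ) (double-const 1#)) double-t)
        (⊛-identityˡ _)) double-t) double-t
        where
        const-μ : const μ ≋ const 1#
        const-μ zero    = μ≈1
        const-μ (suc n) = refl

    pole-≋ : ∀ a b → pole (a , b) ≋ double a ⊞ t ⊛ (t ⊛ (t ⊛ double b))
    pole-≋ a b = 𝕊.+-congˡ (shift³-≋ (double b))

    pole-* : ∀ p q → pole (p M.* q) ≋ double (proj₂ p) ⊛ double (proj₂ q) ⊛ lower ⊞ pole p ⊛ pole q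
    pole-* (a , b) (c , d) = begin
      pole ((a , b) M.* (c , d))
        ≈⟨ pole-≋ _ _ ⟩
      double (a ⊛ c ⊞ b ⊛ d ⊛ f-series) ⊞ t ⊛ (t ⊛ (t ⊛ double (a ⊛ d ⊞ b ⊛ c ⊞ b ⊛ d ⊛ hₛ)))
        ≈⟨ 𝕊.+-cong
             (𝕊.trans (double-⊞ _ _) (𝕊.+-cong (double-⊛ a c)
               (𝕊.trans (double-⊛ (b ⊛ d) f-series) (𝕊.*-cong (double-⊛ b d) double-f))))
             (𝕊.*-congˡ (𝕊.*-congˡ {x = t} (𝕊.*-congˡ {x = t} (𝕊.trans (double-⊞ _ _)
               (𝕊.+-cong (𝕊.trans (double-⊞ _ _) (𝕊.+-cong (double-⊛ a d) (double-⊛ b c)))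
                         (𝕊.trans (double-⊛ (b ⊛ d) hₛ) (𝕊.*-cong (double-⊛ b d) (double-const h)))))))) ⟩
      A ⊛ C ⊞ B ⊛ D ⊛ (t ⊛ t ⊛ (t ⊛ t) ⊛ (t ⊛ t) ⊞ a₂ₛ ⊛ (t ⊛ t) ⊛ (t ⊛ t) ⊞ a₄ₛ ⊛ (t ⊛ t) ⊞ a₆ₛ)
        ⊞ t ⊛ (t ⊛ (t ⊛ (A ⊛ D ⊞ B ⊛ C ⊞ B ⊛ D ⊛ hₛ)))
        ≈⟨ 𝕊₂.solve 9 (λ a b c d t h a₂ a₄ a₆ →
             a 𝕊₂.⊗ c 𝕊₂.⊕ b 𝕊₂.⊗ d 𝕊₂.⊗ (t 𝕊₂.⊗ t 𝕊₂.⊗ (t 𝕊₂.⊗ t) 𝕊₂.⊗ (t 𝕊₂.⊗ t)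
               𝕊₂.⊕ a₂ 𝕊₂.⊗ (t 𝕊₂.⊗ t) 𝕊₂.⊗ (t 𝕊₂.⊗ t) 𝕊₂.⊕ a₄ 𝕊₂.⊗ (t 𝕊₂.⊗ t) 𝕊₂.⊕ a₆)
               𝕊₂.⊕ t 𝕊₂.⊗ (t 𝕊₂.⊗ (t 𝕊₂.⊗ (a 𝕊₂.⊗ d 𝕊₂.⊕ b 𝕊₂.⊗ c 𝕊₂.⊕ b 𝕊₂.⊗ d 𝕊₂.⊗ h)))
             𝕊₂.⊜ b 𝕊₂.⊗ d 𝕊₂.⊗ (t 𝕊₂.⊗ (t 𝕊₂.⊗ (t 𝕊₂.⊗ (t 𝕊₂.⊗ a₂))) 𝕊₂.⊕ t 𝕊₂.⊗ (t 𝕊₂.⊗ a₄) 𝕊₂.⊕ a₆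
               𝕊₂.⊕ t 𝕊₂.⊗ (t 𝕊₂.⊗ (t 𝕊₂.⊗ h)))
               𝕊₂.⊕ (a 𝕊₂.⊕ t 𝕊₂.⊗ (t 𝕊₂.⊗ (t 𝕊₂.⊗ b))) 𝕊₂.⊗ (c 𝕊₂.⊕ t 𝕊₂.⊗ (t 𝕊₂.⊗ (t 𝕊₂.⊗ d))))
             𝕊.refl A B C D t hₛ a₂ₛ a₄ₛ a₆ₛ ⟩
      B ⊛ D ⊛ (t ⊛ (t ⊛ (t ⊛ (t ⊛ a₂ₛ))) ⊞ t ⊛ (t ⊛ a₄ₛ) ⊞ a₆ₛ ⊞ t ⊛ (t ⊛ (t ⊛ hₛ)))
        ⊞ (A ⊞ t ⊛ (t ⊛ (t ⊛ B))) ⊛ (C ⊞ t ⊛ (t ⊛ (t ⊛ D)))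
        ≈⟨ 𝕊.+-cong (𝕊.*-congˡ {x = B ⊛ D} lower-≋) (𝕊.*-cong (pole-≋ a b) (pole-≋ c d)) ⟨
      B ⊛ D ⊛ lower ⊞ pole (a , b) ⊛ pole (c , d) ∎
      where
      open SetoidReasoning 𝕊.setoid
      A = double a
      B = double b
      C = double c
      D = double d

    lower-order : ∀ {p q} n m → pole p ≼ suc n → pole q ≼ suc m →
      double (proj₂ p) ⊛ double (proj₂ q) ⊛ lower ≼ n ℕ.+ m
    lower-order {a , b} {c , d} n m p≼ q≼ k n+m≤k = begin
      (B ⊛ D ⊛ lower) k
        ≡⟨⟩
      shift³ (shift³ (B ⊛ D ⊛ lower)) (6 ℕ.+ k)
        ≈⟨ shift⁶ (6 ℕ.+ k) ⟨
      (shift³ B ⊛ shift³ D ⊛ lower) (6 ℕ.+ k)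
        ≈⟨ ≼-⊛ (n ℕ.+ m) 4 (≼-⊛ n m (proj₂ (pole-≼⁻ p≼)) (proj₂ (pole-≼⁻ q≼))) lower-≼ (6 ℕ.+ k)
             (ℕ.≤-trans (ℕ.≤-reflexive (≡.cong suc (ℕ.+-comm (n ℕ.+ m) 4))) (ℕ.+-mono-≤ (ℕ.m≤n+m 5 1) n+m≤k)) ⟩
      0# ∎
      where
      open SetoidReasoning setoid
      B = double b
      D = double d
      shift⁶ : shift³ B ⊛ shift³ D ⊛ lower ≋ shift³ (shift³ (B ⊛ D ⊛ lower))
      shift⁶ = 𝕊.trans (𝕊.*-congʳ {x = lower} (𝕊.*-cong (shift³-≋ B) (shift³-≋ D))) (𝕊.trans
        (𝕊₂.solve 4 (λ b d t l →
          t 𝕊₂.⊗ (t 𝕊₂.⊗ (t 𝕊₂.⊗ b)) 𝕊₂.⊗ (t 𝕊₂.⊗ (t 𝕊₂.⊗ (t 𝕊₂.⊗ d))) 𝕊₂.⊗ l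
          𝕊₂.⊜ t 𝕊₂.⊗ (t 𝕊₂.⊗ (t 𝕊₂.⊗ (t 𝕊₂.⊗ (t 𝕊₂.⊗ (t 𝕊₂.⊗ (b 𝕊₂.⊗ d 𝕊₂.⊗ l)))))))
          𝕊.refl B D t lower)
        (𝕊.sym (𝕊.trans (shift³-≋ _) (𝕊.*-congˡ {x = t} (𝕊.*-congˡ {x = t} (𝕊.*-congˡ {x = t} (shift³-≋ _)))))))

    degree-* : ∀ {p q n m} → Degree (pole p) n → Degree (pole q) m → Degree (pole (p M.* q)) (n ℕ.+ m)
    degree-* {p} {q} {n} {m} dp dq = degree-resp (pole-* p q)
      (degree-⊞ (lower-order {p} {q} n m (proj₁ dp) (proj₁ dq)) (degree-⊛ dp dq))

    pole-+ : ∀ p q → pole (p M.+ q) ≋ pole p ⊞ pole q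
    pole-+ (a , b) (c , d) k = begin
      double (a ⊞ c) k + shift³ (double (b ⊞ d)) k ≈⟨ +-cong (double-⊞ a c k) (shift³-⊞ k) ⟩
      double a k + double c k + (shift³ (double b) k + shift³ (double d) k) ≈⟨ interchange-+ _ _ _ _ ⟩
      double a k + shift³ (double b) k + (double c k + shift³ (double d) k) ∎
      where
      open SetoidReasoning setoid
      shift³-⊞ : shift³ (double (b ⊞ d)) ≋ shift³ (double b) ⊞ shift³ (double d)
      shift³-⊞ zero                = sym (+-identityˡ 0#)
      shift³-⊞ (suc zero)          = sym (+-identityˡ 0#)
      shift³-⊞ (suc (suc zero))    = sym (+-identityˡ 0#)
      shift³-⊞ (suc (suc (suc k))) = double-⊞ b d k

module NormalForm (F : Field c ℓ) (1+1≈0 : CharTwo (Field.commutativeRing F))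
  {W : Poly (Field.Carrier F)} {κ : Cubic (Field.Carrier F)}
  (P : FieldOfCharacteristicTwo.Presents F 1+1≈0 W κ) where

  open Field F hiding (_⁻¹; inverseʳ)
  open FieldProperties F
  open FieldOfCharacteristicTwo F 1+1≈0
  open SeriesDegree F 1+1≈0
  open Model κ public
  open CoordinateRing W public
  open Spanning P public
  private
    module EvM = Evaluation {F = F} extension ι ι-isRingHomomorphism
    module ι = IsRingHomomorphism ι-isRingHomomorphism

  nf-W : nf W M.≈ M.0#
  nf-W = M.trans (EvM.evaluate-resp nf-standard (Presents.W∼0 P)) ι.0#-homo

  nf-resp : ∀ {p q} → p R.≈ q → nf p M.≈ nf q
  nf-resp = EvM.evaluate-resp nf-W

  horner-zero : ∀ as → coefficients-of as ≋ zeroₛ → horner as R.≈ R.0#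
  horner-zero []       _ = R.refl
  horner-zero (a ∷ as) z = R.trans
    (R.+-cong (con-cong (z 0)) (R.trans (R.*-congˡ (horner-zero as (z ∘ suc))) (R.zeroʳ X)))
    (R.+-identityʳ _)

  horner-uncons : ∀ as → horner as R.≈ con (coefficients-of as 0) :+ X :* horner (drop 1 as)
  horner-uncons []       = R.sym (R.trans (R.+-congˡ (R.zeroʳ X)) (R.+-identityʳ _))
  horner-uncons (a ∷ as) = R.refl

  coefficients-of-drop : ∀ as → coefficients-of (drop 1 as) ≋ tail (coefficients-of as)
  coefficients-of-drop []       _ = refl
  coefficients-of-drop (a ∷ as) _ = refl

  record Coordinates (p : Poly Carrier) : Set (c ⊔ ℓ) where
    field
      as bs : List Carrier
      ∼span : p R.≈ horner as :+ horner bs :* Y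
      as≋   : coefficients-of as ≋ proj₁ (nf p)
      bs≋   : coefficients-of bs ≋ proj₂ (nf p)

  coordinates : ∀ p → Coordinates p
  coordinates p =
    let as , bs , e = spanning p
        e₁ , e₂ = M.trans (M.sym (nf-span as bs)) (nf-resp (R.sym e))
    in record { as = as ; bs = bs ; ∼span = e ; as≋ = e₁ ; bs≋ = e₂ }

  order : Poly Carrier → Series
  order p = pole (nf p)

  order-resp : ∀ {p q} → p R.≈ q → order p ≋ order q
  order-resp e = let e₁ , e₂ = nf-resp e in pole-cong e₁ e₂

  order-bounded : ∀ p → ∃[ n ] order p ≼ n
  order-bounded p = _ , ≼-resp (pole-cong (𝕊.sym as≋) (𝕊.sym bs≋))
    (pole-≼ (≼-mono (ℕ.m≤m+n (length as) (length bs)) (coefficients-of-≼ as))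
            (≼-mono (ℕ.m≤n+m (length bs) (length as)) (coefficients-of-≼ bs)))
    where open Coordinates (coordinates p)

  order-zero : ∀ {p} → order p ≋ zeroₛ → p R.≈ R.0#
  order-zero {p} z = R.trans ∼span (R.trans (R.+-cong
      (horner-zero as λ k → trans (as≋ k) (pole-≼⁻-coefficient₁ {n = 0} (λ k _ → z k) k z≤n))
      (R.trans (R.*-congʳ (horner-zero bs λ k →
        trans (bs≋ k) (pole-≼⁻-coefficient₂ {n = 0} (λ k _ → z k) k z≤n))) (R.zeroˡ Y)))
    (R.+-identityˡ _))
    where open Coordinates (coordinates p)

  linear : ∀ {p} → order p ≼ 4 →
    p R.≈ con (proj₂ (nf p) 0) :* Y :+ con (proj₁ (nf p) 1) :* X :+ con (proj₁ (nf p) 0)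
  linear {p} p≼4 = R.trans ∼span (R.trans
    (R.+-cong
      (R.trans (horner-uncons as) (R.+-cong (con-cong (as≋ 0)) (R.*-congˡ (R.trans (horner-uncons (drop 1 as))
        (R.+-cong (con-cong (trans (coefficients-of-drop as 0) (as≋ 1)))
          (R.trans (R.*-congˡ (horner-zero (drop 1 (drop 1 as)) λ k →
            trans (coefficients-of-drop (drop 1 as) k) (trans (coefficients-of-drop as (suc k)) (trans (as≋ (2 ℕ.+ k))
              (pole-≼⁻-coefficient₁ p≼4 (2 ℕ.+ k) (ℕ.m≤m+n 4 (k ℕ.* 2)))))))
            (R.zeroʳ X)))))))
      (R.*-congʳ (R.trans (horner-uncons bs) (R.+-cong (con-cong (bs≋ 0))
        (R.trans (R.*-congˡ (horner-zero (drop 1 bs) λ k →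
          trans (coefficients-of-drop bs k) (trans (bs≋ (suc k))
            (pole-≼⁻-coefficient₂ p≼4 (suc k) (ℕ.≤-trans (ℕ.n≤1+n 4) (ℕ.m≤m+n 5 (k ℕ.* 2)))))))
          (R.zeroʳ X))))))
    (R₂.solve 5 (λ x y a b e → (a R₂.⊕ x R₂.⊗ (b R₂.⊕ R₂.:0)) R₂.⊕ (e R₂.⊕ R₂.:0) R₂.⊗ y
      R₂.⊜ e R₂.⊗ y R₂.⊕ b R₂.⊗ x R₂.⊕ a) R.refl
      X Y (con (proj₁ (nf p) 0)) (con (proj₁ (nf p) 1)) (con (proj₂ (nf p) 0))))
    where open Coordinates (coordinates p)

  constant : ∀ {p} → order p ≼ 1 → p R.≈ con (proj₁ (nf p) 0)
  constant {p} p≼1 = R.trans (linear (≼-mono (s≤s z≤n) p≼1)) (R.trans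
    (R.+-congʳ (R.+-cong (R.*-congʳ (con-cong (pole-≼⁻-coefficient₂ p≼1 0 (s≤s z≤n))))
                         (R.*-congʳ (con-cong (pole-≼⁻-coefficient₁ p≼1 1 (s≤s z≤n))))))
    (R₂.solve 3 (λ x y a → R₂.:0 R₂.⊗ y R₂.⊕ R₂.:0 R₂.⊗ x R₂.⊕ a R₂.⊜ a) R.refl X Y (con (proj₁ (nf p) 0))))

  zero-or-degree : ∀ p → p R.≈ R.0# ⊎ ∃[ n ] Degree (order p) n
  zero-or-degree p = let n , p≼n = order-bounded p in Sum.map₁ order-zero (degree-exists n p≼n)

  abstract
    positive-degree : ∀ {p} → (∀ a → ¬ (p R.≈ con a)) → ∃[ n ] 0 ℕ.< n × Degree (order p) n
    positive-degree {p} p≁con = positive (zero-or-degree p)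
      where
      positive : p R.≈ R.0# ⊎ ∃[ n ] Degree (order p) n → ∃[ n ] 0 ℕ.< n × Degree (order p) n
      positive (inj₁ p≈0)             = contradiction p≈0 (p≁con 0#)
      positive (inj₂ (zero , p≼1 , _)) = contradiction (constant p≼1) (p≁con _)
      positive (inj₂ (suc n , d))     = suc n , s≤s z≤n , d

  order-con : ∀ a → order (con a) ≋ const a
  order-con a k = trans (+-cong (double-const a k) (lemma k)) (+-identityʳ _)
    where
    lemma : shift³ (double zeroₛ) ≋ zeroₛ
    lemma zero                = refl
    lemma (suc zero)          = refl
    lemma (suc (suc zero))    = refl
    lemma (suc (suc (suc k))) = double-zero k

  order-con-≼ : ∀ a → order (con a) ≼ 1
  order-con-≼ a = ≼-resp (order-con a) (const-≼ a)

  degree-con : ∀ {a} → a ≉ 0# → Degree (order (con a)) 0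
  degree-con {a} a≉0 = degree-resp (order-con a) (const-≼ a , a≉0)

  degree-X : Degree (order X) 2
  degree-X = (λ where
      (suc (suc (suc k))) (s≤s (s≤s (s≤s _))) → trans (+-cong (double-t³ k) (double-zero k)) (+-identityˡ 0#))
    , λ e → 0≉1 (trans (sym e) (+-identityʳ 1#))
    where
    double-t³ : ∀ k → double (const 1#) (suc k) ≈ 0#
    double-t³ k = double-const 1# (suc k)

  X≁con : ∀ a → ¬ (X R.≈ con a)
  X≁con a e = proj₂ degree-X (trans (order-resp e 2) (order-con-≼ a 2 (s≤s z≤n)))

module Classification (F : Field c ℓ) (1+1≈0 : CharTwo (Field.commutativeRing F))
  {W W′ : Poly (Field.Carrier F)} {κ κ′ : Cubic (Field.Carrier F)}
  (P : FieldOfCharacteristicTwo.Presents F 1+1≈0 W κ)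
  (P′ : FieldOfCharacteristicTwo.Presents F 1+1≈0 W′ κ′)
  (μ≈1 : Field._≈_ F (Cubic.μ κ) (Field.1# F))
  (μ′≉0 : Field._≉_ F (Cubic.μ κ′) (Field.0# F))
  (φ : Isomorphism F W W′) where

  open Field F hiding (_⁻¹; inverseʳ)
  open FieldProperties F
  open FieldOfCharacteristicTwo F 1+1≈0
  open SeriesDegree F 1+1≈0
  open NormalForm F 1+1≈0 P
  open PoleOrder κ μ≈1
  private
    module N′ = NormalForm F 1+1≈0 P′
    module R′ = N′.R
  open Isomorphism φ
  open IsRingIsomorphism isRingIsomorphism renaming (⟦⟧-cong to pullback-cong)
  open Cubic κ′ using () renaming (h to h′; μ to μ′; a₂ to a₂′; a₄ to a₄′; a₆ to a₆′)

  private
    f g : Poly Carrier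
    f = pullback X
    g = pullback Y

  pullback≈evaluate : ∀ p → pullback p R.≈ Ev.evaluate f g p
  pullback≈evaluate = Ev.hom≈evaluate isRingHomomorphism fixes-constants

  standard-fg : Ev.evaluate f g (standard κ′) R.≈ R.0#
  standard-fg = R.trans (R.sym (pullback≈evaluate (standard κ′)))
    (R.trans (pullback-cong (FieldOfCharacteristicTwo.Presents.standard∼0 P′)) (fixes-constants 0#))

  f≁con : ∀ a → ¬ (f R.≈ con a)
  f≁con a e = N′.X≁con a (injective (R.trans e (R.sym (fixes-constants a))))

  order-con+ : ∀ {p n} a → 0 ℕ.< n → Degree (order p) n → Degree (order (con a :+ p)) n
  order-con+ {p} a 0<n d = degree-resp (pole-+ (nf (con a)) (nf p))
    (degree-⊞ (≼-mono 0<n (order-con-≼ a)) d)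

  order-* : ∀ {p q n m} → Degree (order p) n → Degree (order q) m → Degree (order (p :* q)) (n ℕ.+ m)
  order-* {p} {q} = degree-* {nf p} {nf q}

  degree-f : ∃[ d ] 0 ℕ.< d × Degree (order f) d
  degree-f = positive-degree f≁con

  private
    d = proj₁ degree-f
    0<d = proj₁ (proj₂ degree-f)
    deg-f = proj₂ (proj₂ degree-f)

  horner-step : ∀ {p n} a → Degree (order p) n → Degree (order (con a :+ f :* p)) (d ℕ.+ n)
  horner-step {p} {n} a dp = order-con+ {f :* p} a (ℕ.≤-trans 0<d (ℕ.m≤m+n d n)) (order-* {f} {p} deg-f dp)

  cubic-fg : g :* (con h′ :+ g) R.≈ con a₆′ :+ f :* (con a₄′ :+ f :* (con a₂′ :+ f :* con μ′))
  cubic-fg = R₂.x+y≈0⇒x≈y (R.trans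
    (R₂.solve 7 (λ f g h μ a₂ a₄ a₆ →
      g R₂.⊗ (h R₂.⊕ g) R₂.⊕ (a₆ R₂.⊕ f R₂.⊗ (a₄ R₂.⊕ f R₂.⊗ (a₂ R₂.⊕ f R₂.⊗ μ)))
      R₂.⊜ g R₂.⊗ g R₂.⊕ h R₂.⊗ g R₂.⊕ (μ R₂.⊗ f R₂.⊗ f R₂.⊗ f R₂.⊕ a₂ R₂.⊗ f R₂.⊗ f R₂.⊕ a₄ R₂.⊗ f R₂.⊕ a₆))
      R.refl f g (con h′) (con μ′) (con a₂′) (con a₄′) (con a₆′))
    standard-fg)

  degree-cubic : Degree (order (g :* (con h′ :+ g))) (d ℕ.+ (d ℕ.+ (d ℕ.+ 0)))
  degree-cubic = degree-resp (order-resp cubic-fg)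
    (horner-step {con a₄′ :+ f :* (con a₂′ :+ f :* con μ′)} a₆′
      (horner-step {con a₂′ :+ f :* con μ′} a₄′ (horner-step {con μ′} a₂′ (degree-con μ′≉0))))

  g≁con : ∀ a → ¬ (g R.≈ con a)
  g≁con a e = proj₂ degree-cubic (trans
    (order-resp {g :* (con h′ :+ g)} {con (a * (h′ + a))}
      (R.trans (R.*-cong e (R.+-congˡ e)) (R.trans (R.*-congˡ (R.sym (con-+ h′ a))) (R.sym (con-* a (h′ + a)))))
      (d ℕ.+ (d ℕ.+ (d ℕ.+ 0))))
    (order-con-≼ (a * (h′ + a)) (d ℕ.+ (d ℕ.+ (d ℕ.+ 0))) (ℕ.≤-trans 0<d (ℕ.m≤m+n d _))))

  degree-g : ∃[ e ] 0 ℕ.< e × Degree (order g) e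
  degree-g = positive-degree g≁con

  private
    e = proj₁ degree-g
    0<e = proj₁ (proj₂ degree-g)
    deg-g = proj₂ (proj₂ degree-g)

  2e≡3d : e ℕ.+ e ≡ d ℕ.+ (d ℕ.+ (d ℕ.+ 0))
  2e≡3d = degree-unique (order-* {g} {con h′ :+ g} deg-g (order-con+ {g} h′ 0<e deg-g)) degree-cubic

  horner-degree : ∀ as → Ev.evaluate f g (horner as) R.≈ R.0#
    ⊎ ∃[ i ] Degree (order (Ev.evaluate f g (horner as))) (i ℕ.* d)
  horner-degree []       = inj₁ R.refl
  horner-degree (a ∷ as) = step (horner-degree as) (a ≟ 0#)
    where
    p = Ev.evaluate f g (horner as)
    step : p R.≈ R.0# ⊎ ∃[ i ] Degree (order p) (i ℕ.* d) → Dec (a ≈ 0#) →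
      con a :+ f :* p R.≈ R.0# ⊎ ∃[ i ] Degree (order (con a :+ f :* p)) (i ℕ.* d)
    step (inj₂ (i , di)) _         = inj₂ (suc i , horner-step {p} a di)
    step (inj₁ z)        (yes a≈0) =
      inj₁ (R.trans (R.+-cong (con-cong a≈0) (R.trans (R.*-congˡ z) (R.zeroʳ f))) (R.+-identityˡ _))
    step (inj₁ z)        (no a≉0)  = inj₂ (0 , degree-resp
      (order-resp {con a :+ f :* p} {con a} (R.trans (R.+-congˡ (R.trans (R.*-congˡ z) (R.zeroʳ f))) (R.+-identityʳ _)))
      (degree-con a≉0))

  k : ℕ
  k = e ℕ.∸ d

  e≡d+k : e ≡ d ℕ.+ k
  e≡d+k = ≡.sym (ℕ.m+[n∸m]≡n {d} {e} (ℕ.≮⇒≥ λ e<d → ℕ.<⇒≢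
    (ℕ.<-≤-trans (ℕ.+-mono-< {e} {d} e<d e<d) (ℕ.+-monoʳ-≤ d (ℕ.m≤m+n d (d ℕ.+ 0)))) 2e≡3d))

  d≡2k : d ≡ 2 ℕ.* k
  d≡2k = ≡.sym (ℕ.+-cancelˡ-≡ (2 ℕ.* d) _ _ (begin
    2 ℕ.* d ℕ.+ 2 ℕ.* k            ≡⟨ ℕ.*-distribˡ-+ 2 d k ⟨
    2 ℕ.* (d ℕ.+ k)                ≡⟨ ≡.cong (2 ℕ.*_) e≡d+k ⟨
    2 ℕ.* e                        ≡⟨ ≡.cong (e ℕ.+_) (ℕ.+-identityʳ e) ⟩
    e ℕ.+ e                        ≡⟨ 2e≡3d ⟩
    3 ℕ.* d                        ≡⟨ ℕ.+-comm d (2 ℕ.* d) ⟩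
    2 ℕ.* d ℕ.+ d                  ∎))
    where open ≡.≡-Reasoning

  e≡3k : e ≡ 3 ℕ.* k
  e≡3k = ≡.trans e≡d+k (≡.trans (≡.cong (ℕ._+ k) d≡2k) (ℕ.+-comm (2 ℕ.* k) k))

  k≢0 : k ≢ 0
  k≢0 k≡0 = ℕ.<⇒≢ 0<d (≡.sym (≡.trans d≡2k (≡.cong (2 ℕ.*_) k≡0)))

  id≡2ik : ∀ i → i ℕ.* d ≡ k ℕ.* (i ℕ.* 2)
  id≡2ik i = begin
    i ℕ.* d          ≡⟨ ≡.cong (i ℕ.*_) d≡2k ⟩
    i ℕ.* (2 ℕ.* k)  ≡⟨ ℕ.*-assoc i 2 k ⟨
    i ℕ.* 2 ℕ.* k    ≡⟨ ℕ.*-comm (i ℕ.* 2) k ⟩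
    k ℕ.* (i ℕ.* 2)  ∎
    where open ≡.≡-Reasoning

  jd+e≡ : ∀ j → j ℕ.* d ℕ.+ e ≡ k ℕ.* (j ℕ.* 2 ℕ.+ 3)
  jd+e≡ j = begin
    j ℕ.* d ℕ.+ e                  ≡⟨ ≡.cong₂ ℕ._+_ (id≡2ik j) (≡.trans e≡3k (ℕ.*-comm 3 k)) ⟩
    k ℕ.* (j ℕ.* 2) ℕ.+ k ℕ.* 3   ≡⟨ ℕ.*-distribˡ-+ k (j ℕ.* 2) 3 ⟨
    k ℕ.* (j ℕ.* 2 ℕ.+ 3)          ∎
    where open ≡.≡-Reasoning

  even≢odd+3 : ∀ i j → i ℕ.* 2 ≢ j ℕ.* 2 ℕ.+ 3
  even≢odd+3 zero    zero    ()
  even≢odd+3 zero    (suc j) ()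
  even≢odd+3 (suc zero) zero ()
  even≢odd+3 (suc (suc i)) zero ()
  even≢odd+3 (suc i) (suc j) eq = even≢odd+3 i j (ℕ.suc-injective (ℕ.suc-injective eq))

  -- X lies in the image of φ, that is, X = A(f) + B(f) g.
  degree-of-X : (∃[ i ] 2 ≡ i ℕ.* d) ⊎ (∃[ j ] 2 ≡ j ℕ.* d ℕ.+ e)
  degree-of-X = conclude (horner-degree as) (horner-degree bs)
    where
    preimage = surjective X
    span = N′.spanning (proj₁ preimage)
    as = proj₁ span
    bs = proj₁ (proj₂ span)
    A = Ev.evaluate f g (horner as)
    B = Ev.evaluate f g (horner bs)

    X≈A+Bg : X R.≈ A :+ B :* g
    X≈A+Bg = R.trans (R.sym (proj₂ preimage R′.refl))
      (R.trans (pullback-cong (proj₂ (proj₂ span))) (pullback≈evaluate (horner as :+ horner bs :* Y)))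

    degree-X≡ : ∀ {p n} → X R.≈ p → Degree (order p) n → 2 ≡ n
    degree-X≡ X≈p dp = degree-unique degree-X (degree-resp (order-resp X≈p) dp)

    X≈Bg : A R.≈ R.0# → X R.≈ B :* g
    X≈Bg A≈0 = R.trans X≈A+Bg (R.trans (R.+-congʳ A≈0) (R.+-identityˡ _))

    X≈A : B R.≈ R.0# → X R.≈ A
    X≈A B≈0 = R.trans X≈A+Bg (R.trans (R.+-congˡ (R.trans (R.*-congʳ B≈0) (R.zeroˡ g))) (R.+-identityʳ _))

    conclude : A R.≈ R.0# ⊎ (∃[ i ] Degree (order A) (i ℕ.* d)) →
      B R.≈ R.0# ⊎ (∃[ j ] Degree (order B) (j ℕ.* d)) → (∃[ i ] 2 ≡ i ℕ.* d) ⊎ (∃[ j ] 2 ≡ j ℕ.* d ℕ.+ e)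
    conclude (inj₁ A≈0) (inj₁ B≈0) = contradiction
      (R.trans (X≈A B≈0) A≈0) (X≁con 0#)
    conclude (inj₂ (i , dA)) (inj₁ B≈0) = inj₁ (i , degree-X≡ {A} (X≈A B≈0) dA)
    conclude (inj₁ A≈0) (inj₂ (j , dB)) = inj₂ (j , degree-X≡ {B :* g} (X≈Bg A≈0) (order-* {B} {g} dB deg-g))
    conclude (inj₂ (i , dA)) (inj₂ (j , dB)) = compare (ℕ.<-cmp (i ℕ.* d) (j ℕ.* d ℕ.+ e))
      where
      dBg = order-* {B} {g} dB deg-g
      compare : Tri (i ℕ.* d ℕ.< j ℕ.* d ℕ.+ e) (i ℕ.* d ≡ j ℕ.* d ℕ.+ e) (j ℕ.* d ℕ.+ e ℕ.< i ℕ.* d) →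
        (∃[ i ] 2 ≡ i ℕ.* d) ⊎ (∃[ j ] 2 ≡ j ℕ.* d ℕ.+ e)
      compare (tri< lt _ _) = inj₂ (j , degree-X≡ {A :+ B :* g} X≈A+Bg
        (degree-resp (pole-+ (nf A) (nf (B :* g))) (degree-⊞ (≼-mono lt (proj₁ dA)) dBg)))
      compare (tri≈ _ eq _) = contradiction
        (ℕ.*-cancelˡ-≡ _ _ k {{ℕ.≢-nonZero k≢0}} (≡.trans (≡.sym (id≡2ik i)) (≡.trans eq (jd+e≡ j))))
        (even≢odd+3 i j)
      compare (tri> _ _ gt) = inj₁ (i , degree-X≡ {B :* g :+ A} (R.trans X≈A+Bg (R.+-comm A (B :* g)))
        (degree-resp (pole-+ (nf (B :* g)) (nf A)) (degree-⊞ (≼-mono gt (proj₁ dBg)) dA)))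

  k≡1 : k ≡ 1
  k≡1 = conclude degree-of-X
    where
    conclude : (∃[ i ] 2 ≡ i ℕ.* d) ⊎ (∃[ j ] 2 ≡ j ℕ.* d ℕ.+ e) → k ≡ 1
    conclude (inj₁ (i , 2≡id)) = ℕ.m*n≡1⇒m≡1 k i (ℕ.*-cancelʳ-≡ _ 1 2
      (≡.trans (ℕ.*-assoc k i 2) (≡.trans (≡.sym (id≡2ik i)) (≡.sym 2≡id))))
    conclude (inj₂ (j , 2≡jd+e)) = contradiction
      (≡.subst (3 ℕ.≤_) (≡.sym 2≡jd+e) (ℕ.≤-trans (ℕ.*-monoʳ-≤ 3 (ℕ.n≢0⇒n>0 k≢0))
        (ℕ.≤-trans (ℕ.≤-reflexive (≡.sym e≡3k)) (ℕ.m≤n+m e _))))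
      λ where (s≤s (s≤s ()))

  degree-f≡2 : Degree (order f) 2
  degree-f≡2 = ≡.subst (Degree (order f)) (≡.trans d≡2k (≡.cong (2 ℕ.*_) k≡1)) deg-f

  degree-g≡3 : Degree (order g) 3
  degree-g≡3 = ≡.subst (Degree (order g)) (≡.trans e≡3k (≡.cong (3 ℕ.*_) k≡1)) deg-g

module _ {S : Setoid c₁ ℓ₁} {T : Setoid c₂ ℓ₂} where
  private
    module S = Setoid S
    module T = Setoid T

  inverse⁺ : (to : S.Carrier → T.Carrier) (from : T.Carrier → S.Carrier) →
    (∀ {x y} → x S.≈ y → to x T.≈ to y) → (∀ {x y} → x T.≈ y → from x S.≈ from y) →
    (∀ y → to (from y) T.≈ y) → (∀ x → from (to x) S.≈ x) → Inverse S T
  inverse⁺ to from to-cong from-cong to∘from from∘to = record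
    { to = to ; from = from ; to-cong = to-cong ; from-cong = from-cong
    ; inverse = (λ e → T.trans (to-cong e) (to∘from _)) , (λ e → S.trans (from-cong e) (from∘to _)) }

module Transformations (F : Field c ℓ) (1+1≈0 : CharTwo (Field.commutativeRing F)) where

  open Field F
  open FieldProperties F
  open FieldOfCharacteristicTwo F 1+1≈0
  open SeriesDegree F 1+1≈0

  substitutionSetoid : Setoid c ℓ
  substitutionSetoid = ×-setoid setoid (×-setoid setoid (×-setoid setoid (×-setoid setoid setoid)))
  module Sub = Setoid substitutionSetoid

  Vanishes : Poly Carrier → Set ℓ
  Vanishes p = eval F p 0# 0# ≈ 0#

  Valid : Cubic Carrier → Cubic Carrier → Substitution Carrier → Set ℓ
  Valid κ κ′ σ@(α , β , γ , δ , ε) = α ≉ 0# × γ ≉ 0# × Vanishes (obstruction-1 κ κ′ σ) × Vanishes (obstruction-X κ κ′ σ) ×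
    Vanishes (obstruction-X² κ κ′ σ) × Vanishes (obstruction-X³ κ κ′ σ) × Vanishes (obstruction-Y κ κ′ σ)

  valid? : ∀ κ κ′ σ → Dec (Valid κ κ′ σ)
  valid? κ κ′ σ@(α , β , γ , δ , ε) =
    ¬? (α ≟ 0#) ×-dec ¬? (γ ≟ 0#) ×-dec (_ ≟ 0#) ×-dec (_ ≟ 0#) ×-dec (_ ≟ 0#) ×-dec (_ ≟ 0#) ×-dec (_ ≟ 0#)

  valid-resp : ∀ κ κ′ {σ σ′} → σ Sub.≈ σ′ → Valid κ κ′ σ → Valid κ κ′ σ′
  valid-resp κ κ′ (α≈ , β≈ , γ≈ , δ≈ , ε≈) (α≉0 , γ≉0 , o₁ , oX , oX² , oX³ , oY) =
    (λ e → α≉0 (trans α≈ e)) , (λ e → γ≉0 (trans γ≈ e)) ,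
    vanishes o₁ (γ≈ ⟨*⟩ γ≈ ⟨*⟩ refl ⟨+⟩ ε≈ ⟨*⟩ ε≈ ⟨+⟩ refl ⟨*⟩ ε≈
      ⟨+⟩ refl ⟨*⟩ β≈ ⟨*⟩ β≈ ⟨*⟩ β≈ ⟨+⟩ refl ⟨*⟩ β≈ ⟨*⟩ β≈ ⟨+⟩ refl ⟨*⟩ β≈ ⟨+⟩ refl) ,
    vanishes oX (γ≈ ⟨*⟩ γ≈ ⟨*⟩ refl ⟨+⟩ refl ⟨*⟩ δ≈ ⟨+⟩ refl ⟨*⟩ α≈ ⟨*⟩ β≈ ⟨*⟩ β≈ ⟨+⟩ refl ⟨*⟩ α≈) ,
    vanishes oX² (γ≈ ⟨*⟩ γ≈ ⟨*⟩ refl ⟨+⟩ δ≈ ⟨*⟩ δ≈ ⟨+⟩ refl ⟨*⟩ α≈ ⟨*⟩ α≈ ⟨*⟩ β≈ ⟨+⟩ refl ⟨*⟩ α≈ ⟨*⟩ α≈) ,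
    vanishes oX³ (γ≈ ⟨*⟩ γ≈ ⟨*⟩ refl ⟨+⟩ refl ⟨*⟩ α≈ ⟨*⟩ α≈ ⟨*⟩ α≈) ,
    vanishes oY (γ≈ ⟨*⟩ γ≈ ⟨*⟩ refl ⟨+⟩ refl ⟨*⟩ γ≈)
    where
    infixl 6 _⟨+⟩_
    infixl 7 _⟨*⟩_
    _⟨+⟩_ : ∀ {x y z w} → x ≈ y → z ≈ w → x + z ≈ y + w
    _⟨+⟩_ = +-cong
    _⟨*⟩_ : ∀ {x y z w} → x ≈ y → z ≈ w → x * z ≈ y * w
    _⟨*⟩_ = *-cong
    vanishes : ∀ {x y} → x ≈ 0# → x ≈ y → y ≈ 0#
    vanishes x≈0 x≈y = trans (sym x≈y) x≈0

  substitute : Poly Carrier → Poly Carrier → Poly Carrier → Poly Carrier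
  substitute = evaluateWith con _:+_ _:*_ (:-_)

  substitute-XY : ∀ p → substitute X Y p ≡ p
  substitute-XY (con a)  = ≡.refl
  substitute-XY X        = ≡.refl
  substitute-XY Y        = ≡.refl
  substitute-XY (p :+ q) = ≡.cong₂ _:+_ (substitute-XY p) (substitute-XY q)
  substitute-XY (p :* q) = ≡.cong₂ _:*_ (substitute-XY p) (substitute-XY q)
  substitute-XY (:- p)   = ≡.cong :-_ (substitute-XY p)

  substitute-substitute : ∀ u v x y p →
    substitute u v (substitute x y p) ≡ substitute (substitute u v x) (substitute u v y) p
  substitute-substitute u v x y (con a)  = ≡.refl
  substitute-substitute u v x y X        = ≡.refl
  substitute-substitute u v x y Y        = ≡.refl
  substitute-substitute u v x y (p :+ q) =
    ≡.cong₂ _:+_ (substitute-substitute u v x y p) (substitute-substitute u v x y q)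
  substitute-substitute u v x y (p :* q) =
    ≡.cong₂ _:*_ (substitute-substitute u v x y p) (substitute-substitute u v x y q)
  substitute-substitute u v x y (:- p)   = ≡.cong :-_ (substitute-substitute u v x y p)

  module _ {W W′ : Poly Carrier} {κ κ′ : Cubic Carrier} (P : Presents W κ) (P′ : Presents W′ κ′) where
    open NormalForm F 1+1≈0 P
    private
      module N′ = NormalForm F 1+1≈0 P′
      module R′ = N′.R
      module R′₂ = N′.R₂
      module Std = Ev.StandardSubstitution R-1+1≈0
      module Std′ = N′.Ev.StandardSubstitution N′.R-1+1≈0
      module P = Presents P
      module P′ = Presents P′

    module ToIsomorphism (σ : Substitution Carrier) (valid : Valid κ κ′ σ) where
      private
        α = proj₁ σ
        β = proj₁ (proj₂ σ)
        γ = proj₁ (proj₂ (proj₂ σ))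
        δ = proj₁ (proj₂ (proj₂ (proj₂ σ)))
        ε = proj₂ (proj₂ (proj₂ (proj₂ σ)))
        α≉0 = proj₁ valid
        γ≉0 = proj₁ (proj₂ valid)
        o₁ = proj₁ (proj₂ (proj₂ valid))
        oX = proj₁ (proj₂ (proj₂ (proj₂ valid)))
        oX² = proj₁ (proj₂ (proj₂ (proj₂ (proj₂ valid))))
        oX³ = proj₁ (proj₂ (proj₂ (proj₂ (proj₂ (proj₂ valid)))))
        oY = proj₂ (proj₂ (proj₂ (proj₂ (proj₂ (proj₂ valid)))))

        x′ y′ : Poly Carrier
        x′ = con (α ⁻¹) :* (X :+ con β)
        y′ = con (γ ⁻¹) :* (Y :+ (con δ :* x′ :+ con ε))

      vanishes-R : ∀ {p} → Vanishes p → Ev.evaluate (con 0#) (con 0#) p R.≈ R.0#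
      vanishes-R {p} v = R.trans (R.sym (Ev.ι-eval p)) (con-cong v)

      vanishes-R′ : ∀ {p} → Vanishes p → N′.Ev.evaluate (con 0#) (con 0#) p R′.≈ R′.0#
      vanishes-R′ {p} v = R′.trans (R′.sym (N′.Ev.ι-eval p)) (N′.con-cong v)

      image-standard : substitute (image-X σ) (image-Y σ) (standard κ′) R.≈ R.0#
      image-standard = R.trans (Std.evaluate-standard-substitution κ κ′ α β γ δ ε X Y) (R.trans
        (R.+-cong (R.*-congˡ P.standard∼0) (R.+-cong (R.+-cong (R.+-cong (R.+-cong
          (vanishes-R {obstruction-1 κ κ′ σ} o₁)
          (R.*-congʳ (vanishes-R {obstruction-X κ κ′ σ} oX)))
          (R.*-congʳ (vanishes-R {obstruction-X² κ κ′ σ} oX²)))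
          (R.*-congʳ (vanishes-R {obstruction-X³ κ κ′ σ} oX³)))
          (R.*-congʳ (vanishes-R {obstruction-Y κ κ′ σ} oY))))
        (R₂.solve 3 (λ x y g → g R₂.⊗ g R₂.⊗ R₂.:0 R₂.⊕ (R₂.:0 R₂.⊕ R₂.:0 R₂.⊗ x R₂.⊕ R₂.:0 R₂.⊗ (x R₂.⊗ x)
          R₂.⊕ R₂.:0 R₂.⊗ (x R₂.⊗ x R₂.⊗ x) R₂.⊕ R₂.:0 R₂.⊗ y) R₂.⊜ R₂.:0) R.refl X Y (con γ)))

      image-W′ : substitute (image-X σ) (image-Y σ) W′ R.≈ R.0#
      image-W′ = Ev.evaluate-resp image-standard P′.W∼0

      con-inverse : ∀ {a} → a ≉ 0# → con a :* con (a ⁻¹) R′.≈ R′.1#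
      con-inverse {a} a≉0 = R′.trans (R′.sym (N′.con-* a (a ⁻¹))) (N′.con-cong (inverseʳ a≉0))

      image-x′ : con α :* x′ :+ con β R′.≈ X
      image-x′ = R′.trans
        (R′₂.solve 4 (λ x a a⁻¹ b → a R′₂.⊗ (a⁻¹ R′₂.⊗ (x R′₂.⊕ b)) R′₂.⊕ b R′₂.⊜ a R′₂.⊗ a⁻¹ R′₂.⊗ (x R′₂.⊕ b) R′₂.⊕ b)
          R′.refl X (con α) (con (α ⁻¹)) (con β))
        (R′.trans (R′.+-congʳ (R′.*-congʳ (con-inverse α≉0)))
          (R′₂.solve 2 (λ x b → R′₂.:1 R′₂.⊗ (x R′₂.⊕ b) R′₂.⊕ b R′₂.⊜ x) R′.refl X (con β)))

      image-y′ : con γ :* y′ :+ con δ :* x′ :+ con ε R′.≈ Y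
      image-y′ = R′.trans
        (R′₂.solve 5 (λ y a a⁻¹ b e → a R′₂.⊗ (a⁻¹ R′₂.⊗ (y R′₂.⊕ (b R′₂.⊕ e))) R′₂.⊕ b R′₂.⊕ e
            R′₂.⊜ a R′₂.⊗ a⁻¹ R′₂.⊗ (y R′₂.⊕ (b R′₂.⊕ e)) R′₂.⊕ b R′₂.⊕ e)
          R′.refl Y (con γ) (con (γ ⁻¹)) (con δ :* x′) (con ε))
        (R′.trans (R′.+-congʳ (R′.+-congʳ (R′.*-congʳ (con-inverse γ≉0))))
          (R′₂.solve 3 (λ y b e → R′₂.:1 R′₂.⊗ (y R′₂.⊕ (b R′₂.⊕ e)) R′₂.⊕ b R′₂.⊕ e R′₂.⊜ y) R′.refl Y (con δ :* x′) (con ε)))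

      γ²-preimage : con γ :* con γ :* substitute x′ y′ (standard κ) R′.≈ R′.0#
      γ²-preimage = begin
        con γ :* con γ :* substitute x′ y′ (standard κ)
          ≈⟨ R′₂.solve 3 (λ x y z → z R′₂.⊜ z R′₂.⊕ (R′₂.:0 R′₂.⊕ R′₂.:0 R′₂.⊗ x R′₂.⊕ R′₂.:0 R′₂.⊗ (x R′₂.⊗ x)
               R′₂.⊕ R′₂.:0 R′₂.⊗ (x R′₂.⊗ x R′₂.⊗ x) R′₂.⊕ R′₂.:0 R′₂.⊗ y)) R′.refl x′ y′ _ ⟩
        con γ :* con γ :* substitute x′ y′ (standard κ) :+ (con 0# :+ con 0# :* x′ :+ con 0# :* (x′ :* x′)
          :+ con 0# :* (x′ :* x′ :* x′) :+ con 0# :* y′)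
          ≈⟨ R′.+-congˡ (R′.+-cong (R′.+-cong (R′.+-cong (R′.+-cong
               (vanishes-R′ {obstruction-1 κ κ′ σ} o₁)
               (R′.*-congʳ (vanishes-R′ {obstruction-X κ κ′ σ} oX)))
               (R′.*-congʳ (vanishes-R′ {obstruction-X² κ κ′ σ} oX²)))
               (R′.*-congʳ (vanishes-R′ {obstruction-X³ κ κ′ σ} oX³)))
               (R′.*-congʳ (vanishes-R′ {obstruction-Y κ κ′ σ} oY))) ⟨
        _ ≈⟨ Std′.evaluate-standard-substitution κ κ′ α β γ δ ε x′ y′ ⟨
        substitute (con α :* x′ :+ con β) (con γ :* y′ :+ con δ :* x′ :+ con ε) (standard κ′)
          ≈⟨ N′.Ev.evaluate-cong image-x′ image-y′ (standard κ′) ⟩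
        standard κ′
          ≈⟨ P′.standard∼0 ⟩
        con 0# ∎
        where open SetoidReasoning R′.setoid

      preimage-standard : substitute x′ y′ (standard κ) R′.≈ R′.0#
      preimage-standard = begin
        s ≈⟨ R′.*-identityˡ s ⟨
        con 1# :* s ≈⟨ R′.*-congʳ (con-inverse γ≉0) ⟨
        con γ :* con (γ ⁻¹) :* s ≈⟨ R′.*-congʳ (R′.*-congʳ (R′.*-identityʳ _)) ⟨
        con γ :* con 1# :* con (γ ⁻¹) :* s ≈⟨ R′.*-congʳ (R′.*-congʳ (R′.*-congˡ (con-inverse γ≉0))) ⟨
        con γ :* (con γ :* con (γ ⁻¹)) :* con (γ ⁻¹) :* s
          ≈⟨ R′₂.solve 3 (λ g i s → g R′₂.⊗ (g R′₂.⊗ i) R′₂.⊗ i R′₂.⊗ s R′₂.⊜ i R′₂.⊗ i R′₂.⊗ (g R′₂.⊗ g R′₂.⊗ s))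
               R′.refl (con γ) (con (γ ⁻¹)) s ⟩
        con (γ ⁻¹) :* con (γ ⁻¹) :* (con γ :* con γ :* s) ≈⟨ R′.*-congˡ γ²-preimage ⟩
        con (γ ⁻¹) :* con (γ ⁻¹) :* con 0# ≈⟨ R′.zeroʳ _ ⟩
        con 0# ∎
        where
        open SetoidReasoning R′.setoid
        s = substitute x′ y′ (standard κ)

      preimage-W : substitute x′ y′ W R′.≈ R′.0#
      preimage-W = N′.Ev.evaluate-resp preimage-standard P.W∼0

      con-inverseˡ : ∀ {a} → a ≉ 0# → con (a ⁻¹) :* con a R.≈ R.1#
      con-inverseˡ {a} a≉0 = R.trans (R.sym (con-* (a ⁻¹) a)) (con-cong (inverseˡ a≉0))

      image-of-x′ : substitute (image-X σ) (image-Y σ) x′ R.≈ X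
      image-of-x′ = R.trans
        (R₂.solve 4 (λ x a i b → i R₂.⊗ (a R₂.⊗ x R₂.⊕ b R₂.⊕ b) R₂.⊜ i R₂.⊗ a R₂.⊗ x)
          R.refl X (con α) (con (α ⁻¹)) (con β))
        (R.trans (R.*-congʳ (con-inverseˡ α≉0)) (R.*-identityˡ X))

      image-of-y′ : substitute (image-X σ) (image-Y σ) y′ R.≈ Y
      image-of-y′ = R.trans (R.*-congˡ (R.+-congˡ (R.+-congʳ (R.*-congˡ image-of-x′)))) (R.trans
        (R₂.solve 6 (λ x y a i b e → i R₂.⊗ (a R₂.⊗ y R₂.⊕ b R₂.⊗ x R₂.⊕ e R₂.⊕ (b R₂.⊗ x R₂.⊕ e)) R₂.⊜ i R₂.⊗ a R₂.⊗ y)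
          R.refl X Y (con γ) (con (γ ⁻¹)) (con δ) (con ε))
        (R.trans (R.*-congʳ (con-inverseˡ γ≉0)) (R.*-identityˡ Y)))

      image∘preimage : ∀ p → substitute (image-X σ) (image-Y σ) (substitute x′ y′ p) R.≈ p
      image∘preimage p = begin
        substitute (image-X σ) (image-Y σ) (substitute x′ y′ p)
          ≡⟨ substitute-substitute (image-X σ) (image-Y σ) x′ y′ p ⟩
        substitute (substitute (image-X σ) (image-Y σ) x′) (substitute (image-X σ) (image-Y σ) y′) p
          ≈⟨ Ev.evaluate-cong image-of-x′ image-of-y′ p ⟩
        substitute X Y p ≡⟨ substitute-XY p ⟩
        p ∎
        where open SetoidReasoning R.setoid

      preimage∘image : ∀ p → substitute x′ y′ (substitute (image-X σ) (image-Y σ) p) R′.≈ p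
      preimage∘image p = begin
        substitute x′ y′ (substitute (image-X σ) (image-Y σ) p)
          ≡⟨ substitute-substitute x′ y′ (image-X σ) (image-Y σ) p ⟩
        substitute (substitute x′ y′ (image-X σ)) (substitute x′ y′ (image-Y σ)) p
          ≈⟨ N′.Ev.evaluate-cong image-x′ image-y′ p ⟩
        substitute X Y p ≡⟨ substitute-XY p ⟩
        p ∎
        where open SetoidReasoning R′.setoid

      toIsomorphism : Isomorphism F W W′
      toIsomorphism = record
        { pullback = substitute (image-X σ) (image-Y σ)
        ; isRingIsomorphism = record
          { isRingMonomorphism = record
            { isRingHomomorphism = Ev.evaluate-isRingHomomorphism image-W′
            ; injective = λ {x} {y} e → R′.trans (R′.sym (preimage∘image x))
                (R′.trans (N′.Ev.evaluate-resp preimage-W e) (preimage∘image y))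
            }
          ; surjective = λ y → substitute x′ y′ y , λ e → R.trans (Ev.evaluate-resp image-W′ e) (image∘preimage y)
          }
        ; fixes-constants = λ a → R.refl
        }

    open ToIsomorphism public using (toIsomorphism)

    module FromIsomorphism (μ≈1 : Cubic.μ κ ≈ 1#) (μ′≉0 : Cubic.μ κ′ ≉ 0#) (φ : Isomorphism F W W′) where
      open Isomorphism φ
      open Classification F 1+1≈0 P P′ μ≈1 μ′≉0 φ

      private
        f = pullback X
        g = pullback Y
        α = proj₁ (nf f) 1
        β = proj₁ (nf f) 0
        γ = proj₂ (nf g) 0
        δ = proj₁ (nf g) 1
        ε = proj₁ (nf g) 0

      parameters : Substitution Carrier
      parameters = α , β , γ , δ , ε

      f≈image : f R.≈ image-X parameters
      f≈image = R.trans (linear {f} (≼-mono (ℕ.n≤1+n 3) (proj₁ degree-f≡2)))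
        (R.+-congʳ (R.trans (R.+-congʳ (R.trans (R.*-congʳ (con-cong
          (pole-≼⁻-coefficient₂ {proj₁ (nf f)} {proj₂ (nf f)} (proj₁ degree-f≡2) 0 ℕ.≤-refl))) (R.zeroˡ Y)))
          (R.+-identityˡ _)))

      g≈image : g R.≈ image-Y parameters
      g≈image = linear {g} (proj₁ degree-g≡3)

      α≉0 : α ≉ 0#
      α≉0 e = proj₂ degree-f≡2 (trans (+-identityʳ _) e)

      γ≉0 : γ ≉ 0#
      γ≉0 e = proj₂ degree-g≡3 (trans (+-identityˡ _) e)

      private
        o₁ = eval F (obstruction-1 κ κ′ parameters) 0# 0#
        oX = eval F (obstruction-X κ κ′ parameters) 0# 0#
        oX² = eval F (obstruction-X² κ κ′ parameters) 0# 0#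
        oX³ = eval F (obstruction-X³ κ κ′ parameters) 0# 0#
        oY = eval F (obstruction-Y κ κ′ parameters) 0# 0#
        os : List Carrier
        os = o₁ ∷ oX ∷ oX² ∷ oX³ ∷ []

      obstructions∼0 : horner os :+ horner (oY ∷ []) :* Y R.≈ R.0#
      obstructions∼0 = begin
        horner os :+ horner (oY ∷ []) :* Y
          ≈⟨ R₂.solve 7 (λ x y a b c d e → a R₂.⊕ x R₂.⊗ (b R₂.⊕ x R₂.⊗ (c R₂.⊕ x R₂.⊗ (d R₂.⊕ x R₂.⊗ R₂.:0)))
                R₂.⊕ (e R₂.⊕ x R₂.⊗ R₂.:0) R₂.⊗ y
               R₂.⊜ a R₂.⊕ b R₂.⊗ x R₂.⊕ c R₂.⊗ (x R₂.⊗ x) R₂.⊕ d R₂.⊗ (x R₂.⊗ x R₂.⊗ x) R₂.⊕ e R₂.⊗ y)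
               R.refl X Y (con o₁) (con oX) (con oX²) (con oX³) (con oY) ⟩
        con o₁ :+ con oX :* X :+ con oX² :* (X :* X) :+ con oX³ :* (X :* X :* X) :+ con oY :* Y
          ≈⟨ R.+-cong (R.+-cong (R.+-cong (R.+-cong
               (Ev.ι-eval {0#} {0#} (obstruction-1 κ κ′ parameters))
               (R.*-congʳ (Ev.ι-eval {0#} {0#} (obstruction-X κ κ′ parameters))))
               (R.*-congʳ (Ev.ι-eval {0#} {0#} (obstruction-X² κ κ′ parameters))))
               (R.*-congʳ (Ev.ι-eval {0#} {0#} (obstruction-X³ κ κ′ parameters))))
               (R.*-congʳ (Ev.ι-eval {0#} {0#} (obstruction-Y κ κ′ parameters))) ⟩
        obs
          ≈⟨ R.+-identityˡ obs ⟨
        con 0# :+ obs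
          ≈⟨ R.+-congʳ (R.trans (R.*-congˡ P.standard∼0) (R.zeroʳ (con γ :* con γ))) ⟨
        con γ :* con γ :* standard κ :+ obs
          ≈⟨ Std.evaluate-standard-substitution κ κ′ α β γ δ ε X Y ⟨
        substitute (image-X parameters) (image-Y parameters) (standard κ′)
          ≈⟨ Ev.evaluate-cong f≈image g≈image (standard κ′) ⟨
        substitute f g (standard κ′)
          ≈⟨ standard-fg ⟩
        con 0# ∎
        where
        open SetoidReasoning R.setoid
        obs = obstruction-1 κ κ′ parameters :+ obstruction-X κ κ′ parameters :* X
          :+ obstruction-X² κ κ′ parameters :* (X :* X) :+ obstruction-X³ κ κ′ parameters :* (X :* X :* X)
          :+ obstruction-Y κ κ′ parameters :* Y

      private
        coefficients≈0 : (coefficients-of os , coefficients-of (oY ∷ [])) M.≈ nf (con 0#)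
        coefficients≈0 = M.trans (M.sym (nf-span os (oY ∷ []))) (nf-resp obstructions∼0)

      parameters-valid : Valid κ κ′ parameters
      parameters-valid = α≉0 , γ≉0 , proj₁ coefficients≈0 0 , proj₁ coefficients≈0 1 ,
        proj₁ coefficients≈0 2 , proj₁ coefficients≈0 3 , proj₂ coefficients≈0 0

      pullback≈substitute : ∀ p → pullback p R.≈ substitute (image-X parameters) (image-Y parameters) p
      pullback≈substitute p = R.trans (pullback≈evaluate p) (Ev.evaluate-cong f≈image g≈image p)

    open FromIsomorphism public using (parameters; parameters-valid; pullback≈substitute)

    module _ (μ≈1 : Cubic.μ κ ≈ 1#) (μ′≉0 : Cubic.μ κ′ ≉ 0#) where

      parameters-cong : ∀ {φ ψ} → Setoid._≈_ (isomorphismSetoid F W W′) φ ψ →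
        parameters μ≈1 μ′≉0 φ Sub.≈ parameters μ≈1 μ′≉0 ψ
      parameters-cong e = proj₁ (nf-resp (e X)) 1 , proj₁ (nf-resp (e X)) 0 ,
        proj₂ (nf-resp (e Y)) 0 , proj₁ (nf-resp (e Y)) 1 , proj₁ (nf-resp (e Y)) 0

      substitute-image-cong : ∀ {σ σ′} → σ Sub.≈ σ′ → ∀ p →
        substitute (image-X σ) (image-Y σ) p R.≈ substitute (image-X σ′) (image-Y σ′) p
      substitute-image-cong (α≈ , β≈ , γ≈ , δ≈ , ε≈) = Ev.evaluate-cong
        (R.+-cong (R.*-congʳ (con-cong α≈)) (con-cong β≈))
        (R.+-cong (R.+-cong (R.*-congʳ (con-cong γ≈)) (R.*-congʳ (con-cong δ≈))) (con-cong ε≈))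

      parameters-toIsomorphism : ∀ σ valid → parameters μ≈1 μ′≉0 (toIsomorphism σ valid) Sub.≈ σ
      parameters-toIsomorphism (α , β , γ , δ , ε) valid =
        proj₁ nf-X 1 , proj₁ nf-X 0 , proj₂ nf-Y 0 , proj₁ nf-Y 1 , proj₁ nf-Y 0
        where
        nf-X : nf (con α :* X :+ con β) M.≈ (coefficients-of (β ∷ α ∷ []) , coefficients-of [])
        nf-X = M.trans (nf-resp (R₂.solve 4 (λ x y a b → a R₂.⊗ x R₂.⊕ b
            R₂.⊜ b R₂.⊕ x R₂.⊗ (a R₂.⊕ x R₂.⊗ R₂.:0) R₂.⊕ R₂.:0 R₂.⊗ y) R.refl X Y (con α) (con β)))
          (nf-span (β ∷ α ∷ []) [])
        nf-Y : nf (con γ :* Y :+ con δ :* X :+ con ε) M.≈ (coefficients-of (ε ∷ δ ∷ []) , coefficients-of (γ ∷ []))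
        nf-Y = M.trans (nf-resp (R₂.solve 5 (λ x y a b e → a R₂.⊗ y R₂.⊕ b R₂.⊗ x R₂.⊕ e
            R₂.⊜ e R₂.⊕ x R₂.⊗ (b R₂.⊕ x R₂.⊗ R₂.:0) R₂.⊕ (a R₂.⊕ x R₂.⊗ R₂.:0) R₂.⊗ y)
            R.refl X Y (con γ) (con δ) (con ε)))
          (nf-span (ε ∷ δ ∷ []) (γ ∷ []))

      isomorphisms↔valid : Inverse (isomorphismSetoid F W W′) (On.setoid substitutionSetoid (proj₁ {B = Valid κ κ′}))
      isomorphisms↔valid = inverse⁺
        (λ φ → parameters μ≈1 μ′≉0 φ , parameters-valid μ≈1 μ′≉0 φ)
        (λ (σ , valid) → toIsomorphism σ valid)
        (λ {φ} {ψ} → parameters-cong {φ} {ψ})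
        substitute-image-cong
        (λ (σ , valid) → parameters-toIsomorphism σ valid)
        (λ φ p → R.sym (pullback≈substitute μ≈1 μ′≉0 φ p))

Restrict : (S : Setoid c ℓ) → (Setoid.Carrier S → Set ℓ₃) → Setoid (c ⊔ ℓ₃) ℓ
Restrict S P = On.setoid S (proj₁ {B = P})

module _ {S : Setoid c₁ ℓ₁} {T : Setoid c₂ ℓ₂} where

  hasCardinality-resp : ∀ {n} → Inverse S T → T HasCardinality n → S HasCardinality n
  hasCardinality-resp = InverseComposition.inverse

  hasCardinality-× : ∀ {m n} → S HasCardinality m → T HasCardinality n → ×-setoid S T HasCardinality (m ℕ.* n)
  hasCardinality-× {m} {n} I J = inverse⁺
    (λ (x , y) → Fin.combine (I.to x) (J.to y))
    (λ k → let i , j = Fin.remQuot n k in I.from i , J.from j)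
    (λ (e , e′) → ≡.cong₂ Fin.combine (I.to-cong e) (J.to-cong e′))
    (λ where ≡.refl → Setoid.refl S , Setoid.refl T)
    (λ k → ≡.trans (≡.cong₂ Fin.combine (I.strictlyInverseˡ _) (J.strictlyInverseˡ _)) (Fin.combine-remQuot {m} n k))
    (λ (x , y) → let e = Fin.remQuot-combine (I.to x) (J.to y) in
      Setoid.trans S (I.from-cong (≡.cong proj₁ e)) (I.strictlyInverseʳ x) ,
      Setoid.trans T (J.from-cong (≡.cong proj₂ e)) (J.strictlyInverseʳ y))
    where
    module I = Inverse I
    module J = Inverse J

module _ {S : Setoid c ℓ} where
  open Setoid S

  hasCardinality-unique : ∀ {m n} → S HasCardinality m → S HasCardinality n → m ≡ n
  hasCardinality-unique I J = Permutation.↔⇒≡ (InverseComposition.inverse (InverseSymmetry.inverse I) J)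

  hasCardinality-Maybe : ∀ {n} → S HasCardinality n → Maybe.setoid S HasCardinality suc n
  hasCardinality-Maybe I = inverse⁺
    (λ where nothing → zero ; (just x) → suc (I.to x))
    (λ where zero → nothing ; (suc i) → just (I.from i))
    (λ where Maybe.nothing → ≡.refl ; (Maybe.just e) → ≡.cong suc (I.to-cong e))
    (λ where ≡.refl → Maybe.refl refl)
    (λ where zero → ≡.refl ; (suc i) → ≡.cong suc (I.strictlyInverseˡ i))
    (λ where nothing → Maybe.nothing ; (just x) → Maybe.just (I.strictlyInverseʳ x))
    where module I = Inverse I

hasCardinality-RestrictFin : ∀ {n} (P : Fin n → Set ℓ₃) → (∀ i → Dec (P i)) →
  ∃[ k ] Restrict (≡.setoid (Fin n)) P HasCardinality k
hasCardinality-RestrictFin {n = zero}  P P? = 0 , inverse⁺ (λ where (() , _)) (λ where ())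
  (λ { {() , _} }) (λ { {()} }) (λ where ()) (λ where (() , _))
hasCardinality-RestrictFin {n = suc n} P P? = extend (P? zero) (hasCardinality-RestrictFin (P ∘ suc) (P? ∘ suc))
  where
  extend : Dec (P zero) → (∃[ k ] Restrict (≡.setoid (Fin n)) (P ∘ suc) HasCardinality k) →
    ∃[ k ] Restrict (≡.setoid (Fin (suc n))) P HasCardinality k
  extend (yes p) (k , I) = suc k , inverse⁺
    (λ where (zero , _) → zero ; (suc i , q) → suc (I.to (i , q)))
    (λ where zero → zero , p ; (suc j) → suc (proj₁ (I.from j)) , proj₂ (I.from j))
    (λ { {zero , _}  {zero , _}   _ → ≡.refl
       ; {suc i , _} {suc i′ , _} e → ≡.cong suc (I.to-cong (Fin.suc-injective e)) })
    (λ where ≡.refl → ≡.refl)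
    (λ where zero → ≡.refl ; (suc j) → ≡.cong suc (I.strictlyInverseˡ j))
    (λ where (zero , _) → ≡.refl ; (suc i , q) → ≡.cong suc (I.strictlyInverseʳ (i , q)))
    where module I = Inverse I
  extend (no ¬p) (k , I) = k , inverse⁺
    (λ where (zero , q) → contradiction q ¬p ; (suc i , q) → I.to (i , q))
    (λ j → suc (proj₁ (I.from j)) , proj₂ (I.from j))
    (λ { {zero , q}  {_}          _ → contradiction q ¬p
       ; {suc i , _} {zero , q}   _ → contradiction q ¬p
       ; {suc i , _} {suc i′ , _} e → I.to-cong (Fin.suc-injective e) })
    (λ where ≡.refl → ≡.refl)
    I.strictlyInverseˡ
    (λ where (zero , q) → contradiction q ¬p ; (suc i , q) → ≡.cong suc (I.strictlyInverseʳ (i , q)))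
    where module I = Inverse I

module _ {S : Setoid c ℓ} {n : ℕ} (I : S HasCardinality n) where
  open Setoid S
  private module I = Inverse I

  module _ {P : Carrier → Set ℓ₃} (P? : ∀ x → Dec (P x)) (resp : ∀ {x y} → x ≈ y → P x → P y) where

    hasCardinality-Restrict : ∃[ k ] Restrict S P HasCardinality k
    hasCardinality-Restrict =
      let k , J = hasCardinality-RestrictFin (P ∘ I.from) (P? ∘ I.from)
      in k , hasCardinality-resp (inverse⁺
        (λ (x , px) → I.to x , resp (sym (I.strictlyInverseʳ x)) px)
        (λ (i , pi) → I.from i , pi)
        I.to-cong I.from-cong
        (λ (i , _) → I.strictlyInverseˡ i)
        (λ (x , _) → I.strictlyInverseʳ x)) J

    any? : Dec (∃[ x ] P x)
    any? = map′ (λ (i , pi) → I.from i , pi) (λ (x , px) → I.to x , resp (sym (I.strictlyInverseʳ x)) px)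
      (Fin.any? (P? ∘ I.from))

injective⇒surjective-Fin : ∀ {n} (f : Fin n → Fin n) → (∀ {i j} → f i ≡ f j → i ≡ j) →
  ∀ y → ∃[ i ] f i ≡ y
injective⇒surjective-Fin {suc n} f inj y = search (Fin.any? (λ i → f i Fin.≟ y))
  where
  search : Dec (∃[ i ] f i ≡ y) → ∃[ i ] f i ≡ y
  search (yes found) = found
  search (no ¬found) = contradiction
    (Fin.injective⇒≤ {f = λ i → punchOut (avoids i)}
      (λ {i} {j} e → inj (Fin.punchOut-injective (avoids i) (avoids j) e))) ℕ.1+n≰n
    where
    avoids : ∀ i → y ≢ f i
    avoids i e = ¬found (i , ≡.sym e)

injective⇒surjective : {S : Setoid c ℓ} {n : ℕ} → S HasCardinality n → let open Setoid S in
  (f : Carrier → Carrier) → (∀ {x y} → x ≈ y → f x ≈ f y) → (∀ {x y} → f x ≈ f y → x ≈ y) →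
  ∀ y → ∃[ x ] f x ≈ y
injective⇒surjective {S = S} I f f-cong inj y =
  let i , e = injective⇒surjective-Fin (I.to ∘ f ∘ I.from)
        (λ e → I-from-injective (inj (I-to-injective e))) (I.to y)
  in I.from i , I-to-injective e
  where
  open Setoid S
  module I = Inverse I
  I-to-injective : ∀ {x y} → I.to x ≡ I.to y → x ≈ y
  I-to-injective e = trans (sym (I.strictlyInverseʳ _)) (trans (I.from-cong e) (I.strictlyInverseʳ _))
  I-from-injective : ∀ {i j} → I.from i ≈ I.from j → i ≡ j
  I-from-injective e = ≡.trans (≡.sym (I.strictlyInverseˡ _)) (≡.trans (I.to-cong e) (I.strictlyInverseˡ _))

module FiniteField (F : Field c ℓ) {q : ℕ} (I : Field.setoid F HasCardinality q) where
  open Field F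
  open FieldProperties F
  open Mult semiring using (×1-homo-*; ×-congˡ) renaming (_×_ to infixr 8 _⋆_)
  open FiniteSum +-commutativeMonoid using (sum; sum-permute; ∑-distrib-+; sum-replicate; sum-cong-≋)
  private module I = Inverse I

  -- Compare the sum of all elements with its translate by 1.
  q⋆1≈0 : q ⋆ 1# ≈ 0#
  q⋆1≈0 = begin
    q ⋆ 1#                        ≈⟨ +-identityˡ _ ⟨
    0# + q ⋆ 1#                   ≈⟨ +-congʳ (-‿inverseˡ total) ⟨
    - total + total + q ⋆ 1#      ≈⟨ +-assoc _ _ _ ⟩
    - total + (total + q ⋆ 1#)    ≈⟨ +-congˡ shifted ⟨
    - total + total               ≈⟨ -‿inverseˡ total ⟩
    0#                            ∎
    where
    open SetoidReasoning setoid
    total = sum I.from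

    cancel : ∀ x y z → y + z ≈ 0# → x + y + z ≈ x
    cancel x y z e = trans (+-assoc x y z) (trans (+-congˡ e) (+-identityʳ x))

    π : Permutation.Permutation q q
    π = inverse⁺ (λ i → I.to (I.from i + 1#)) (λ i → I.to (I.from i + - 1#))
      (≡.cong _) (≡.cong _)
      (λ i → ≡.trans (I.to-cong (trans (+-congʳ (I.strictlyInverseʳ _)) (cancel _ _ _ (-‿inverseˡ 1#)))) (I.strictlyInverseˡ i))
      (λ i → ≡.trans (I.to-cong (trans (+-congʳ (I.strictlyInverseʳ _)) (cancel _ _ _ (-‿inverseʳ 1#)))) (I.strictlyInverseˡ i))

    shifted : total ≈ total + q ⋆ 1#
    shifted = begin
      total                                   ≈⟨ sum-permute I.from π ⟩
      sum (λ i → I.from (I.to (I.from i + 1#))) ≈⟨ sum-cong-≋ (λ i → I.strictlyInverseʳ (I.from i + 1#)) ⟩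
      sum (λ i → I.from i + 1#)               ≈⟨ ∑-distrib-+ I.from (λ _ → 1#) ⟩
      total + sum {q} (λ _ → 1#)              ≈⟨ +-congˡ (sum-replicate q) ⟩
      total + q ⋆ 1#                          ∎

  characteristic-2 : ∀ m → q ≡ 2 ℕ.^ m → 1# + 1# ≈ 0#
  characteristic-2 m q≡2^m with (1# + 1#) ≟ 0#
  ... | yes e = e
  ... | no  e = contradiction (trans (sym (×-congˡ q≡2^m)) q⋆1≈0) (power m)
    where
    power : ∀ m → (2 ℕ.^ m) ⋆ 1# ≉ 0#
    power zero    z = 0≉1 (trans (sym z) (+-identityʳ 1#))
    power (suc m) z = *-nonzero (λ z′ → e (trans (+-congˡ (sym (+-identityʳ 1#))) z′)) (power m)
      (trans (sym (×1-homo-* 2 (2 ℕ.^ m))) z)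

  module _ (1+1≈0 : 1# + 1# ≈ 0#) where
    open CharacteristicTwo commutativeRing 1+1≈0

    square-injective : ∀ {x y} → x * x ≈ y * y → x ≈ y
    square-injective {x} {y} e = x+y≈0⇒x≈y (x²≈0⇒x≈0 (trans
      (solve 2 (λ x y → (x ⊕ y) ⊗ (x ⊕ y) ⊜ x ⊗ x ⊕ y ⊗ y) refl x y) (x≈y⇒x+y≈0 e)))

    square-surjective : ∀ x → ∃[ y ] y * y ≈ x
    square-surjective = injective⇒surjective I (λ x → x * x) (λ e → *-cong e e) square-injective

  Units : Setoid (c ⊔ ℓ) ℓ
  Units = Restrict setoid (_≉ 0#)

  units-cardinality : ∃[ k ] Units HasCardinality k × q ≡ suc k
  units-cardinality =
    let k , J = hasCardinality-Restrict I (λ x → ¬? (x ≟ 0#)) (λ e x≉0 y≈0 → x≉0 (trans e y≈0))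
    in k , J , hasCardinality-unique I (hasCardinality-resp split (hasCardinality-Maybe J))
    where
    module U = Setoid (Maybe.setoid Units)

    to : ∀ x → Dec (x ≈ 0#) → U.Carrier
    to x (yes _)   = nothing
    to x (no x≉0) = just (x , x≉0)

    from : U.Carrier → Carrier
    from nothing        = 0#
    from (just (x , _)) = x

    to-cong : ∀ {x y} → x ≈ y → ∀ dx dy → to x dx U.≈ to y dy
    to-cong e (yes _)   (yes _)   = Maybe.nothing
    to-cong e (yes x≈0) (no y≉0)  = contradiction (trans (sym e) x≈0) y≉0
    to-cong e (no x≉0)  (yes y≈0) = contradiction (trans e y≈0) x≉0
    to-cong e (no _)    (no _)    = Maybe.just e

    to-from : ∀ u d → to (from u) d U.≈ u
    to-from nothing          (yes _)   = Maybe.nothing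
    to-from nothing          (no 0≉0)  = contradiction refl 0≉0
    to-from (just (x , x≉0)) (yes x≈0) = contradiction x≈0 x≉0
    to-from (just (x , x≉0)) (no _)    = Maybe.just refl

    from-to : ∀ x d → from (to x d) ≈ x
    from-to x (yes x≈0) = sym x≈0
    from-to x (no _)    = refl

    split : Inverse setoid (Maybe.setoid Units)
    split = inverse⁺ (λ x → to x (x ≟ 0#)) from
      (λ {x} {y} e → to-cong e (x ≟ 0#) (y ≟ 0#))
      (λ where Maybe.nothing → refl ; (Maybe.just e) → e)
      (λ u → to-from u (from u ≟ 0#)) (λ x → from-to x (x ≟ 0#))

module _ (K : Field c ℓ) where
  open Field K

  add-self : ∀ W x y → y + y + Weierstrass.a₁ W * x + Weierstrass.a₃ W ≈ 0# → add K W (just (x , y)) (just (x , y)) ≡ nothing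
  add-self (weierstrass a₁ a₂ a₃ a₄ a₆) x y e with x ≟ x | (y + y + a₁ * x + a₃) ≟ 0#
  ... | yes _   | yes _ = ≡.refl
  ... | yes _   | no ¬e = contradiction e ¬e
  ... | no x≉x  | _     = contradiction refl x≉x

  module _ (1+1≈0 : 1# + 1# ≈ 0#)
    (algebraicallyClosed : ∀ n as → ∃[ x ] evalMonic K {suc n} as x ≈ 0#) where
    open FieldProperties K
    open CharacteristicTwo commutativeRing 1+1≈0

    -- The abscissa of a point of order 2 satisfies a₁ x = a₃.
    hasPointOfOrder2 : ∀ W → Weierstrass.a₁ W ≉ 0# → HasPointOfOrder2 K W
    hasPointOfOrder2 W@(weierstrass a₁ a₂ a₃ a₄ a₆) a₁≉0 = (x , y) , onCurve , add-self W x y order2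
      where
      x = a₁ ⁻¹ * a₃
      s = a₁ * x + a₃
      t = x * x * x + a₂ * x * x + a₄ * x + a₆
      root = algebraicallyClosed 1 (t ∷ s ∷ [])
      y = proj₁ root

      onCurve : OnCurve K W (x , y)
      onCurve = trans
        (solve 7 (λ x y a₁ a₂ a₃ a₄ a₆ →
          y ⊗ y ⊕ a₁ ⊗ x ⊗ y ⊕ a₃ ⊗ y ⊕ ⊖ (x ⊗ x ⊗ x ⊕ a₂ ⊗ x ⊗ x ⊕ a₄ ⊗ x ⊕ a₆)
          ⊜ x ⊗ x ⊗ x ⊕ a₂ ⊗ x ⊗ x ⊕ a₄ ⊗ x ⊕ a₆ ⊕ y ⊗ (a₁ ⊗ x ⊕ a₃ ⊕ y ⊗ :1)) refl x y a₁ a₂ a₃ a₄ a₆)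
        (proj₂ root)

      order2 : y + y + a₁ * x + a₃ ≈ 0#
      order2 = trans
        (solve 4 (λ y a i b → y ⊕ y ⊕ a ⊗ (i ⊗ b) ⊕ b ⊜ (a ⊗ i) ⊗ b ⊕ b) refl y a₁ (a₁ ⁻¹) a₃)
        (trans (+-congʳ (trans (*-congʳ (inverseʳ a₁≉0)) (*-identityˡ a₃))) (x+x≈0 a₃))

module _ (F : Field c ℓ) (1+1≈0 : CharTwo (Field.commutativeRing F)) where
  open Field F
  open FieldProperties F
  open FieldOfCharacteristicTwo F 1+1≈0

  supersingular⇒a₁≈0 : (F̄ : AlgebraicClosure F c′ ℓ′) (E : EllipticCurve F) → Supersingular F̄ E →
    Weierstrass.a₁ (coefficients E) ≈ 0#
  supersingular⇒a₁≈0 F̄ E supersingular with Weierstrass.a₁ (coefficients E) ≟ 0#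
  ... | yes a₁≈0 = a₁≈0
  ... | no  a₁≉0 = contradiction
    (hasPointOfOrder2 closure
      (K.trans (K.+-cong (K.sym ι.1#-homo) (K.sym ι.1#-homo))
        (K.trans (K.sym (ι.+-homo 1# 1#)) (K.trans (ι.⟦⟧-cong 1+1≈0) ι.0#-homo)))
      algebraicallyClosed
      (mapWeierstrass ι (coefficients E))
      λ ιa₁≈0 → K.0≉1 (K.trans (K.sym (K.zeroˡ _)) (K.trans (K.*-congʳ (K.sym ιa₁≈0))
        (K.trans (K.sym (ι.*-homo a₁ (a₁ ⁻¹))) (K.trans (ι.⟦⟧-cong (inverseʳ a₁≉0)) ι.1#-homo)))))
    supersingular
    where
    open AlgebraicClosure F̄
    open Weierstrass (coefficients E) using (a₁)
    module K = Field closure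
    module ι = IsRingHomomorphism ι-isHomomorphism

  nonsingular⇒a₃≉0 : ∀ W → Weierstrass.a₁ W ≈ 0# → discriminant F W ≉ 0# → Weierstrass.a₃ W ≉ 0#
  nonsingular⇒a₃≉0 (weierstrass a₁ a₂ a₃ a₄ a₆) a₁≈0 Δ≉0 a₃≈0 = Δ≉0 (trans
    (solve 5 (λ a₁ a₂ a₃ a₄ a₆ →
      let ×2 = λ x → x ⊕ x
          ×4 = λ x → x ⊕ x ⊕ x ⊕ x
          ×8 = λ x → ×4 x ⊕ x ⊕ x ⊕ x ⊕ x
          ×9 = λ x → ×8 x ⊕ x
          ×18 = λ x → ×9 x ⊕ x ⊕ x ⊕ x ⊕ x ⊕ x ⊕ x ⊕ x ⊕ x ⊕ x
          ×27 = λ x → ×18 x ⊕ x ⊕ x ⊕ x ⊕ x ⊕ x ⊕ x ⊕ x ⊕ x ⊕ x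
          b₂ = a₁ ⊗ a₁ ⊕ ×4 a₂
          b₄ = ×2 a₄ ⊕ a₁ ⊗ a₃
          b₆ = a₃ ⊗ a₃ ⊕ ×4 a₆
          b₈ = a₁ ⊗ a₁ ⊗ a₆ ⊕ ×4 (a₂ ⊗ a₆) ⊕ ⊖ (a₁ ⊗ a₃ ⊗ a₄) ⊕ a₂ ⊗ (a₃ ⊗ a₃) ⊕ ⊖ (a₄ ⊗ a₄)
      in ⊖ (b₂ ⊗ b₂ ⊗ b₈) ⊕ ⊖ ×8 (b₄ ⊗ b₄ ⊗ b₄) ⊕ ⊖ ×27 (b₆ ⊗ b₆) ⊕ ×9 (b₂ ⊗ b₄ ⊗ b₆)
        ⊜ a₁ ⊗ (a₁ ⊗ a₁ ⊗ a₁ ⊗ (a₁ ⊗ a₁ ⊗ a₆ ⊕ a₁ ⊗ a₃ ⊗ a₄ ⊕ a₂ ⊗ (a₃ ⊗ a₃) ⊕ a₄ ⊗ a₄) ⊕ a₁ ⊗ a₁ ⊗ a₃ ⊗ a₃ ⊗ a₃)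
          ⊕ a₃ ⊗ (a₃ ⊗ a₃ ⊗ a₃))
      refl a₁ a₂ a₃ a₄ a₆)
    (trans (+-cong (trans (*-congʳ a₁≈0) (zeroˡ _)) (trans (*-congʳ a₃≈0) (zeroˡ _))) (+-identityˡ 0#)))

  weierstrassCubic : Weierstrass Carrier → Cubic Carrier
  weierstrassCubic (weierstrass a₁ a₂ a₃ a₄ a₆) = cubic a₃ 1# a₂ a₄ a₆

  weierstrass-presents : ∀ W → Weierstrass.a₁ W ≈ 0# → Presents (equation W) (weierstrassCubic W)
  weierstrass-presents W@(weierstrass a₁ a₂ a₃ a₄ a₆) a₁≈0 = record
    { standard∼0 = Coordinate.∼-trans (standard∼equation (equation W)) Coordinate.curve
    ; W∼0 = Coordinate.∼-trans (Coordinate.∼-sym (standard∼equation (standard (weierstrassCubic W)))) Coordinate.curve }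
    where
    standard∼equation : ∀ V → Coordinate._∼_ F V (standard (weierstrassCubic W)) (equation W)
    standard∼equation V = R.trans
      (R₂.solve 6 (λ x y a₂ a₃ a₄ a₆ →
        y R₂.⊗ y R₂.⊕ a₃ R₂.⊗ y R₂.⊕ (R₂.:1 R₂.⊗ x R₂.⊗ x R₂.⊗ x R₂.⊕ a₂ R₂.⊗ x R₂.⊗ x R₂.⊕ a₄ R₂.⊗ x R₂.⊕ a₆)
        R₂.⊜ y R₂.⊗ y R₂.⊕ R₂.:0 R₂.⊗ x R₂.⊗ y R₂.⊕ a₃ R₂.⊗ y
          R₂.⊕ R₂.⊖ (x R₂.⊗ x R₂.⊗ x R₂.⊕ a₂ R₂.⊗ x R₂.⊗ x R₂.⊕ a₄ R₂.⊗ x R₂.⊕ a₆))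
        R.refl X Y (con a₂) (con a₃) (con a₄) (con a₆))
      (R.+-congʳ (R.+-congʳ (R.+-congˡ (R.*-congʳ (R.*-congʳ (con-cong (sym a₁≈0)))))))
      where open CoordinateRing V

  familyCubic : Carrier × Carrier → Cubic Carrier
  familyCubic (l , μ) = cubic 1# μ 0# l 0#

  family-presents : ∀ lμ → Presents (familyEquation F lμ) (familyCubic lμ)
  family-presents lμ@(l , μ) = record
    { standard∼0 = Coordinate.∼-trans (standard∼equation (familyEquation F lμ)) Coordinate.curve
    ; W∼0 = Coordinate.∼-trans (Coordinate.∼-sym (standard∼equation (standard (familyCubic lμ)))) Coordinate.curve }
    where
    standard∼equation : ∀ V → Coordinate._∼_ F V (standard (familyCubic lμ)) (familyEquation F lμ)
    standard∼equation V =
      R₂.solve 4 (λ x y l m →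
        y R₂.⊗ y R₂.⊕ R₂.:1 R₂.⊗ y R₂.⊕ (m R₂.⊗ x R₂.⊗ x R₂.⊗ x R₂.⊕ R₂.:0 R₂.⊗ x R₂.⊗ x R₂.⊕ l R₂.⊗ x R₂.⊕ R₂.:0)
        R₂.⊜ y R₂.⊗ y R₂.⊕ y R₂.⊕ R₂.⊖ (l R₂.⊗ x R₂.⊕ m R₂.⊗ x R₂.⊗ x R₂.⊗ x))
        R.refl X Y (con l) (con μ)
      where open CoordinateRing V

module Parametrisation (F : Field c ℓ) {q : ℕ} (I : Field.setoid F HasCardinality q)
  (1+1≈0 : CharTwo (Field.commutativeRing F)) (W : Weierstrass (Field.Carrier F))
  (a₁≈0 : Field._≈_ F (Weierstrass.a₁ W) (Field.0# F)) (a₃≉0 : Field._≉_ F (Weierstrass.a₃ W) (Field.0# F)) where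

  open Field F
  open FieldProperties F
  open FiniteField F I using (Units; square-injective; square-surjective)
  open FieldOfCharacteristicTwo F 1+1≈0
  open Transformations F 1+1≈0
  open Weierstrass W

  private
    κ : Cubic Carrier
    κ = weierstrassCubic F 1+1≈0 W

    κ′ : Carrier × Carrier → Cubic Carrier
    κ′ = familyCubic F 1+1≈0

  pairSetoid : Setoid c ℓ
  pairSetoid = ×-setoid setoid setoid

  FamilyTransformation : (Carrier × Carrier) × Substitution Carrier → Set ℓ
  FamilyTransformation ((l , μ) , σ) = μ ≉ 0# × Valid κ (κ′ (l , μ)) σ

  familyTransformations : Setoid (c ⊔ ℓ) ℓ
  familyTransformations = Restrict (×-setoid pairSetoid substitutionSetoid) FamilyTransformation

  affinePoints : Setoid (c ⊔ ℓ) ℓ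
  affinePoints = Restrict pairSetoid (OnCurve F W)

  -- Comparing coefficients of Y forces γ² a₃ = γ.
  γ₀ : Carrier
  γ₀ = a₃ ⁻¹

  √ : Carrier → Carrier
  √ x = proj₁ (square-surjective 1+1≈0 x)

  √-square : ∀ x → √ x * √ x ≈ x
  √-square x = proj₂ (square-surjective 1+1≈0 x)

  √-cong : ∀ {x y} → x ≈ y → √ x ≈ √ y
  √-cong e = square-injective 1+1≈0 (trans (√-square _) (trans e (sym (√-square _))))

  ⁻¹-cong : ∀ {x y} → x ≉ 0# → x ≈ y → x ⁻¹ ≈ y ⁻¹
  ⁻¹-cong x≉0 x≈y = *-cancelˡ x≉0 (trans (inverseʳ x≉0)
    (sym (trans (*-congʳ x≈y) (inverseʳ λ y≈0 → x≉0 (trans x≈y y≈0)))))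

  zero+ : ∀ {x y} → x ≈ 0# → y ≈ 0# → x + y ≈ 0#
  zero+ x≈0 y≈0 = trans (+-cong x≈0 y≈0) (+-identityˡ 0#)

  zero* : ∀ {x} y → x ≈ 0# → y * x ≈ 0#
  zero* y x≈0 = trans (*-congˡ x≈0) (zeroʳ y)

  equation-value : Carrier → Carrier → Carrier
  equation-value x y = y * y + a₃ * y + (1# * x * x * x + a₂ * x * x + a₄ * x + a₆)

  equation≈ : ∀ x y → eval F (equation W) x y ≈ equation-value x y
  equation≈ x y = trans
    (+-congʳ (+-congʳ (+-congˡ (*-congʳ (*-congʳ a₁≈0)))))
    (solve 6 (λ x y a₂ a₃ a₄ a₆ →
      y ⊗ y ⊕ :0 ⊗ x ⊗ y ⊕ a₃ ⊗ y ⊕ ⊖ (x ⊗ x ⊗ x ⊕ a₂ ⊗ x ⊗ x ⊕ a₄ ⊗ x ⊕ a₆)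
      ⊜ y ⊗ y ⊕ a₃ ⊗ y ⊕ (:1 ⊗ x ⊗ x ⊗ x ⊕ a₂ ⊗ x ⊗ x ⊕ a₄ ⊗ x ⊕ a₆)) refl x y a₂ a₃ a₄ a₆)

  δ₀ : Carrier → Carrier
  δ₀ x = γ₀ * √ (a₂ + x)

  μ₀ : Carrier → Carrier
  μ₀ α = γ₀ * γ₀ * (α ⁻¹ * α ⁻¹ * α ⁻¹)

  λ-numerator : Carrier → Carrier → Carrier → Carrier → Carrier → Carrier
  λ-numerator γ δ μ α β = γ * γ * a₄ + δ + μ * α * β * β

  λ₀ : Carrier → Carrier → Carrier
  λ₀ α x = α ⁻¹ * λ-numerator γ₀ (δ₀ x) (μ₀ α) α (α * x)

  σ₀ : Carrier → Carrier → Carrier → Substitution Carrier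
  σ₀ α x y = α , α * x , γ₀ , δ₀ x , γ₀ * y + δ₀ x * x

  μ₀-nonzero : ∀ {α} → α ≉ 0# → μ₀ α ≉ 0#
  μ₀-nonzero α≉0 = *-nonzero (*-nonzero γ₀≉0 γ₀≉0) (*-nonzero (*-nonzero α⁻¹≉0 α⁻¹≉0) α⁻¹≉0)
    where
    γ₀≉0 = ⁻¹-nonzero a₃≉0
    α⁻¹≉0 = ⁻¹-nonzero α≉0

  σ₀-valid : ∀ {α x y} → α ≉ 0# → OnCurve F W (x , y) → Valid κ (κ′ (λ₀ α x , μ₀ α)) (σ₀ α x y)
  σ₀-valid {α} {x} {y} α≉0 onCurve =
    α≉0 , ⁻¹-nonzero a₃≉0 ,
    trans (solve 10 (λ x y a₂ a₃ a₄ a₆ α i g r →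
        let δ = g ⊗ r
            μ = g ⊗ g ⊗ (i ⊗ i ⊗ i)
            β = α ⊗ x
            ε = g ⊗ y ⊕ δ ⊗ x
            N = g ⊗ g ⊗ a₄ ⊕ δ ⊕ μ ⊗ α ⊗ β ⊗ β
        in g ⊗ g ⊗ a₆ ⊕ ε ⊗ ε ⊕ :1 ⊗ ε ⊕ μ ⊗ β ⊗ β ⊗ β ⊕ :0 ⊗ β ⊗ β ⊕ i ⊗ N ⊗ β ⊕ :0
        ⊜ g ⊗ g ⊗ (y ⊗ y ⊕ a₃ ⊗ y ⊕ (:1 ⊗ x ⊗ x ⊗ x ⊕ a₂ ⊗ x ⊗ x ⊕ a₄ ⊗ x ⊕ a₆))
          ⊕ g ⊗ g ⊗ x ⊗ x ⊗ (r ⊗ r ⊕ (a₂ ⊕ x)) ⊕ g ⊗ y ⊗ (a₃ ⊗ g ⊕ :1) ⊕ N ⊗ x ⊗ (α ⊗ i ⊕ :1))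
        refl x y a₂ a₃ a₄ a₆ α (α ⁻¹) γ₀ ρ)
      (zero+ (zero+ (zero+ (zero* _ C≈0) (zero* _ ρ≈0)) (zero* _ γ≈0)) (zero* _ α≈0)) ,
    trans (solve 6 (λ x a₄ α i g r →
        let δ = g ⊗ r
            μ = g ⊗ g ⊗ (i ⊗ i ⊗ i)
            β = α ⊗ x
            N = g ⊗ g ⊗ a₄ ⊕ δ ⊕ μ ⊗ α ⊗ β ⊗ β
        in g ⊗ g ⊗ a₄ ⊕ :1 ⊗ δ ⊕ μ ⊗ α ⊗ β ⊗ β ⊕ i ⊗ N ⊗ α ⊜ N ⊗ (α ⊗ i ⊕ :1))
        refl x a₄ α (α ⁻¹) γ₀ ρ)
      (zero* _ α≈0) ,
    trans (solve 6 (λ x a₂ α i g r →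
        let μ = g ⊗ g ⊗ (i ⊗ i ⊗ i)
            w = α ⊗ i
        in g ⊗ g ⊗ a₂ ⊕ g ⊗ r ⊗ (g ⊗ r) ⊕ μ ⊗ α ⊗ α ⊗ (α ⊗ x) ⊕ :0 ⊗ α ⊗ α
        ⊜ g ⊗ g ⊗ (r ⊗ r ⊕ (a₂ ⊕ x)) ⊕ g ⊗ g ⊗ x ⊗ (w ⊗ w ⊕ w ⊕ :1) ⊗ (α ⊗ i ⊕ :1))
        refl x a₂ α (α ⁻¹) γ₀ ρ)
      (zero+ (zero* _ ρ≈0) (zero* _ α≈0)) ,
    trans (solve 3 (λ α i g →
        let w = α ⊗ i
        in g ⊗ g ⊗ :1 ⊕ g ⊗ g ⊗ (i ⊗ i ⊗ i) ⊗ α ⊗ α ⊗ α ⊜ g ⊗ g ⊗ (w ⊗ w ⊕ w ⊕ :1) ⊗ (α ⊗ i ⊕ :1))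
        refl α (α ⁻¹) γ₀)
      (zero* _ α≈0) ,
    trans (solve 2 (λ a₃ g → g ⊗ g ⊗ a₃ ⊕ :1 ⊗ g ⊜ g ⊗ (a₃ ⊗ g ⊕ :1)) refl a₃ γ₀) (zero* _ γ≈0)
    where
    ρ = √ (a₂ + x)
    C≈0 : equation-value x y ≈ 0#
    C≈0 = trans (sym (equation≈ x y)) onCurve
    ρ≈0 : ρ * ρ + (a₂ + x) ≈ 0#
    ρ≈0 = x≈y⇒x+y≈0 (√-square (a₂ + x))
    γ≈0 : a₃ * γ₀ + 1# ≈ 0#
    γ≈0 = x≈y⇒x+y≈0 (inverseʳ a₃≉0)
    α≈0 : α * α ⁻¹ + 1# ≈ 0#
    α≈0 = x≈y⇒x+y≈0 (inverseʳ α≉0)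

  divide : ∀ {x} y → x ≉ 0# → x * (x ⁻¹ * y) ≈ y
  divide y x≉0 = trans (sym (*-assoc _ _ y)) (trans (*-congʳ (inverseʳ x≉0)) (*-identityˡ y))

  divide′ : ∀ {x} y → x ≉ 0# → x ⁻¹ * (x * y) ≈ y
  divide′ y x≉0 = trans (sym (*-assoc _ _ y)) (trans (*-congʳ (inverseˡ x≉0)) (*-identityˡ y))

  -- The point that a transformation moves to the point (0 , 0) of the member.
  abscissa ordinate : Substitution Carrier → Carrier
  abscissa (α , β , γ , δ , ε) = α ⁻¹ * β
  ordinate σ@(α , β , γ , δ , ε) = γ ⁻¹ * (δ * abscissa σ + ε)

  module _ {l μ : Carrier} {α β γ δ ε : Carrier} (valid : Valid κ (κ′ (l , μ)) (α , β , γ , δ , ε)) where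
    private
      σ = α , β , γ , δ , ε
      x = abscissa σ
      y = ordinate σ
      α≉0 = proj₁ valid
      γ≉0 = proj₁ (proj₂ valid)
      o₁ = proj₁ (proj₂ (proj₂ valid))
      oX = proj₁ (proj₂ (proj₂ (proj₂ valid)))
      oX² = proj₁ (proj₂ (proj₂ (proj₂ (proj₂ valid))))
      oX³ = proj₁ (proj₂ (proj₂ (proj₂ (proj₂ (proj₂ valid)))))
      oY = proj₂ (proj₂ (proj₂ (proj₂ (proj₂ (proj₂ valid)))))

      open Evaluation {F = F} commutativeRing id (RingIdentity.isRingHomomorphism rawRing refl)
      open StandardSubstitution 1+1≈0

      image-x : α * x + β ≈ 0#
      image-x = x≈y⇒x+y≈0 (divide β α≉0)

      image-y : γ * y + δ * x + ε ≈ 0#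
      image-y = trans (+-assoc _ _ _) (x≈y⇒x+y≈0 (divide (δ * x + ε) γ≉0))

    point-onCurve : OnCurve F W (x , y)
    point-onCurve = trans (equation≈ x y) (xy≈0⇒y≈0 (*-nonzero γ≉0 γ≉0) (begin
      γ * γ * equation-value x y
        ≈⟨ +-identityʳ _ ⟨
      γ * γ * equation-value x y + 0#
        ≈⟨ +-congˡ (zero+ (zero+ (zero+ (zero+ o₁ (trans (*-congʳ oX) (zeroˡ x)))
             (trans (*-congʳ oX²) (zeroˡ _))) (trans (*-congʳ oX³) (zeroˡ _))) (trans (*-congʳ oY) (zeroˡ y))) ⟨
      _ ≈⟨ evaluate-standard-substitution κ (κ′ (l , μ)) α β γ δ ε x y ⟨
      evaluate (α * x + β) (γ * y + δ * x + ε) (standard (κ′ (l , μ)))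
        ≈⟨ evaluate-cong image-x image-y (standard (κ′ (l , μ))) ⟩
      evaluate 0# 0# (standard (κ′ (l , μ)))
        ≈⟨ solve 2 (λ l m → :0 ⊗ :0 ⊕ :1 ⊗ :0 ⊕ (m ⊗ :0 ⊗ :0 ⊗ :0 ⊕ :0 ⊗ :0 ⊗ :0 ⊕ l ⊗ :0 ⊕ :0) ⊜ :0) refl l μ ⟩
      0# ∎))
      where open SetoidReasoning setoid

    γ≈γ₀ : γ ≈ γ₀
    γ≈γ₀ = *-cancelˡ a₃≉0 (trans (x+y≈0⇒x≈y (xy≈0⇒y≈0 γ≉0
      (trans (solve 2 (λ a g → g ⊗ (a ⊗ g ⊕ :1) ⊜ g ⊗ g ⊗ a ⊕ :1 ⊗ g) refl a₃ γ) oY))) (sym (inverseʳ a₃≉0)))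

    β≈ : α * x ≈ β
    β≈ = divide β α≉0

    μα³≈γ² : μ * α * α * α ≈ γ * γ
    μα³≈γ² = sym (trans (sym (*-identityʳ _)) (x+y≈0⇒x≈y oX³))

    μ≈μ₀ : μ ≈ μ₀ α
    μ≈μ₀ = begin
      μ ≈⟨ trans (*-congˡ (trans (*-cong (*-cong αi αi) αi) (trans (*-identityʳ _) (*-identityʳ _)))) (*-identityʳ μ) ⟨
      μ * (α * α ⁻¹ * (α * α ⁻¹) * (α * α ⁻¹))
        ≈⟨ solve 3 (λ m a i → m ⊗ (a ⊗ i ⊗ (a ⊗ i) ⊗ (a ⊗ i)) ⊜ m ⊗ a ⊗ a ⊗ a ⊗ (i ⊗ i ⊗ i)) refl μ α (α ⁻¹) ⟩
      μ * α * α * α * (α ⁻¹ * α ⁻¹ * α ⁻¹)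
        ≈⟨ *-congʳ (trans μα³≈γ² (*-cong γ≈γ₀ γ≈γ₀)) ⟩
      μ₀ α ∎
      where
      open SetoidReasoning setoid
      αi = inverseʳ α≉0

    δ≈δ₀ : δ ≈ δ₀ x
    δ≈δ₀ = square-injective 1+1≈0 (begin
      δ * δ ≈⟨ x+y≈0⇒x≈y (trans (solve 6 (λ g a₂ d m a b →
          d ⊗ d ⊕ (g ⊗ g ⊗ a₂ ⊕ m ⊗ a ⊗ a ⊗ b) ⊜ g ⊗ g ⊗ a₂ ⊕ d ⊗ d ⊕ m ⊗ a ⊗ a ⊗ b ⊕ :0 ⊗ a ⊗ a) refl γ a₂ δ μ α β) oX²) ⟩
      γ * γ * a₂ + μ * α * α * β ≈⟨ +-congˡ (trans (*-congˡ (sym β≈)) (sym (*-assoc _ α x))) ⟩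
      γ * γ * a₂ + μ * α * α * α * x ≈⟨ +-congˡ (*-congʳ μα³≈γ²) ⟩
      γ * γ * a₂ + γ * γ * x ≈⟨ distribˡ _ a₂ x ⟨
      γ * γ * (a₂ + x) ≈⟨ *-cong (*-cong γ≈γ₀ γ≈γ₀) (sym (√-square (a₂ + x))) ⟩
      γ₀ * γ₀ * (√ (a₂ + x) * √ (a₂ + x)) ≈⟨ solve 2 (λ g r → g ⊗ g ⊗ (r ⊗ r) ⊜ g ⊗ r ⊗ (g ⊗ r)) refl γ₀ (√ (a₂ + x)) ⟩
      δ₀ x * δ₀ x ∎)
      where open SetoidReasoning setoid

    ε≈ : γ₀ * y + δ₀ x * x ≈ ε
    ε≈ = begin
      γ₀ * y + δ₀ x * x ≈⟨ +-cong (*-congʳ γ≈γ₀) (*-congʳ δ≈δ₀) ⟨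
      γ * y + δ * x ≈⟨ x+y≈0⇒x≈y image-y ⟩
      ε ∎
      where open SetoidReasoning setoid

    λ≈λ₀ : l ≈ λ₀ α x
    λ≈λ₀ = begin
      l ≈⟨ divide′ l α≉0 ⟨
      α ⁻¹ * (α * l) ≈⟨ *-congˡ (x+y≈0⇒x≈y (trans (solve 7 (λ g a₄ d m a b l →
          a ⊗ l ⊕ (g ⊗ g ⊗ a₄ ⊕ d ⊕ m ⊗ a ⊗ b ⊗ b)
          ⊜ g ⊗ g ⊗ a₄ ⊕ :1 ⊗ d ⊕ m ⊗ a ⊗ b ⊗ b ⊕ l ⊗ a) refl γ a₄ δ μ α β l) oX)) ⟩
      α ⁻¹ * λ-numerator γ δ μ α β
        ≈⟨ *-congˡ (+-cong (+-cong (*-congʳ (*-cong γ≈γ₀ γ≈γ₀)) δ≈δ₀)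
             (*-cong (*-cong (*-congʳ μ≈μ₀) (sym β≈)) (sym β≈))) ⟩
      λ₀ α x ∎
      where open SetoidReasoning setoid

  module _ {α α′ x x′ y y′ : Carrier} (α≉0 : α ≉ 0#) (α≈ : α ≈ α′) (x≈ : x ≈ x′) (y≈ : y ≈ y′) where
    private
      i≈ = ⁻¹-cong α≉0 α≈

    δ₀-cong : δ₀ x ≈ δ₀ x′
    δ₀-cong = *-congˡ (√-cong (+-congˡ x≈))

    μ₀-cong : μ₀ α ≈ μ₀ α′
    μ₀-cong = *-congˡ (*-cong (*-cong i≈ i≈) i≈)

    λ₀-cong : λ₀ α x ≈ λ₀ α′ x′
    λ₀-cong = *-cong i≈ (+-cong (+-congˡ δ₀-cong)
      (*-cong (*-cong (*-cong μ₀-cong α≈) (*-cong α≈ x≈)) (*-cong α≈ x≈)))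

    σ₀-cong : σ₀ α x y Sub.≈ σ₀ α′ x′ y′
    σ₀-cong = α≈ , *-cong α≈ x≈ , refl , δ₀-cong , +-cong (*-congˡ y≈) (*-cong δ₀-cong x≈)

  -- A transformation is determined by α and by the point that it moves to (0 , 0).
  familyTransformations↔ : Inverse familyTransformations (×-setoid Units affinePoints)
  familyTransformations↔ = inverse⁺
    (λ where ((lμ , σ) , _ , valid) → (proj₁ σ , proj₁ valid) , ((abscissa σ , ordinate σ) , point-onCurve valid))
    (λ where ((α , α≉0) , ((x , y) , onCurve)) →
               ((λ₀ α x , μ₀ α) , σ₀ α x y) , μ₀-nonzero α≉0 , σ₀-valid α≉0 onCurve)
    (λ { {_ , _ , valid} {_} (_ , α≈ , β≈ , γ≈ , δ≈ , ε≈) →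
         let x≈ = *-cong (⁻¹-cong (proj₁ valid) α≈) β≈
         in α≈ , x≈ , *-cong (⁻¹-cong (proj₁ (proj₂ valid)) γ≈) (+-cong (*-cong δ≈ x≈) ε≈) })
    (λ { {(α , α≉0) , _} {_} (α≈ , x≈ , y≈) →
         (λ₀-cong α≉0 α≈ x≈ y≈ , μ₀-cong α≉0 α≈ x≈ y≈) , σ₀-cong α≉0 α≈ x≈ y≈ })
    (λ where ((α , α≉0) , ((x , y) , onCurve)) →
               let x≈ = divide′ x α≉0
                   γ₀≉0 = ⁻¹-nonzero a₃≉0
               in refl , x≈ , trans (*-congˡ (trans (+-congʳ (*-congˡ x≈))
                    (solve 3 (λ d x g → d ⊗ x ⊕ (g ⊕ d ⊗ x) ⊜ g) refl (δ₀ x) x (γ₀ * y)))) (divide′ y γ₀≉0))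
    (λ where (((l , μ) , (α , β , γ , δ , ε)) , _ , valid) →
               (sym (λ≈λ₀ valid) , sym (μ≈μ₀ valid)) ,
               refl , β≈ valid , sym (γ≈γ₀ valid) , sym (δ≈δ₀ valid) , ε≈ valid)

module Isomorphisms (F : Field c ℓ) (1+1≈0 : CharTwo (Field.commutativeRing F)) where
  open Field F hiding (_⁻¹; inverseʳ)
  open FieldOfCharacteristicTwo F 1+1≈0
  open Transformations F 1+1≈0 using (substitute-XY)
  open Isomorphism

  infixr 9 _⨟_

  _⨟_ : ∀ {W W′ W″} → Isomorphism F W W′ → Isomorphism F W′ W″ → Isomorphism F W W″
  _⨟_ {W} φ ψ = record
    { pullback = pullback φ ∘ pullback ψ
    ; isRingIsomorphism = RingComposition.isRingIsomorphism R.trans (isRingIsomorphism ψ) (isRingIsomorphism φ)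
    ; fixes-constants = λ a → R.trans (φ.⟦⟧-cong (fixes-constants ψ a)) (fixes-constants φ a)
    }
    where
    module R = CommutativeRing (coordinateRing F W)
    module φ = IsRingIsomorphism (isRingIsomorphism φ)

  module _ {W W′ : Poly Carrier} (φ : Isomorphism F W W′) where
    private
      module R = CommutativeRing (coordinateRing F W)
      module R′ = CommutativeRing (coordinateRing F W′)
      open CoordinateRing using (R-1+1≈0)
      open IsRingIsomorphism (isRingIsomorphism φ)

    pushforward : R.Carrier → R′.Carrier
    pushforward p = proj₁ (surjective p)

    pullback-pushforward : ∀ p → pullback φ (pushforward p) R.≈ p
    pullback-pushforward p = proj₂ (surjective p) R′.refl

    pushforward-pullback : ∀ p → pushforward (pullback φ p) R′.≈ p
    pushforward-pullback p = injective (pullback-pushforward (pullback φ p))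

    inverse : Isomorphism F W′ W
    inverse = record
      { pullback = pushforward
      ; isRingIsomorphism = record
        { isRingMonomorphism = record
          { isRingHomomorphism = isRingHomomorphism₂ {R = coordinateRing F W} {S = coordinateRing F W′}
              (R-1+1≈0 W) (R-1+1≈0 W′)
              (λ {p} {q} e → injective (R.trans (pullback-pushforward p) (R.trans e (R.sym (pullback-pushforward q)))))
              (λ p q → injective (R.trans (pullback-pushforward (p :+ q)) (R.sym (R.trans (+-homo _ _)
                (R.+-cong (pullback-pushforward p) (pullback-pushforward q))))))
              (injective (R.trans (pullback-pushforward _) (R.sym (fixes-constants φ 0#))))
              (λ p q → injective (R.trans (pullback-pushforward (p :* q)) (R.sym (R.trans (*-homo _ _)
                (R.*-cong (pullback-pushforward p) (pullback-pushforward q))))))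
              (injective (R.trans (pullback-pushforward _) (R.sym (fixes-constants φ 1#))))
          ; injective = λ {p} {q} e → R.trans (R.sym (pullback-pushforward p))
              (R.trans (⟦⟧-cong e) (pullback-pushforward q))
          }
        ; surjective = λ y → pullback φ y , λ e → injective (R.trans (pullback-pushforward _) e)
        }
      ; fixes-constants = λ a → injective (R.trans (pullback-pushforward _) (R.sym (fixes-constants φ a)))
      }

  module _ (W W′ : Poly Carrier) (W′∼0 : Coordinate._∼_ F W W′ (con 0#)) (W∼0 : Coordinate._∼_ F W′ W (con 0#)) where
    private
      weaken : ∀ {V V′} → Coordinate._∼_ F V′ V (con 0#) → ∀ {p q} → Coordinate._∼_ F V p q → Coordinate._∼_ F V′ p q
      weaken {V} {V′} V∼0 {p} {q} e = ≡.subst₂ (Coordinate._∼_ F V′) (substitute-XY p) (substitute-XY q)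
        (CoordinateRing.Ev.evaluate-resp V′ (≡.subst (λ V → Coordinate._∼_ F V′ V (con 0#)) (≡.sym (substitute-XY V)) V∼0) e)
      module R = CoordinateRing.R W

    sameCurve : Isomorphism F W W′
    sameCurve = record
      { pullback = id
      ; isRingIsomorphism = record
        { isRingMonomorphism = record
          { isRingHomomorphism = isRingHomomorphism₂ {R = coordinateRing F W′} {S = coordinateRing F W}
              (CoordinateRing.R-1+1≈0 W′) (CoordinateRing.R-1+1≈0 W)
              (weaken W′∼0) (λ _ _ → R.refl) R.refl (λ _ _ → R.refl) R.refl
          ; injective = weaken W∼0
          }
        ; surjective = λ y → y , weaken W′∼0
        }
      ; fixes-constants = λ a → R.refl
      }

  identity : ∀ W → Isomorphism F W W
  identity W = sameCurve W W Coordinate.curve Coordinate.curve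

  family-cong : ∀ {l l′ μ μ′} → l ≈ l′ → μ ≈ μ′ → ∀ V →
    Coordinate._∼_ F V (familyEquation F (l , μ)) (familyEquation F (l′ , μ′))
  family-cong l≈ μ≈ V = R.+-congˡ (R.-‿cong (R.+-cong (R.*-congʳ (con-cong l≈))
    (R.*-congʳ (R.*-congʳ (R.*-congʳ (con-cong μ≈))))))
    where open CoordinateRing V

  sameMember : ∀ {l l′ μ μ′} → l ≈ l′ → μ ≈ μ′ →
    Isomorphism F (familyEquation F (l , μ)) (familyEquation F (l′ , μ′))
  sameMember l≈ μ≈ = sameCurve _ _
    (Coordinate.∼-trans (family-cong (sym l≈) (sym μ≈) _) Coordinate.curve)
    (Coordinate.∼-trans (family-cong l≈ μ≈ _) Coordinate.curve)

module Counting (F : Field c ℓ) {q : ℕ} (I : Field.setoid F HasCardinality q)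
  (1+1≈0 : CharTwo (Field.commutativeRing F)) (E : EllipticCurve F)
  (a₁≈0 : Field._≈_ F (Weierstrass.a₁ (coefficients E)) (Field.0# F)) where

  open Field F
  open FieldOfCharacteristicTwo F 1+1≈0
  open Transformations F 1+1≈0
  open Isomorphisms F 1+1≈0
  open Isomorphism

  private
    W = coefficients E
    WE = equation W
    a₃≉0 = nonsingular⇒a₃≉0 F 1+1≈0 W a₁≈0 (nonsingular E)
    PE = weierstrass-presents F 1+1≈0 W a₁≈0
    κE = weierstrassCubic F 1+1≈0 W
    1≉0 : 1# ≉ 0#
    1≉0 e = 0≉1 (sym e)

    family : Carrier × Carrier → Poly Carrier
    family = familyEquation F

    Pfam : ∀ lμ → Presents (family lμ) (familyCubic F 1+1≈0 lμ)
    Pfam = family-presents F 1+1≈0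

  open Parametrisation F I 1+1≈0 W a₁≈0 a₃≉0
  open NormalForm F 1+1≈0 PE using (module R)

  pair-cardinality : pairSetoid HasCardinality (q ℕ.* q)
  pair-cardinality = hasCardinality-× I I

  substitution-cardinality : substitutionSetoid HasCardinality (q ℕ.* (q ℕ.* (q ℕ.* (q ℕ.* q))))
  substitution-cardinality = hasCardinality-× I (hasCardinality-× I (hasCardinality-× I pair-cardinality))

  automorphism-cardinality : ∃[ a ] automorphisms E HasCardinality a
  automorphism-cardinality =
    let a , J = hasCardinality-Restrict substitution-cardinality (valid? κE κE) (valid-resp κE κE)
    in a , hasCardinality-resp (isomorphisms↔valid PE PE refl 1≉0) J

  Member : Carrier × Carrier → Set (c ⊔ ℓ)
  Member lμ = proj₂ lμ ≉ 0# × Isomorphism F (family lμ) WE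

  member-resp : ∀ {lμ l′μ′} → Setoid._≈_ pairSetoid lμ l′μ′ → Member lμ → Member l′μ′
  member-resp (l≈ , μ≈) (μ≉0 , χ) = (λ e → μ≉0 (trans μ≈ e)) , sameMember (sym l≈) (sym μ≈) ⨟ χ

  isomorphic? : ∀ lμ → proj₂ lμ ≉ 0# → Dec (Isomorphism F (family lμ) WE)
  isomorphic? lμ μ≉0 = map′
    (λ (σ , valid) → inverse (toIsomorphism PE (Pfam lμ) σ valid))
    (λ χ → parameters PE (Pfam lμ) refl μ≉0 (inverse χ) , parameters-valid PE (Pfam lμ) refl μ≉0 (inverse χ))
    (any? substitution-cardinality (valid? κE (familyCubic F 1+1≈0 lμ)) (valid-resp κE (familyCubic F 1+1≈0 lμ)))

  member? : ∀ lμ → Dec (Member lμ)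
  member? lμ = decide (proj₂ lμ ≟ 0#)
    where
    decide : Dec (proj₂ lμ ≈ 0#) → Dec (Member lμ)
    decide (yes μ≈0) = no λ (μ≉0 , _) → μ≉0 μ≈0
    decide (no μ≉0)  = map′ (μ≉0 ,_) proj₂ (isomorphic? lμ μ≉0)

  member-cardinality : ∃[ N ] isomorphicMembers E HasCardinality N
  member-cardinality = hasCardinality-Restrict pair-cardinality member? member-resp

  affine-cardinality : ∃[ k ] affinePoints HasCardinality k
  affine-cardinality = hasCardinality-Restrict pair-cardinality (λ _ → _ ≟ 0#) onCurve-resp
    where
    onCurve-resp : ∀ {P Q} → Setoid._≈_ pairSetoid P Q → OnCurve F W P → OnCurve F W Q
    onCurve-resp {x , y} {x′ , y′} (x≈ , y≈) e = trans (sym (trans (equation≈ x y)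
      (trans (evaluate-cong x≈ y≈ (standard κE)) (sym (equation≈ x′ y′))))) e
      where open Evaluation {F = F} commutativeRing id (RingIdentity.isRingHomomorphism rawRing refl)

  module Torsor {N : ℕ} (J : isomorphicMembers E HasCardinality N) where
    private
      module J = Inverse J
      module A = Setoid (automorphisms E)
      module T = Setoid familyTransformations
      index = ≡.setoid (Fin N)
      module B = Setoid (×-setoid index (automorphisms E))

    pair : Fin N → Carrier × Carrier
    pair i = proj₁ (J.from i)

    μ≉0 : ∀ i → proj₂ (pair i) ≉ 0#
    μ≉0 i = proj₁ (proj₂ (J.from i))

    χ : ∀ i → Isomorphism F (family (pair i)) WE
    χ i = proj₂ (proj₂ (J.from i))

    isomorphism : (t : T.Carrier) → Isomorphism F WE (family (proj₁ (proj₁ t)))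
    isomorphism ((lμ , σ) , _ , valid) = toIsomorphism PE (Pfam lμ) σ valid

    indexOf : T.Carrier → Fin N
    indexOf t@((lμ , σ) , μ≉0 , valid) = J.to (lμ , μ≉0 , inverse (isomorphism t))

    toRepresentative : (t : T.Carrier) → Isomorphism F WE (family (pair (indexOf t)))
    toRepresentative t@((lμ , σ) , μ≉0 , valid) =
      let l≈ , μ≈ = J.strictlyInverseʳ (lμ , μ≉0 , inverse (isomorphism t))
      in isomorphism t ⨟ sameMember (sym l≈) (sym μ≈)

    automorphism : T.Carrier → A.Carrier
    automorphism t = toRepresentative t ⨟ χ (indexOf t)

    transformation : B.Carrier → T.Carrier
    transformation (i , φ) =
      let ψ = φ ⨟ inverse (χ i)
      in (pair i , parameters PE (Pfam (pair i)) refl (μ≉0 i) ψ) , μ≉0 i , parameters-valid PE (Pfam (pair i)) refl (μ≉0 i) ψ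

    χ-cong : ∀ {i j} → i ≡ j → ∀ p → pullback (χ i) p ≡ pullback (χ j) p
    χ-cong ≡.refl p = ≡.refl

    automorphism-cong : ∀ {t t′} → t T.≈ t′ → automorphism t A.≈ automorphism t′
    automorphism-cong {t} {t′} e@((l≈ , μ≈) , σ≈) p = R.trans
      (R.reflexive (≡.cong (pullback (isomorphism t)) (χ-cong (J.to-cong {_} {_} (l≈ , μ≈)) p)))
      (substitute-image-cong PE (Pfam (proj₁ (proj₁ t))) refl (proj₁ (proj₂ t)) σ≈ (pullback (χ (indexOf t′)) p))

    transformation-cong : ∀ {x y} → x B.≈ y → transformation x T.≈ transformation y
    transformation-cong {i , φ} {_ , ψ} (≡.refl , e) = (refl , refl) ,
      parameters-cong PE (Pfam (pair i)) refl (μ≉0 i) {φ ⨟ inverse (χ i)} {ψ ⨟ inverse (χ i)}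
        (λ p → e (pullback (inverse (χ i)) p))

    indexOf-transformation : ∀ x → indexOf (transformation x) ≡ proj₁ x
    indexOf-transformation (i , φ) = J.inverseˡ (refl , refl)

    isomorphism-transformation : ∀ i φ p →
      pullback (isomorphism (transformation (i , φ))) p R.≈ pullback φ (pushforward (χ i) p)
    isomorphism-transformation i φ p =
      R.sym (pullback≈substitute PE (Pfam (pair i)) refl (μ≉0 i) (φ ⨟ inverse (χ i)) p)

    automorphism-transformation₁ : ∀ x p → pullback (automorphism (transformation x)) p
      R.≈ pullback (isomorphism (transformation x)) (pullback (χ (proj₁ x)) p)
    automorphism-transformation₁ x p = R.reflexive
      (≡.cong (pullback (isomorphism (transformation x))) (χ-cong (indexOf-transformation x) p))

    automorphism-transformation₂ : ∀ i φ p →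
      pullback φ (pushforward (χ i) (pullback (χ i) p)) R.≈ pullback φ p
    automorphism-transformation₂ i φ p = IsRingIsomorphism.⟦⟧-cong (isRingIsomorphism φ) (pushforward-pullback (χ i) p)

    automorphism-transformation : ∀ x → automorphism (transformation x) A.≈ proj₂ x
    automorphism-transformation (i , φ) p =
      R.trans {pullback (automorphism (transformation (i , φ))) p}
              {pullback (isomorphism (transformation (i , φ))) (pullback (χ i) p)}
              {pullback φ p}
        (automorphism-transformation₁ (i , φ) p)
      (R.trans {pullback (isomorphism (transformation (i , φ))) (pullback (χ i) p)}
               {pullback φ (pushforward (χ i) (pullback (χ i) p))}
               {pullback φ p}
        (isomorphism-transformation i φ (pullback (χ i) p))
        (automorphism-transformation₂ i φ p))

    transformation-automorphism : ∀ t → transformation (indexOf t , automorphism t) T.≈ t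
    transformation-automorphism t@((lμ , σ) , μ≉0′ , valid) =
      J.strictlyInverseʳ (lμ , μ≉0′ , inverse (isomorphism t)) ,
      Sub.trans
        {parameters PE (Pfam (pair i)) refl (μ≉0 i) (automorphism t ⨟ inverse (χ i))}
        {parameters PE (Pfam (pair i)) refl (μ≉0 i) (toRepresentative t)}
        (parameters-cong PE (Pfam (pair i)) refl (μ≉0 i) {automorphism t ⨟ inverse (χ i)} {toRepresentative t}
          (λ p → IsRingIsomorphism.⟦⟧-cong (isRingIsomorphism (toRepresentative t)) (pullback-pushforward (χ i) p)))
        (parameters-toIsomorphism PE (Pfam lμ) refl μ≉0′ σ valid)
      where i = indexOf t

    -- The isomorphisms from E to a fixed member form a torsor under Aut(E).
    torsor : Inverse familyTransformations (×-setoid index (automorphisms E))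
    torsor = inverse⁺ (λ t → indexOf t , automorphism t) transformation
      (λ {t} {t′} e → J.to-cong (proj₁ e) , automorphism-cong {t} {t′} e)
      (λ {x} {y} → transformation-cong {x} {y})
      (λ x → indexOf-transformation x , automorphism-transformation x)
      transformation-automorphism

  count : ∀ {N k u a} → isomorphicMembers E HasCardinality N → affinePoints HasCardinality k →
    FiniteField.Units F I HasCardinality u → automorphisms E HasCardinality a → N ℕ.* a ≡ u ℕ.* k
  count J K U A = hasCardinality-unique
    (hasCardinality-resp (Torsor.torsor J) (hasCardinality-× (InverseIdentity.inverse _) A))
    (hasCardinality-resp familyTransformations↔ (hasCardinality-× U K))

  automorphism-nonZero : ∀ {a} → automorphisms E HasCardinality a → NonZero a
  automorphism-nonZero {zero}  A with Inverse.to A (identity WE)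
  ... | ()
  automorphism-nonZero {suc a} A = _

quotient : ∀ N a u k .{{_ : NonZero a}} → N ℕ.* a ≡ u ℕ.* k →
  (+ N) / 1 ≡ ((+ suc u ℤ.- + 1) ℤ.* (+ suc k ℤ.- + 1)) / a
quotient N (suc a) u k e = ℚ.fromℚᵘ-cong {mkℚᵘ (+ N) 0} {mkℚᵘ (+ u ℤ.* + k) a} (*≡* (begin
  + N ℤ.* + suc a          ≡⟨ ℤ.pos-* N (suc a) ⟨
  + (N ℕ.* suc a)          ≡⟨ ≡.cong +_ e ⟩
  + (u ℕ.* k)              ≡⟨ ℤ.pos-* u k ⟩
  + u ℤ.* + k              ≡⟨ ℤ.*-identityʳ _ ⟨
  + u ℤ.* + k ℤ.* + 1      ∎))
  where open ≡.≡-Reasoning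

proposition4p2 : ∀ {c ℓ c′ ℓ′} (F : Field c ℓ) (m q : ℕ) →
    1 ≤ m → q ≡ 2 ^ m → 4 < q →
    Field.setoid F HasCardinality q →
    (F̄ : AlgebraicClosure F c′ ℓ′) (E : EllipticCurve F) →
    Supersingular F̄ E →
    ∃[ N ] ∃[ n ] ∃[ a ]
    isomorphicMembers E HasCardinality N ×
    rationalPoints E HasCardinality n ×
    automorphisms E HasCardinality a ×
    Σ[ a≢0 ∈ NonZero a ]
    ((+ N) / 1 ≡ _/_ ((+ q ℤ.- + 1) ℤ.* (+ n ℤ.- + 1)) a {{a≢0}})
proposition4p2 F m q _ q≡2^m _ I F̄ E supersingular =
  N , suc k , a , J , hasCardinality-Maybe K , A , a≢0 ,
  ≡.subst (λ q → (+ N) / 1 ≡ _/_ ((+ q ℤ.- + 1) ℤ.* (+ suc k ℤ.- + 1)) a {{a≢0}}) (≡.sym q≡1+u)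
    (quotient N a u k {{a≢0}} (count J K U A))
  where
  1+1≈0 = FiniteField.characteristic-2 F I m q≡2^m
  open Counting F I 1+1≈0 E (supersingular⇒a₁≈0 F 1+1≈0 F̄ E supersingular)
  N = proj₁ member-cardinality
  J = proj₂ member-cardinality
  k = proj₁ affine-cardinality
  K = proj₂ affine-cardinality
  a = proj₁ automorphism-cardinality
  A = proj₂ automorphism-cardinality
  a≢0 = automorphism-nonZero A
  u = proj₁ (FiniteField.units-cardinality F I)
  U = proj₁ (proj₂ (FiniteField.units-cardinality F I))
  q≡1+u = proj₂ (proj₂ (FiniteField.units-cardinality F I))
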